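{- For every integer $r \geq 1$ there exists a polynomial $\tilde P_r$ with $\deg \tilde P_r \leq 3r-3$ such that the generating function $$F_r(t) = \sum_{n=r+1}^\infty M_n^{(n-r)} t^n$$ satisfies, after the change of variables $t = w/(1+w)^2$, the identity of formal power series in $w$ $$F_r\!\left(\frac{w}{(1+w)^2}\right) = \sum_{n=r+1}^\infty M_n^{(n-r)} \frac{w^n}{(1+w)^{2n}} = \frac{w^{r+1}(1+w)}{(1-w)^{2r-1}}\, \tilde P_r(w).$$
   Context: For $n \geq 1$, let $NC_2(2n)$ denote the set of non-crossing pair partitions (perfect matchings with no two pairs $\{a,b\},\{c,d\}$ satisfying $a<c<b<d$) of $\{1,\dots,2n\}$. A meandric system on $2n$ points is a pair $(P,Q) \in NC_2(2n)^2$ (thought of as arches drawn above and below a horizontal line through $2n$ points); its loops are the connected components of the graph on vertex set $\{1,\dots,2n\}$ whose edge multiset is the union of the pairs of $P$ and of $Q$ (each component is a cycle). $M_n^{(k)}$ denotes the number of meandric systems on $2n$ points having exactly $k$ loops. -}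

module Defs where

open import Data.Bool using (Bool; true; false; _∧_; _∨_; not; if_then_else_)
open import Data.Nat as ℕ using (ℕ; zero; suc; _∸_; _≤ᵇ_; _<ᵇ_; _≡ᵇ_)
open import Data.Fin using (Fin; toℕ)
open import Data.Fin.Properties using (_≟_)
open import Data.Bool.ListAction using (all)
open import Data.List using (List; []; _∷_; [_]; map; concatMap; allFin; filterᵇ; length; _++_)
open import Data.Vec as V using (Vec; lookup)
open import Data.Integer as ℤ using (ℤ; +_; -_)
open import Relation.Nullary.Decidable using (⌊_⌋)
open import Relation.Binary.PropositionalEquality using (_≡_)
import Data.Product

allVecs : {A : Set} → List A → (k : ℕ) → List (Vec A k)
allVecs xs zero    = [ V.[] ]
allVecs xs (suc k) = concatMap (λ x → map (x V.∷_) (allVecs xs k)) xs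

allMaps : (m : ℕ) → List (Vec (Fin m) m)
allMaps m = allVecs (allFin m) m

_<F_ : {m : ℕ} → Fin m → Fin m → Bool
i <F j = toℕ i <ᵇ toℕ j

_==F_ : {m : ℕ} → Fin m → Fin m → Bool
i ==F j = ⌊ i ≟ j ⌋

-- p (given as a table) is a pair partition of {0..m-1}:
-- a fixed-point-free involution, i.e. every i is paired with p i ≠ i.
isPairPartition : {m : ℕ} → Vec (Fin m) m → Bool
isPairPartition {m} p =
  all (λ i → not (lookup p i ==F i) ∧ (lookup p (lookup p i) ==F i)) (allFin m)

isNonCrossing : {m : ℕ} → Vec (Fin m) m → Bool
isNonCrossing {m} p =
  all (λ a → all (λ c → not ((a <F c) ∧ (c <F lookup p a) ∧ (lookup p a <F lookup p c)))
                 (allFin m))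
      (allFin m)

NC₂ : (m : ℕ) → List (Vec (Fin m) m)
NC₂ m = filterᵇ (λ p → isPairPartition p ∧ isNonCrossing p) (allMaps m)

-- Connected components of the graph on {0..m-1} whose edges are the
-- pairs {j, p j} and {j, q j}.  One closure step adds all neighbours.
closeStep : {m : ℕ} → Vec (Fin m) m → Vec (Fin m) m → (Fin m → Bool) → (Fin m → Bool)
closeStep p q S j = S j ∨ S (lookup p j) ∨ S (lookup q j)

iterate : {A : Set} → ℕ → (A → A) → A → A
iterate zero    f x = x
iterate (suc k) f x = f (iterate k f x)

-- component p q i j = true iff j is connected to i (a walk in a graph on m
-- vertices can always be shortened to length < m, so m closure steps suffice).
component : {m : ℕ} → Vec (Fin m) m → Vec (Fin m) m → Fin m → Fin m → Bool
component {m} p q i = iterate m (closeStep p q) (λ j → j ==F i)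

-- Number of loops (connected components): count the vertices that are the
-- smallest element of their component.
loops : {m : ℕ} → Vec (Fin m) m → Vec (Fin m) m → ℕ
loops {m} p q =
  length (filterᵇ (λ i → all (λ j → not (component p q i j) ∨ (toℕ i ℕ.≤ᵇ toℕ j)) (allFin m))
                  (allFin m))

-- M n k : number of meandric systems (P , Q) ∈ NC₂(2n)² with exactly k loops.
M : ℕ → ℕ → ℕ
M n k = length (filterᵇ (λ pq → loops (Data.Product.proj₁ pq) (Data.Product.proj₂ pq) ≡ᵇ k)
                        (concatMap (λ p → map (λ q → (p Data.Product., q)) (NC₂ (2 ℕ.* n))) (NC₂ (2 ℕ.* n))))

PS : Set
PS = ℕ → ℤ

sumTo : ℕ → (ℕ → ℤ) → ℤ
sumTo zero    f = f 0
sumTo (suc N) f = sumTo N f ℤ.+ f (suc N)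

sumFrom1 : ℕ → (ℕ → ℤ) → ℤ
sumFrom1 zero    f = + 0
sumFrom1 (suc N) f = sumFrom1 N f ℤ.+ f (suc N)

_⊛_ : PS → PS → PS
(f ⊛ g) N = sumTo N (λ i → f i ℤ.* g (N ∸ i))
infixl 7 _⊛_

one : PS
one zero    = + 1
one (suc _) = + 0

X : PS
X 1 = + 1
X _ = + 0

onePlusX : PS
onePlusX 0 = + 1
onePlusX 1 = + 1
onePlusX _ = + 0

oneMinusX : PS
oneMinusX 0 = + 1
oneMinusX 1 = - (+ 1)
oneMinusX _ = + 0

_^ˢ_ : PS → ℕ → PS
f ^ˢ zero  = one
f ^ˢ suc n = f ⊛ (f ^ˢ n)
infixr 8 _^ˢ_

nth : List ℤ → ℕ → ℤ
nth []       _       = + 0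
nth (x ∷ xs) zero    = x
nth (x ∷ xs) (suc i) = nth xs i

-- Coefficients b₀..b_N of the multiplicative inverse of a series f with
-- constant term 1:  b₀ = 1,  b_k = - Σ_{i=1}^{k} f i * b_{k-i}.
invList : PS → ℕ → List ℤ
invList f zero    = [ + 1 ]
invList f (suc N) =
  let bs = invList f N in
  bs ++ [ - sumFrom1 (suc N) (λ i → f i ℤ.* nth bs (suc N ∸ i)) ]

-- 1/f, for f with f 0 = 1 (the only case used below).
inv₁ : PS → PS
inv₁ f N = nth (invList f N) N

-- Composition F(G) for G with G 0 = 0:  [w^N] F(G) = Σ_{n=0}^{N} F n * [w^N] G^n.
_∘ˢ_ : PS → PS → PS
(F ∘ˢ G) N = sumTo N (λ n → F n ℤ.* (G ^ˢ n) N)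

-- Polynomial with coefficient vector (a₀, …, a_{d-1}), i.e. degree ≤ d-1.
poly : {d : ℕ} → Vec ℤ d → PS
poly a = nth (V.toList a)

F : ℕ → PS
F r n = if r <ᵇ n then + M n (n ∸ r) else + 0

substT : PS
substT = X ⊛ inv₁ (onePlusX ^ˢ 2)

rhs : (r : ℕ) → PS → PS
rhs r P = (X ^ˢ suc r) ⊛ onePlusX ⊛ inv₁ (oneMinusX ^ˢ (2 ℕ.* r ∸ 1)) ⊛ P

{-# OPTIONS --safe #-}
-- Encode a meandric system by the word of pairs (upper bracket, lower bracket) at its points and
-- weight it by q^(n − loops).  Closed words have closed factors that can be inserted and removed,
-- the weight being multiplicative.  Cutting a closed word at its irreducible kernel (the part left
-- after removing all closed factors that avoid the first letter) gives, for Y(t,q) = Σ Mₙ⁽ⁿ⁻ʳ⁾ tⁿ qʳ,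
--   Y = 1 + t Y² + Σ_{p ≥ 2} κₚ(q) tᵖ Y²ᵖ,
-- where κₚ counts irreducible systems.  These have no loop with only two points, so they have at
-- most p/2 loops and κₚ involves only the powers qˢ with s < p ≤ 2s.
-- For t = w/(1+w)² and Y = (1+w) V the equation reads (1+w) V = 1 + w V² + Σ κₚ wᵖ V²ᵖ.  Hence
-- V₀ = 1, and the coefficient of qʳ expresses (1−w) Vᵣ by lower coefficients; induction on r gives
-- (1−w)²ʳ⁻¹ Vᵣ = wʳ⁺¹ P̃ᵣ with deg P̃ᵣ ≤ 3r−3.
module Submission where

open import Algebra.Bundles using (CommutativeRing)
open import Data.Bool.Base using (Bool; true; false)
open import Data.Empty using (⊥-elim)
open import Data.List.Base using (List; []; _∷_)
open import Data.Nat.Base using (ℕ; zero; suc; _≤_; _<_; z≤n; s≤s)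
open import Data.Product.Base using (_×_; _,_; ∃-syntax; proj₁; proj₂)
open import Data.Sum.Base using (_⊎_; inj₁; inj₂)
open import Level using (0ℓ)
open import Relation.Nullary using (¬_; Dec; yes; no)

-- The substitution is dictated by q = 0: there every loop has two points, the equation is Y = 1 + t
-- Y², and t = w/(1+w)² makes 1+w its solution. Dividing Y by it turns t Y² into w V², so 1+w
-- survives only once, on the left. Since κₚ with p ≥ 2 has no constant term in q, Vᵣ occurs on the
-- right only as 2w Vᵣ, coming from w V²; against (1+w) Vᵣ on the left this leaves (1-w) Vᵣ. The
-- degree bound comes from the single term κₚ wᵖ: at qʳ it has r+1 ≤ p ≤ 2r, and clearing the
-- denominator (1-w)^(2r-2) raises the largest exponent to 4r-2, so that 4r-2-(r+1) = 3r-3 remains.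
-- Two obstacles shape the rest. The number of loops is defined by iterated closure, which says
-- nothing about inserting words; it is therefore characterised by a universal property of
-- colourings (`LoopLabelling`). The sum over p is infinite; it is only ever used through finite
-- Horner sums that are correct up to a prescribed coefficient.

module PowerSeries where

  -- Formal power series over a commutative ring

  module Series (R : CommutativeRing 0ℓ 0ℓ) where

    open CommutativeRing R
    open import Algebra.Solver.Ring.NaturalCoefficients.Default commutativeSemiring
      using (solve; _:=_; _:*_; _:+_)
    open import Relation.Binary.Reasoning.Setoid setoid

    Coeffs : Set
    Coeffs = ℕ → Carrier

    infix 4 _≋_
    _≋_ : Coeffs → Coeffs → Set
    f ≋ g = ∀ n → f n ≈ g n

    tail : Coeffs → Coeffs
    tail f n = f (suc n)

    infixl 6 _⊕_
    _⊕_ : Coeffs → Coeffs → Coeffs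
    (f ⊕ g) n = f n + g n

    infixr 7 _·_
    _·_ : Carrier → Coeffs → Coeffs
    (c · f) n = c * f n

    infixl 7 _⊗_
    -- Peeling off the first coefficient of the left factor, instead of summing over splittings of
    -- n, lets the ring laws follow by structural induction.
    _⊗_ : Coeffs → Coeffs → Coeffs
    (f ⊗ g) zero    = f 0 * g 0
    (f ⊗ g) (suc n) = f 0 * g (suc n) + (tail f ⊗ g) n

    const : Carrier → Coeffs
    const c zero    = c
    const c (suc _) = 0#

    shift : Coeffs → Coeffs
    shift f zero    = 0#
    shift f (suc n) = f n

    zeroˢ : Coeffs
    zeroˢ _ = 0#

    ⊗-cong : ∀ {f f′ g g′} → f ≋ f′ → g ≋ g′ → f ⊗ g ≋ f′ ⊗ g′
    ⊗-cong p q zero    = *-cong (p 0) (q 0)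
    ⊗-cong p q (suc n) = +-cong (*-cong (p 0) (q (suc n))) (⊗-cong (λ i → p (suc i)) q n)

    ⊗-distribʳ : ∀ h f g → (f ⊕ g) ⊗ h ≋ f ⊗ h ⊕ g ⊗ h
    ⊗-distribʳ h f g zero    = distribʳ _ _ _
    ⊗-distribʳ h f g (suc n) = trans (+-congˡ (⊗-distribʳ h (tail f) (tail g) n))
      (solve 5 (λ a b c x y → (a :+ b) :* c :+ (x :+ y) := a :* c :+ x :+ (b :* c :+ y)) refl
        _ _ _ _ _)

    zero-⊗ : ∀ g → zeroˢ ⊗ g ≋ zeroˢ
    zero-⊗ g zero    = zeroˡ _
    zero-⊗ g (suc n) = trans (+-cong (zeroˡ _) (zero-⊗ g n)) (+-identityʳ _)

    ·-⊗ : ∀ c f g → (c · f) ⊗ g ≋ c · (f ⊗ g)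
    ·-⊗ c f g zero    = *-assoc _ _ _
    ·-⊗ c f g (suc n) = trans (+-congˡ (·-⊗ c (tail f) g n))
      (solve 4 (λ c a b x → c :* a :* b :+ c :* x := c :* (a :* b :+ x)) refl _ _ _ _)

    -- The mirror image of the defining recursion, peeling the right factor; commutativity needs
    -- both.
    ⊗-suc : ∀ f g n → (f ⊗ g) (suc n) ≈ (f ⊗ tail g) n + f (suc n) * g 0
    ⊗-suc f g zero    = refl
    ⊗-suc f g (suc n) = trans (+-congˡ (⊗-suc (tail f) g n)) (sym (+-assoc _ _ _))

    ⊗-comm : ∀ f g → f ⊗ g ≋ g ⊗ f
    ⊗-comm f g zero    = *-comm _ _
    ⊗-comm f g (suc n) = begin
      f 0 * g (suc n) + (tail f ⊗ g) n ≈⟨ +-cong (*-comm _ _) (⊗-comm (tail f) g n) ⟩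
      g (suc n) * f 0 + (g ⊗ tail f) n ≈⟨ +-comm _ _ ⟩
      (g ⊗ tail f) n + g (suc n) * f 0 ≈⟨ ⊗-suc g f n ⟨
      (g ⊗ f) (suc n) ∎

    ⊗-assoc : ∀ f g h → (f ⊗ g) ⊗ h ≋ f ⊗ (g ⊗ h)
    ⊗-assoc f g h zero    = *-assoc _ _ _
    ⊗-assoc f g h (suc n) = begin
      f 0 * g 0 * h (suc n) + ((f 0 · tail g ⊕ tail f ⊗ g) ⊗ h) n
        ≈⟨ +-congˡ (⊗-distribʳ h (f 0 · tail g) (tail f ⊗ g) n) ⟩
      f 0 * g 0 * h (suc n) + (((f 0 · tail g) ⊗ h) n + ((tail f ⊗ g) ⊗ h) n)
        ≈⟨ +-congˡ (+-cong (·-⊗ (f 0) (tail g) h n) (⊗-assoc (tail f) g h n)) ⟩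
      f 0 * g 0 * h (suc n) + (f 0 * (tail g ⊗ h) n + (tail f ⊗ (g ⊗ h)) n)
        ≈⟨ solve 5 (λ a b c x y → a :* b :* c :+ (a :* x :+ y) := a :* (b :* c :+ x) :+ y) refl
             _ _ _ _ _ ⟩
      f 0 * (g ⊗ h) (suc n) + (tail f ⊗ (g ⊗ h)) n ∎

    const-⊗ : ∀ c f → const c ⊗ f ≋ c · f
    const-⊗ c f zero    = refl
    const-⊗ c f (suc n) = trans (+-congˡ (zero-⊗ f n)) (+-identityʳ _)

    shift-⊗ : ∀ f g → shift f ⊗ g ≋ shift (f ⊗ g)
    shift-⊗ f g zero    = zeroˡ _
    shift-⊗ f g (suc n) = trans (+-congʳ (zeroˡ _)) (+-identityˡ _)

    seriesRing : CommutativeRing 0ℓ 0ℓ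
    seriesRing = record
      { Carrier = Coeffs
      ; _≈_ = _≋_
      ; _+_ = _⊕_
      ; _*_ = _⊗_
      ; -_ = λ f n → - f n
      ; 0# = zeroˢ
      ; 1# = const 1#
      ; isCommutativeRing = record
        { isRing = record
          { +-isAbelianGroup = record
            { isGroup = record
              { isMonoid = record
                { isSemigroup = record
                  { isMagma = record
                    { isEquivalence = record
                      { refl = λ _ → refl
                      ; sym = λ p n → sym (p n)
                      ; trans = λ p q n → trans (p n) (q n)
                      }
                    ; ∙-cong = λ p q n → +-cong (p n) (q n)
                    }
                  ; assoc = λ _ _ _ _ → +-assoc _ _ _
                  }
                ; identity = (λ _ _ → +-identityˡ _) , (λ _ _ → +-identityʳ _)
                }
              ; inverse = (λ _ _ → -‿inverseˡ _) , (λ _ _ → -‿inverseʳ _)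
              ; ⁻¹-cong = λ p n → -‿cong (p n)
              }
            ; comm = λ _ _ _ → +-comm _ _
            }
          ; *-cong = ⊗-cong
          ; *-assoc = ⊗-assoc
          ; *-identity = one-⊗ , (λ f n → trans (⊗-comm f (const 1#) n) (one-⊗ f n))
          ; distrib = (λ h f g n → trans (⊗-comm h (f ⊕ g) n) (trans (⊗-distribʳ h f g n)
                        (+-cong (⊗-comm f h n) (⊗-comm g h n))))
                    , ⊗-distribʳ
          }
        ; *-comm = ⊗-comm
        }
      }
      where
      one-⊗ : ∀ f → const 1# ⊗ f ≋ f
      one-⊗ f n = trans (const-⊗ 1# f n) (*-identityˡ _)

-- Generating series of functions on words

module WordSeries where

  open PowerSeries

  module Horner (R : CommutativeRing 0ℓ 0ℓ) where

    open CommutativeRing R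

    -- The truncation Σ c j sʲ over j < n. It replaces infinite sums everywhere, n being chosen
    -- beyond the coefficients under consideration.
    horner : ℕ → (ℕ → Carrier) → Carrier → Carrier
    horner zero    c s = 0#
    horner (suc n) c s = c 0 + s * horner n (λ j → c (suc j)) s

  module Words (R : CommutativeRing 0ℓ 0ℓ) {A : Set} (alphabet : List A) where

    open CommutativeRing R
    open Series R
    open Horner seriesRing
    open import Algebra.Solver.Ring.NaturalCoefficients.Default commutativeSemiring
      using (solve; _:=_; _:*_; _:+_)
    open import Relation.Binary.Reasoning.Setoid setoid

    sumOver : List A → (A → Carrier) → Carrier
    sumOver []       f = 0#
    sumOver (a ∷ as) f = f a + sumOver as f

    sumOver-cong : ∀ as {f g : A → Carrier} → (∀ a → f a ≈ g a) → sumOver as f ≈ sumOver as g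
    sumOver-cong []       p = refl
    sumOver-cong (a ∷ as) p = +-cong (p a) (sumOver-cong as p)

    sumOver-0 : ∀ as → sumOver as (λ _ → 0#) ≈ 0#
    sumOver-0 []       = refl
    sumOver-0 (a ∷ as) = trans (+-identityˡ _) (sumOver-0 as)

    sumOver-+ : ∀ as f g → sumOver as (λ a → f a + g a) ≈ sumOver as f + sumOver as g
    sumOver-+ []       f g = sym (+-identityʳ _)
    sumOver-+ (a ∷ as) f g = trans (+-congˡ (sumOver-+ as f g))
      (solve 4 (λ a b x y → a :+ b :+ (x :+ y) := a :+ x :+ (b :+ y)) refl _ _ _ _)

    sumOver-* : ∀ as c f → sumOver as (λ a → c * f a) ≈ c * sumOver as f
    sumOver-* []       c f = sym (zeroʳ c)
    sumOver-* (a ∷ as) c f = trans (+-congˡ (sumOver-* as c f)) (sym (distribˡ _ _ _))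

    sumOver-⊗ : ∀ as (f : A → Coeffs) g →
      (λ n → sumOver as (λ a → f a n)) ⊗ g ≋ (λ n → sumOver as (λ a → (f a ⊗ g) n))
    sumOver-⊗ []       f g = zero-⊗ g
    sumOver-⊗ (a ∷ as) f g n = trans (⊗-distribʳ g (f a) (λ n → sumOver as (λ a → f a n)) n)
      (+-congˡ (sumOver-⊗ as f g n))

    ⊗-sumOver : ∀ as f (g : A → Coeffs) →
      f ⊗ (λ n → sumOver as (λ a → g a n)) ≋ (λ n → sumOver as (λ a → (f ⊗ g a) n))
    ⊗-sumOver as f g n = trans (⊗-comm f _ n) (trans (sumOver-⊗ as g f n)
      (sumOver-cong as (λ a → ⊗-comm (g a) f n)))

    after : A → (List A → Carrier) → List A → Carrier
    after a f w = f (a ∷ w)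

    generating : (List A → Carrier) → Coeffs
    generating f zero    = f []
    generating f (suc n) = sumOver alphabet (λ a → generating (after a f) n)

    generating-0 : ∀ n → generating (λ _ → 0#) n ≈ 0#
    generating-0 zero    = refl
    generating-0 (suc n) = trans (sumOver-cong alphabet (λ _ → generating-0 n)) (sumOver-0 alphabet)

    generating-+ : ∀ f g → generating (λ w → f w + g w) ≋ generating f ⊕ generating g
    generating-+ f g zero    = refl
    generating-+ f g (suc n) = trans (sumOver-cong alphabet (λ a → generating-+ (after a f) (after a g) n))
      (sumOver-+ alphabet _ _)

    generating-* : ∀ c f → generating (λ w → c * f w) ≋ c · generating f
    generating-* c f zero    = refl
    generating-* c f (suc n) = trans (sumOver-cong alphabet (λ a → generating-* c (after a f) n))
      (sumOver-* alphabet c _)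

    -- Sum of f x * g y over all factorisations w = x ++ y.
    conv : (f g : List A → Carrier) → List A → Carrier
    conv f g []      = f [] * g []
    conv f g (a ∷ w) = f [] * g (a ∷ w) + conv (after a f) g w

    generating-conv : ∀ f g → generating (conv f g) ≋ generating f ⊗ generating g
    generating-conv f g zero    = refl
    generating-conv f g (suc n) = begin
      sumOver alphabet (λ a → generating (λ w → f [] * g (a ∷ w) + conv (after a f) g w) n)
        ≈⟨ sumOver-cong alphabet (λ a → trans
             (generating-+ (λ w → f [] * g (a ∷ w)) (conv (after a f) g) n)
             (+-cong (generating-* (f []) (after a g) n) (generating-conv (after a f) g n))) ⟩
      sumOver alphabet (λ a → f [] * generating (after a g) n + (generating (after a f) ⊗ generating g) n)
        ≈⟨ sumOver-+ alphabet _ _ ⟩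
      sumOver alphabet (λ a → f [] * generating (after a g) n)
        + sumOver alphabet (λ a → (generating (after a f) ⊗ generating g) n)
        ≈⟨ +-cong (sumOver-* alphabet (f []) _)
             (sym (sumOver-⊗ alphabet (λ a → generating (after a f)) (generating g) n)) ⟩
      f [] * generating g (suc n) + (tail (generating f) ⊗ generating g) n ∎

    -- Sum of g (a₁ … aⱼ) * z x₁ * … * z xⱼ over all factorisations w = a₁ x₁ … aⱼ xⱼ with j ≤ B.
    inflate : (z : List A → Carrier) → ℕ → (List A → Carrier) → List A → Carrier
    inflate z B       g []      = g []
    inflate z zero    g (a ∷ w) = 0#
    inflate z (suc B) g (a ∷ w) = conv z (inflate z B (after a g)) w

    -- Horner sums are linear in their coefficients; this is what moves the sum over the first
    -- kernel letter inside.
    horner-sumOver : ∀ n as (c : A → Coeffs) s →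
      (λ k → sumOver as (λ a → horner n (λ j → const (c a j)) s k))
        ≋ horner n (λ j → const (sumOver as (λ a → c a j))) s
    horner-sumOver zero    as c s k = sumOver-0 as
    horner-sumOver (suc n) as c s k = trans (sumOver-+ as _ _) (+-cong (sum-const k)
      (trans (sym (⊗-sumOver as s (λ a → horner n (λ j → const (c a (suc j))) s) k))
        (⊗-cong {f = s} (λ _ → refl) (horner-sumOver n as (λ a → tail (c a)) s) k)))
      where
      sum-const : (λ k → sumOver as (λ a → const (c a 0) k)) ≋ const (sumOver as (λ a → c a 0))
      sum-const zero    = refl
      sum-const (suc k) = sumOver-0 as

    -- A kernel letter and the word inserted behind it contribute one factor t Z(t), which is
    -- `shift (generating z)`. Kernels of length 0, ..., B account for the `suc B` terms.
    generating-inflate : ∀ z B g → generating (inflate z B g)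
      ≋ horner (suc B) (λ j → const (generating g j)) (shift (generating z))
    generating-inflate z B g zero    = sym (trans (+-congˡ (zeroˡ _)) (+-identityʳ _))
    generating-inflate z zero    g (suc n) = trans (generating-0 (suc n)) (sym (trans (+-identityˡ _)
      (CommutativeRing.zeroʳ seriesRing (shift (generating z)) (suc n))))
    generating-inflate z (suc B) g (suc n) = begin
      sumOver alphabet (λ a → generating (conv z (inflate z B (after a g))) n)
        ≈⟨ sumOver-cong alphabet (λ a → trans (generating-conv z (inflate z B (after a g)) n)
             (⊗-cong {f = Z} (λ _ → refl) (generating-inflate z B (after a g)) n)) ⟩
      sumOver alphabet (λ a → (Z ⊗ horner (suc B) (λ j → const (generating (after a g) j)) (shift Z)) n)
        ≈⟨ ⊗-sumOver alphabet Z _ n ⟨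
      (Z ⊗ (λ k → sumOver alphabet (λ a →
        horner (suc B) (λ j → const (generating (after a g) j)) (shift Z) k))) n
        ≈⟨ ⊗-cong {f = Z} (λ _ → refl)
             (horner-sumOver (suc B) alphabet (λ a → generating (after a g)) (shift Z)) n ⟩
      (Z ⊗ H) n
        ≈⟨ shift-⊗ Z H (suc n) ⟨
      (shift Z ⊗ H) (suc n)
        ≈⟨ +-identityˡ _ ⟨
      0# + (shift Z ⊗ H) (suc n) ∎
      where
      Z = generating z
      H = horner (suc B) (λ j → const (generating g (suc j))) (shift Z)

-- Closed factors and the unique parsing of a word by its kernel

module Parsing where

  open PowerSeries
  open WordSeries
  open import Data.List.Base using (_++_; [_]; length)
  open import Data.List.Properties using (++-assoc; ++-identityʳ; ∷-injective; length-++)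
  open import Data.Nat.Properties using (≤-trans; ≤-refl; m≤n+m; ≤-reflexive)
  open import Data.Product.Base using (∃)
  open import Relation.Binary.PropositionalEquality as ≡ using (_≡_; _≢_; cong; subst)

  -- These properties are all that the parsing argument uses of meandric systems. The decisive one
  -- is `meet`: two closed words can only overlap in a closed word.
  record FactorClosed {A : Set} (Closed : List A → Set) : Set where
    field
      closed?  : ∀ w → Dec (Closed w)
      empty    : Closed []
      insert   : ∀ a {c} b → Closed c → Closed (a ++ b) → Closed (a ++ c ++ b)
      remove   : ∀ a {c} b → Closed c → Closed (a ++ c ++ b) → Closed (a ++ b)
      meet  : ∀ a {b} c → Closed (a ++ b) → Closed (b ++ c) → Closed b

  -- Levi's lemma for free monoids.
  ++-split : ∀ {A : Set} (a {b} c {d} : List A) → a ++ b ≡ c ++ d →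
    (∃ λ v → c ≡ a ++ v × b ≡ v ++ d) ⊎ (∃ λ v → a ≡ c ++ v × d ≡ v ++ b)
  ++-split []      c       eq = inj₁ (c , ≡.refl , eq)
  ++-split (x ∷ a) []      eq = inj₂ (x ∷ a , ≡.refl , ≡.sym eq)
  ++-split (x ∷ a) (y ∷ c) eq with ∷-injective eq
  ... | ≡.refl , eq′ with ++-split a c eq′
  ...   | inj₁ (v , p , q) = inj₁ (v , cong (x ∷_) p , q)
  ...   | inj₂ (v , p , q) = inj₂ (v , cong (x ∷_) p , q)

  module Kernels {A : Set} {Closed : List A → Set} (closure : FactorClosed Closed) where

    open FactorClosed closure

    ClosedPrefix : List A → Set
    ClosedPrefix w = ∃[ c ] ∃[ b ] w ≡ c ++ b × c ≢ [] × Closed c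

    ClosedFactor : List A → Set
    ClosedFactor w = ∃[ a ] ∃[ b ] w ≡ a ++ b × ClosedPrefix b

    -- A closed word with a proper nonempty closed factor has one that does not start at its
    -- first letter, since a closed prefix can be removed.
    Reducible : List A → Set
    Reducible []      = ClosedFactor []
    Reducible (_ ∷ w) = ClosedFactor w

    -- The search for a closed prefix has to remember the letters p already read, since closedness
    -- concerns the whole prefix.
    extends? : ∀ p w → Dec (∃[ c ] ∃[ b ] w ≡ c ++ b × c ≢ [] × Closed (p ++ c))
    extends? p []      = no λ where
      ([]    , _ , _  , c≢[] , _) → c≢[] ≡.refl
      (_ ∷ _ , _ , () , _)
    extends? p (a ∷ w) with closed? (p ++ [ a ]) | extends? (p ++ [ a ]) w
    ... | yes cl | _ = yes ([ a ] , w , ≡.refl , (λ ()) , cl)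
    ... | no _   | yes (c , b , w≡ , _ , cl) =
          yes (a ∷ c , b , cong (a ∷_) w≡ , (λ ()) , subst Closed (++-assoc p [ a ] c) cl)
    ... | no ¬cl | no ¬ext = no λ where
      ([]        , _ , _      , c≢[] , _)  → c≢[] ≡.refl
      (_ ∷ []    , _ , ≡.refl , _ , cl)    → ¬cl cl
      (_ ∷ y ∷ c , b , ≡.refl , _ , cl)    →
        ¬ext (y ∷ c , b , ≡.refl , (λ ()) , subst Closed (≡.sym (++-assoc p [ a ] (y ∷ c))) cl)

    closedPrefix? : ∀ w → Dec (ClosedPrefix w)
    closedPrefix? = extends? []

    closedFactor? : ∀ w → Dec (ClosedFactor w)
    closedFactor? [] with closedPrefix? []
    ... | yes p = yes ([] , [] , ≡.refl , p)
    ... | no ¬p = no λ where ([] , [] , _ , p) → ¬p p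
    closedFactor? (x ∷ w) with closedPrefix? (x ∷ w) | closedFactor? w
    ... | yes p | _ = yes ([] , x ∷ w , ≡.refl , p)
    ... | no _  | yes (a , b , w≡ , p) = yes (x ∷ a , b , cong (x ∷_) w≡ , p)
    ... | no ¬p | no ¬q = no λ where
      ([]    , _ , ≡.refl , p) → ¬p p
      (_ ∷ a , b , ≡.refl , p) → ¬q (a , b , ≡.refl , p)

    reducible? : ∀ w → Dec (Reducible w)
    reducible? []      = closedFactor? []
    reducible? (_ ∷ w) = closedFactor? w

    ¬reducible-[] : ¬ Reducible []
    ¬reducible-[] ([] , [] , _ , []    , _ , _ , c≢[] , _) = c≢[] ≡.refl
    ¬reducible-[] ([] , [] , _ , _ ∷ _ , _ , () , _)

    -- Closed prefixes are split off until none is left; `insert` keeps their concatenation closed.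
    -- The bound n on the length drives the recursion.
    maximalPrefix : ∀ n w → length w ≤ n → ∃[ x ] ∃[ y ] w ≡ x ++ y × Closed x × ¬ ClosedPrefix y
    maximalPrefix n w |w|≤n with closedPrefix? w
    ... | no ¬p = [] , w , ≡.refl , empty , ¬p
    maximalPrefix n       w |w|≤n | yes ([]    , b , _      , c≢[] , _) = ⊥-elim (c≢[] ≡.refl)
    maximalPrefix (suc n) w (s≤s |w|≤n) | yes (a ∷ c , b , ≡.refl , _ , cl)
      with maximalPrefix n b (≤-trans (≤-trans (m≤n+m (length b) (length c))
             (≤-reflexive (≡.sym (length-++ c)))) |w|≤n)
    ... | x , y , ≡.refl , clx , ¬p =
          (a ∷ c) ++ x , y , ≡.sym (++-assoc (a ∷ c) x y) , insert [] x cl clx , ¬p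

  module Inflation (R : CommutativeRing 0ℓ 0ℓ) {A : Set} (alphabet : List A)
    {Closed : List A → Set} (closure : FactorClosed Closed)
    (z : List A → CommutativeRing.Carrier R)
    (z-closed : ∀ w → ¬ Closed w → CommutativeRing._≈_ R (z w) (CommutativeRing.0# R))
    (z-insert : ∀ a {c} b → Closed c →
      CommutativeRing._≈_ R (z (a ++ c ++ b)) (CommutativeRing._*_ R (z c) (z (a ++ b))))
    where

    open CommutativeRing R
    open FactorClosed closure
    open Kernels closure
    open Words R alphabet
    open import Relation.Binary.Reasoning.Setoid setoid

    kernel : List A → Carrier
    kernel k with reducible? k
    ... | yes _ = 0#
    ... | no  _ = z k

    kernel-reducible : ∀ k → Reducible k → kernel k ≈ 0#
    kernel-reducible k red with reducible? k
    ... | yes _ = refl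
    ... | no ¬r = ⊥-elim (¬r red)

    kernel-irreducible : ∀ k → ¬ Reducible k → kernel k ≈ z k
    kernel-irreducible k irr with reducible? k
    ... | yes r = ⊥-elim (irr r)
    ... | no  _ = refl

    conv-0 : ∀ f g w → (∀ x y → x ++ y ≡ w → f x * g y ≈ 0#) → conv f g w ≈ 0#
    conv-0 f g []      p = p [] [] ≡.refl
    conv-0 f g (a ∷ w) p = trans (+-cong (p [] (a ∷ w) ≡.refl)
      (conv-0 (after a f) g w (λ x y eq → p (a ∷ x) y (cong (a ∷_) eq)))) (+-identityˡ _)

    conv-single : ∀ f g x₀ y₀ →
      (∀ x y → x ++ y ≡ x₀ ++ y₀ → x ≢ x₀ → f x * g y ≈ 0#) →
      conv f g (x₀ ++ y₀) ≈ f x₀ * g y₀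
    conv-single f g []       []       p = refl
    conv-single f g []       (a ∷ y₀) p = trans (+-congˡ (conv-0 (after a f) g y₀
      (λ x y eq → p (a ∷ x) y (cong (a ∷_) eq) λ ()))) (+-identityʳ _)
    conv-single f g (a ∷ x₀) y₀       p = trans (+-cong (p [] (a ∷ x₀ ++ y₀) ≡.refl λ ())
      (conv-single (after a f) g x₀ y₀
        (λ x y eq x≢ → p (a ∷ x) y (cong (a ∷_) eq) λ { ≡.refl → x≢ ≡.refl }))) (+-identityˡ _)

    conv-cong : ∀ f {g h} w → (∀ y → g y ≈ h y) → conv f g w ≈ conv f h w
    conv-cong f []      p = *-congˡ (p [])
    conv-cong f (a ∷ w) p = +-cong (*-congˡ (p (a ∷ w))) (conv-cong (after a f) w p)

    inflate-cong : ∀ B {g h} w → (∀ u → g u ≈ h u) → inflate z B g w ≈ inflate z B h w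
    inflate-cong B       []      p = p []
    inflate-cong zero    (a ∷ w) p = refl
    inflate-cong (suc B) (a ∷ w) p =
      conv-cong z w (λ y → inflate-cong B y (λ u → p (a ∷ u)))

    inflate-0 : ∀ B g w → (∀ u → g u ≈ 0#) → inflate z B g w ≈ 0#
    inflate-0 B       g []      p = p []
    inflate-0 zero    g (a ∷ w) p = refl
    inflate-0 (suc B) g (a ∷ w) p = conv-0 z _ w
      (λ x y _ → trans (*-congˡ (inflate-0 B (after a g) y (λ u → p (a ∷ u)))) (zeroʳ _))

    closedTerms-0 : ∀ g w → (∀ x y → x ++ y ≡ w → Closed x → g y ≈ 0#) → conv z g w ≈ 0#
    closedTerms-0 g w p = conv-0 z g w λ x y eq → term x y eq (closed? x)
      where
      term : ∀ x y → x ++ y ≡ w → Dec (Closed x) → z x * g y ≈ 0#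
      term x y eq (yes cl) = trans (*-congˡ (p x y eq cl)) (zeroʳ _)
      term x y eq (no ¬cl) = trans (*-congʳ (z-closed x ¬cl)) (zeroˡ _)

    from : List A → List A → Carrier
    from k u = kernel (k ++ u)

    snoc-from : ∀ k a u → from k (a ∷ u) ≈ from (k ++ [ a ]) u
    snoc-from k a u = reflexive (cong kernel (≡.sym (++-assoc k [ a ] u)))

    from-reducible : ∀ h k s u → s ≢ [] → Closed s → from (h ∷ k ++ s) u ≈ 0#
    from-reducible h k s u s≢[] cl = kernel-reducible (h ∷ (k ++ s) ++ u)
      (k , s ++ u , ++-assoc k s u , s , u , ≡.refl , s≢[] , cl)

    -- Here h ∷ k ++ s has already been put into the kernel and s can be completed to a closed word
    -- by y₁. Whatever is cut out of y₁, the kernel letters that remain of s ++ y₁ still form a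
    -- nonempty closed factor behind h, so every parse has a reducible kernel.
    dead : ∀ B h k s y₁ y₂ → s ++ y₁ ≢ [] → Closed (s ++ y₁) →
      inflate z B (from (h ∷ k ++ s)) (y₁ ++ y₂) ≈ 0#
    dead B h k s [] y₂ ≢[] cl = inflate-0 B _ y₂ (λ u → from-reducible h k s u
      (subst (_≢ []) (++-identityʳ s) ≢[]) (subst Closed (++-identityʳ s) cl))
    dead zero    h k s (a ∷ y₁) y₂ ≢[] cl = refl
    dead (suc B) h k s (a ∷ y₁) y₂ ≢[] cl = closedTerms-0 _ (y₁ ++ y₂) rest
      where
      sa≢[] : ∀ s {v} → (s ++ [ a ]) ++ v ≢ []
      sa≢[] []      ()
      sa≢[] (_ ∷ _) ()
      step : ∀ u → from (h ∷ k ++ s) (a ∷ u) ≈ from (h ∷ k ++ (s ++ [ a ])) u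
      step u = trans (snoc-from (h ∷ k ++ s) a u)
        (reflexive (cong (λ l → from l u) (++-assoc (h ∷ k) s [ a ])))
      cl′ : Closed ((s ++ [ a ]) ++ y₁)
      cl′ = subst Closed (≡.sym (++-assoc s [ a ] y₁)) cl
      rest : ∀ x y → x ++ y ≡ y₁ ++ y₂ → Closed x →
        inflate z B (after a (from (h ∷ k ++ s))) y ≈ 0#
      rest x y eq clx with ++-split x y₁ eq
      ... | inj₁ (v , ≡.refl , ≡.refl) = trans (inflate-cong B (v ++ y₂) step)
            (dead B h k (s ++ [ a ]) v y₂ (sa≢[] s) (remove (s ++ [ a ]) v clx cl′))
      ... | inj₂ (v , ≡.refl , ≡.refl) = inflate-0 B _ y (λ u → trans (step u)
            (from-reducible h k (s ++ [ a ]) u (subst (_≢ []) (++-identityʳ _) (sa≢[] s)) clsa))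
        where
        -- The word cut out overhangs y₁ by v. By `meet` the overlap y₁ is closed itself, and
        -- removing it leaves a closed word already inside the kernel.
        clsa : Closed (s ++ [ a ])
        clsa = subst Closed (++-identityʳ _) (remove (s ++ [ a ]) [] (meet (s ++ [ a ]) v cl′ clx)
          (subst (λ l → Closed ((s ++ [ a ]) ++ l)) (≡.sym (++-identityʳ y₁)) cl′))

    -- The invariant of the greedy parse: no closed factor of k ++ y starts within k or right after
    -- it. The letter h exempts factors starting at the first letter, in accordance with
    -- `Reducible`.
    Fresh : List A → List A → Set
    Fresh k y = ∀ h k′ s → k ≡ h ∷ k′ ++ s → ¬ ClosedPrefix (s ++ y)

    -- A closed prefix that ends before or at v was there already; one that reaches beyond a stays
    -- closed when x is put back behind a. Either way it contradicts freshness before x was cut out.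
    fresh-extend : ∀ h k a v x y → Closed x → Fresh (h ∷ k ++ v) (a ∷ x ++ y) →
      ¬ ClosedPrefix ((v ++ [ a ]) ++ y)
    fresh-extend h k a v x y clx fr (c , b , eq , c≢[] , cl)
      with ++-split v c (≡.trans (≡.sym (++-assoc v [ a ] y)) eq)
    ... | inj₂ (v′ , ≡.refl , _) =
          fr h k v ≡.refl (c , v′ ++ a ∷ x ++ y , ++-assoc c v′ _ , c≢[] , cl)
    ... | inj₁ ([]     , c≡ , _) = fr h k v ≡.refl (c , a ∷ x ++ y ,
          cong (_++ a ∷ x ++ y) (≡.sym (≡.trans c≡ (++-identityʳ v))) , c≢[] , cl)
    ... | inj₁ (_ ∷ v′ , ≡.refl , ≡.refl) = fr h k v ≡.refl (v ++ a ∷ x ++ v′ , b ,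
          ≡.sym (≡.trans (++-assoc v (a ∷ x ++ v′) b)
            (cong (λ l → v ++ a ∷ l) (++-assoc x v′ b))) , nonempty v ,
          subst Closed (++-assoc v [ a ] (x ++ v′)) (insert (v ++ [ a ]) v′ clx
            (subst Closed (≡.sym (++-assoc v [ a ] v′)) cl)))
      where
      nonempty : ∀ v {u} → v ++ a ∷ u ≢ []
      nonempty []      ()
      nonempty (_ ∷ _) ()

    fresh-snoc : ∀ k a x y → Closed x → ¬ ClosedPrefix y → Fresh k (a ∷ x ++ y) → Fresh (k ++ [ a ]) y
    fresh-snoc k a x y clx ¬p fr h k′ s eq with ++-split k (h ∷ k′) eq
    ... | inj₁ ([] , hk≡ , ≡.refl) = fresh-extend h k′ a [] x y clx
          (subst (λ l → Fresh l (a ∷ x ++ y))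
            (≡.trans (≡.trans (≡.sym (++-identityʳ k)) (≡.sym hk≡)) (≡.sym (++-identityʳ _))) fr)
    ... | inj₁ (_ ∷ [] , _ , ≡.refl) = ¬p
    ... | inj₁ (_ ∷ _ ∷ _ , _ , ())
    ... | inj₂ (v , ≡.refl , ≡.refl) = fresh-extend h k′ a v x y clx fr

    -- Only one summand survives: behind each kernel letter the maximal closed prefix x₀ is cut out.
    -- With a shorter closed x, the rest of x₀ is closed and stays in the kernel, which is then
    -- `dead`. With a longer one, the surplus would be a closed prefix of y₀.
    inflate-fresh : ∀ B k y → length y ≤ B → Fresh k y → inflate z B (from k) y ≈ z (k ++ y)
    inflate-fresh B k [] _ fr = kernel-irreducible (k ++ []) (irr k fr)
      where
      irr : ∀ k → Fresh k [] → ¬ Reducible (k ++ [])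
      irr []       fr r               = ¬reducible-[] r
      irr (h ∷ k′) fr (p , b , eq , pre) = fr h p b
        (cong (h ∷_) (≡.trans (≡.sym (++-identityʳ k′)) eq))
        (subst ClosedPrefix (≡.sym (++-identityʳ b)) pre)
    inflate-fresh (suc B) k (a ∷ y) (s≤s |y|≤B) fr with maximalPrefix (length y) y ≤-refl
    ... | x₀ , y₀ , ≡.refl , cl₀ , ¬p = begin
      conv z (inflate z B (after a (from k))) (x₀ ++ y₀)
        ≈⟨ conv-single z _ x₀ y₀ (λ x y eq x≢ → others x y eq x≢ (closed? x)) ⟩
      z x₀ * inflate z B (after a (from k)) y₀
        ≈⟨ *-congˡ (inflate-cong B y₀ (snoc-from k a)) ⟩
      z x₀ * inflate z B (from (k ++ [ a ])) y₀
        ≈⟨ *-congˡ (inflate-fresh B (k ++ [ a ]) y₀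
             (≤-trans (≤-trans (m≤n+m (length y₀) (length x₀)) (≤-reflexive (≡.sym (length-++ x₀)))) |y|≤B)
             (fresh-snoc k a x₀ y₀ cl₀ ¬p fr)) ⟩
      z x₀ * z ((k ++ [ a ]) ++ y₀)
        ≈⟨ z-insert (k ++ [ a ]) y₀ cl₀ ⟨
      z ((k ++ [ a ]) ++ x₀ ++ y₀)
        ≡⟨ cong z (++-assoc k [ a ] (x₀ ++ y₀)) ⟩
      z (k ++ a ∷ x₀ ++ y₀) ∎
      where
      view : ∀ k → ∃[ h ] ∃[ k′ ] k ++ [ a ] ≡ h ∷ k′ ++ []
      view []       = a , [] , ≡.refl
      view (h ∷ k′) = h , k′ ++ [ a ] , cong (h ∷_) (≡.sym (++-identityʳ _))
      others : ∀ x y → x ++ y ≡ x₀ ++ y₀ → x ≢ x₀ → Dec (Closed x) →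
        z x * inflate z B (after a (from k)) y ≈ 0#
      others x y eq x≢ (no ¬cl) = trans (*-congʳ (z-closed x ¬cl)) (zeroˡ _)
      others x y eq x≢ (yes cl) with ++-split x x₀ eq
      ... | inj₁ (v , ≡.refl , ≡.refl) = trans (*-congˡ (trans
              (inflate-cong B (v ++ y₀) (λ u → trans (snoc-from k a u)
                (reflexive (cong (λ l → from l u) (proj₂ (proj₂ (view k)))))))
              (dead B (proj₁ (view k)) (proj₁ (proj₂ (view k))) [] v y₀
                (λ { ≡.refl → x≢ (≡.sym (++-identityʳ x)) }) (remove [] v cl cl₀)))) (zeroʳ _)
      ... | inj₂ (v , ≡.refl , ≡.refl) = ⊥-elim (¬p (v , y , ≡.refl ,
              (λ { ≡.refl → x≢ (++-identityʳ x₀) }) , remove [] v cl₀ cl))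

    inflate-kernel : ∀ B w → length w ≤ B → inflate z B kernel w ≈ z w
    inflate-kernel B w |w|≤B = inflate-fresh B [] w |w|≤B (λ _ _ _ ())

-- Pairs of bracket words, their colourings and their loops

module Brackets where

  open Parsing using (FactorClosed)
  open import Data.Fin.Base using (Fin; _↑ˡ_; _↑ʳ_; splitAt)
  open import Data.Fin.Properties using (_≟_; injective⇒≤; splitAt-↑ˡ; splitAt-↑ʳ; splitAt⁻¹-↑ˡ; splitAt⁻¹-↑ʳ)
  open import Data.List.Base using (_++_; map; length; zip)
  open import Data.List.Properties using (map-++; map-∘; map-cong; length-map; ∷-injective; ∷-injectiveˡ; ∷-injectiveʳ)
  open import Data.List.Membership.Propositional using (_∈_)
  open import Data.List.Membership.Propositional.Properties using (∈-++⁺ˡ; ∈-++⁺ʳ; ∈-++⁻; ∈-map⁺)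
  open import Data.List.Relation.Unary.Any using (here; there)
  open import Data.Nat.Base using (_+_)
  open import Data.Nat.Properties as ℕ using (m+n≡0⇒m≡0; ≤-antisym)
  open import Data.Sum.Base using ([_,_]′)
  open import Function.Base using (_∘_)
  open import Relation.Binary.PropositionalEquality
  open import Relation.Nullary using (does)
  open import Relation.Nullary.Decidable using (map′; _×-dec_; dec-true)

  Letter : Set
  Letter = Bool × Bool

  upper lower : List Letter → List Bool
  upper = map proj₁
  lower = map proj₂

  data Path : ℕ → List Bool → ℕ → Set where
    stop : ∀ {m} → Path m [] m
    up   : ∀ {m u n} → Path (suc m) u n → Path m (true ∷ u) n
    down : ∀ {m u n} → Path m u n → Path (suc m) (false ∷ u) n

  Dyck : List Bool → Set
  Dyck u = Path 0 u 0

  path? : ∀ m u n → Dec (Path m u n)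
  path? m [] n = map′ (λ { refl → stop }) (λ { stop → refl }) (m ℕ.≟ n)
  path? m (true ∷ u) n = map′ up (λ { (up p) → p }) (path? (suc m) u n)
  path? zero (false ∷ u) n = no λ ()
  path? (suc m) (false ∷ u) n = map′ down (λ { (down p) → p }) (path? m u n)

  path-++ : ∀ {l u m v n} → Path l u m → Path m v n → Path l (u ++ v) n
  path-++ stop     q = q
  path-++ (up p)   q = up (path-++ p q)
  path-++ (down p) q = down (path-++ p q)

  path-split : ∀ {l n} u {v} → Path l (u ++ v) n → ∃[ m ] Path l u m × Path m v n
  path-split []          p        = _ , stop , p
  path-split (true ∷ u)  (up p)   with path-split u p
  ... | m , q , r = m , up q , r
  path-split (false ∷ u) (down p) with path-split u p
  ... | m , q , r = m , down q , r

  path-raise : ∀ k {m u n} → Path m u n → Path (m + k) u (n + k)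
  path-raise k stop     = stop
  path-raise k (up p)   = up (path-raise k p)
  path-raise k (down p) = down (path-raise k p)

  path-unique : ∀ {m u n n′} → Path m u n → Path m u n′ → n ≡ n′
  path-unique stop     stop     = refl
  path-unique (up p)   (up q)   = path-unique p q
  path-unique (down p) (down q) = path-unique p q

  dyck-factorClosed : FactorClosed Dyck
  dyck-factorClosed = record
    { closed? = λ u → path? 0 u 0
    ; empty   = stop
    ; insert  = λ a b c ab → let (k , p , q) = path-split a ab in path-++ p (path-++ (path-raise k c) q)
    ; remove  = remove
    ; meet    = meet
    }
    where
    remove : ∀ a {c} b → Dyck c → Dyck (a ++ c ++ b) → Dyck (a ++ b)
    remove a {c} b pc p with path-split a p
    ... | k , pa , q with path-split c q
    ...   | k′ , pc′ , pb = path-++ pa (subst (λ i → Path i b 0) (path-unique pc′ (path-raise k pc)) pb)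
    -- As a suffix of a Dyck word b descends from k to 0, as a prefix of another it goes from 0 to
    -- j. Raising the latter path by k gives j + k = 0.
    meet : ∀ a {b} c → Dyck (a ++ b) → Dyck (b ++ c) → Dyck b
    meet a {b} c p q with path-split a p | path-split b q
    ... | k , _ , pb | j , pb′ , _ =
          subst (Path 0 b) (m+n≡0⇒m≡0 j (path-unique (path-raise k pb′) pb)) pb′

  map-factorClosed : ∀ {A B : Set} {C : List B → Set} (f : A → B) → FactorClosed C → FactorClosed (C ∘ map f)
  map-factorClosed {C = C} f cl = record
    { closed? = λ w → closed? (map f w)
    ; empty   = empty
    ; insert  = λ a {c} b pc p → subst C (sym (maps a c b))
                  (insert (map f a) (map f b) pc (subst C (map-++ f a b) p))
    ; remove  = λ a {c} b pc p → subst C (sym (map-++ f a b))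
                  (remove (map f a) (map f b) pc (subst C (maps a c b) p))
    ; meet    = λ a {b} c p q → meet (map f a) (map f c) (subst C (map-++ f a b) p) (subst C (map-++ f b c) q)
    }
    where
    open FactorClosed cl
    maps : ∀ a c b → map f (a ++ c ++ b) ≡ map f a ++ map f c ++ map f b
    maps a c b = trans (map-++ f a (c ++ b)) (cong (map f a ++_) (map-++ f c b))

  ×-factorClosed : ∀ {A : Set} {C D : List A → Set} →
    FactorClosed C → FactorClosed D → FactorClosed (λ w → C w × D w)
  ×-factorClosed c d = record
    { closed? = λ w → C.closed? w ×-dec D.closed? w
    ; empty   = C.empty , D.empty
    ; insert  = λ a b (p , q) (r , s) → C.insert a b p r , D.insert a b q s
    ; remove  = λ a b (p , q) (r , s) → C.remove a b p r , D.remove a b q s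
    ; meet    = λ a b (p , q) (r , s) → C.meet a b p r , D.meet a b q s
    }
    where
    module C = FactorClosed c
    module D = FactorClosed d

  Closed : List Letter → Set
  Closed w = Dyck (upper w) × Dyck (lower w)

  closed-factorClosed : FactorClosed Closed
  closed-factorClosed =
    ×-factorClosed (map-factorClosed proj₁ dyck-factorClosed) (map-factorClosed proj₂ dyck-factorClosed)

  -- Run σ u hs τ: reading the brackets u, the i-th of which has colour hs[i], moves the stack of
  -- colours of the open brackets from σ to τ, a closing bracket having the colour of its partner.
  data Run {A : Set} : List A → List Bool → List A → List A → Set where
    done  : ∀ {σ} → Run σ [] [] σ
    push  : ∀ {h σ u hs τ} → Run (h ∷ σ) u hs τ → Run σ (true ∷ u) (h ∷ hs) τ
    pop   : ∀ {h σ u hs τ} → Run σ u hs τ → Run (h ∷ σ) (false ∷ u) (h ∷ hs) τ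

  module _ {A : Set} where

    run-length : ∀ {σ τ : List A} {u hs} → Run σ u hs τ → length hs ≡ length u
    run-length done     = refl
    run-length (push r) = cong suc (run-length r)
    run-length (pop r)  = cong suc (run-length r)

    run-++ : ∀ {ρ σ τ : List A} {u v hs is} → Run ρ u hs σ → Run σ v is τ → Run ρ (u ++ v) (hs ++ is) τ
    run-++ done     s = s
    run-++ (push r) s = push (run-++ r s)
    run-++ (pop r)  s = pop (run-++ r s)

    run-split : ∀ {ρ τ : List A} u {v} hs {is} → length hs ≡ length u → Run ρ (u ++ v) (hs ++ is) τ →
      ∃[ σ ] Run ρ u hs σ × Run σ v is τ
    run-split []          []       eq r        = _ , done , r
    run-split (true ∷ u)  (h ∷ hs) eq (push r) with run-split u hs (ℕ.suc-injective eq) r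
    ... | σ , p , q = σ , push p , q
    run-split (false ∷ u) (h ∷ hs) eq (pop r)  with run-split u hs (ℕ.suc-injective eq) r
    ... | σ , p , q = σ , pop p , q

    run-raise : ∀ ρ {σ τ : List A} {u hs} → Run σ u hs τ → Run (σ ++ ρ) u hs (τ ++ ρ)
    run-raise ρ done     = done
    run-raise ρ (push r) = push (run-raise ρ r)
    run-raise ρ (pop r)  = pop (run-raise ρ r)

    -- A path that never drops below height 0 cannot touch the lower part ρ of the stack. Hence the
    -- colours inside a closed factor do not interact with those outside, which is what makes
    -- removal possible.
    run-confined : ∀ {m u n} (σ : List A) {ρ hs τ} → Path m u n → length σ ≡ m → Run (σ ++ ρ) u hs τ →
      ∃[ τ′ ] τ ≡ τ′ ++ ρ × length τ′ ≡ n × Run σ u hs τ′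
    run-confined σ       stop     eq done     = σ , refl , eq , done
    run-confined σ       (up p)   eq (push {h} r) with run-confined (h ∷ σ) p (cong suc eq) r
    ... | τ′ , e₁ , e₂ , r′ = τ′ , e₁ , e₂ , push r′
    run-confined (h ∷ σ) (down p) eq (pop r)  with run-confined σ p (ℕ.suc-injective eq) r
    ... | τ′ , e₁ , e₂ , r′ = τ′ , e₁ , e₂ , pop r′

    run-insert : ∀ a {c} b ha {hc hb} → length ha ≡ length a → Run {A} [] c hc [] →
      Run [] (a ++ b) (ha ++ hb) [] → Run [] (a ++ c ++ b) (ha ++ hc ++ hb) []
    run-insert a b ha eq rc r with run-split a ha eq r
    ... | σ , p , q = run-++ p (run-++ (run-raise σ rc) q)

    run-remove : ∀ a {c} b ha hc {hb} → length ha ≡ length a → length hc ≡ length c → Dyck c →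
      Run [] (a ++ c ++ b) (ha ++ hc ++ hb) [] → Run {A} [] c hc [] × Run [] (a ++ b) (ha ++ hb) []
    run-remove a {c} b ha hc ea ec dc r with run-split a ha ea r
    ... | σ , p , q with run-split c hc ec q
    ...   | σ′ , p′ , q′ with run-confined [] dc refl p′
    ...     | [] , refl , _ , r′ = r′ , run-++ p q′

  run-map : ∀ {A B : Set} (φ : A → B) {σ τ u hs} → Run σ u hs τ → Run (map φ σ) u (map φ hs) (map φ τ)
  run-map φ done     = done
  run-map φ (push r) = push (run-map φ r)
  run-map φ (pop r)  = pop (run-map φ r)

  -- A numbering of the loops by Fin c: each point carries the number of its loop.  Connectedness of
  -- the loops is expressed by factor: colourings constant along the arches are constant on loops.
  record LoopLabelling (w : List Letter) (c : ℕ) : Set where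
    field
      labels    : List (Fin c)
      upperRun  : Run [] (upper w) labels []
      lowerRun  : Run [] (lower w) labels []
      onto      : ∀ k → k ∈ labels
      factor    : ∀ (bs : List Bool) → Run [] (upper w) bs [] → Run [] (lower w) bs [] →
                  ∃[ φ ] bs ≡ map φ labels

    length-labels : length labels ≡ length w
    length-labels = trans (run-length upperRun) (length-map proj₁ w)

  zip-∈ : ∀ {A B : Set} {x : A} xs (ys : List B) → length xs ≡ length ys → x ∈ xs → ∃[ y ] (x , y) ∈ zip xs ys
  zip-∈ (x ∷ xs) (y ∷ ys) eq (here refl) = y , here refl
  zip-∈ (x ∷ xs) (_ ∷ ys) eq (there p)   with zip-∈ xs ys (ℕ.suc-injective eq) p
  ... | y , q = y , there q

  zip-map-≡ : ∀ {A B C : Set} {f : A → C} {g : B → C} xs ys {x y} → map f xs ≡ map g ys →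
    (x , y) ∈ zip xs ys → f x ≡ g y
  zip-map-≡ (x ∷ xs) (y ∷ ys) eq (here refl) = ∷-injectiveˡ eq
  zip-map-≡ (x ∷ xs) (y ∷ ys) eq (there p)   = zip-map-≡ xs ys (∷-injectiveʳ eq) p

  -- Each label k of L is sent to the label in L′ of some point carrying k. For injectivity, colour
  -- the points by whether their label in L is l: by `factor` for L′ this colour depends on the
  -- label in L′ only, so equal images force k = l.
  labelling-≤ : ∀ {w c c′} → LoopLabelling w c → LoopLabelling w c′ → c ≤ c′
  labelling-≤ {w} {c} {c′} L L′ = injective⇒≤ {f = λ k → proj₁ (partner k)} inj
    where
    open LoopLabelling
    partner : ∀ k → ∃[ k′ ] (k , k′) ∈ zip (labels L) (labels L′)
    partner k = zip-∈ (labels L) (labels L′) (trans (length-labels L) (sym (length-labels L′))) (onto L k)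
    inj : ∀ {k l} → proj₁ (partner k) ≡ proj₁ (partner l) → k ≡ l
    inj {k} {l} eq with factor L′ (map (λ x → does (x ≟ l)) (labels L))
      (run-map _ (upperRun L)) (run-map _ (lowerRun L))
    ... | φ , fac = decide (k ≟ l) refl
      where
      same : does (k ≟ l) ≡ does (l ≟ l)
      same = trans (zip-map-≡ (labels L) (labels L′) fac (proj₂ (partner k)))
        (trans (cong φ eq) (sym (zip-map-≡ (labels L) (labels L′) fac (proj₂ (partner l)))))
      decide : (d : Dec (k ≡ l)) → does d ≡ does (k ≟ l) → k ≡ l
      decide (yes p) _ = p
      decide (no ¬p) e with () ← trans e (trans same (dec-true (l ≟ l) refl))

  labelling-unique : ∀ {w c c′} → LoopLabelling w c → LoopLabelling w c′ → c ≡ c′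
  labelling-unique L L′ = ≤-antisym (labelling-≤ L L′) (labelling-≤ L′ L)

  split-like : ∀ {A B : Set} (a b : List A) (hs : List B) → length hs ≡ length (a ++ b) →
    ∃[ ha ] ∃[ hb ] hs ≡ ha ++ hb × length ha ≡ length a × length hb ≡ length b
  split-like []      b hs       eq = [] , hs , refl , refl , eq
  split-like (_ ∷ a) b (h ∷ hs) eq with split-like a b hs (ℕ.suc-injective eq)
  ... | ha , hb , refl , ea , eb = h ∷ ha , hb , refl , cong suc ea , eb

  -- No arch joins the inserted closed word to its surroundings, so the loops are a disjoint union,
  -- labelled by `_↑ˡ_` and `_↑ʳ_`. For `factor`, a colouring of the whole restricts to both parts,
  -- and the two resulting maps are glued by `splitAt`.
  labelling-insert : ∀ a {c} b {j k} → Closed c → LoopLabelling (a ++ b) j → LoopLabelling c k →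
    LoopLabelling (a ++ c ++ b) (j + k)
  labelling-insert a {w} b {j} {k} (dyck₁ , dyck₂) L M
    with split-like a b (LoopLabelling.labels L) (LoopLabelling.length-labels L)
  ... | ha , hb , hs≡ , ea , eb = record
    { labels   = left ha ++ right hc ++ left hb
    ; upperRun = insertion proj₁ L.upperRun M.upperRun
    ; lowerRun = insertion proj₂ L.lowerRun M.lowerRun
    ; onto     = onto
    ; factor   = factor
    }
    where
    module L = LoopLabelling L
    module M = LoopLabelling M
    hc = M.labels
    left  = map (_↑ˡ k)
    right = map (j ↑ʳ_)
    maps : ∀ (f : Letter → Bool) → map f (a ++ w ++ b) ≡ map f a ++ map f w ++ map f b
    maps f = trans (map-++ f a (w ++ b)) (cong (map f a ++_) (map-++ f w b))
    insertion : ∀ (f : Letter → Bool) → Run [] (map f (a ++ b)) L.labels [] → Run [] (map f w) hc [] →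
      Run [] (map f (a ++ w ++ b)) (left ha ++ right hc ++ left hb) []
    insertion f r s = subst (λ u → Run [] u _ []) (sym (maps f))
      (run-insert (map f a) (map f b) (left ha)
        (trans (length-map _ ha) (trans ea (sym (length-map f a)))) (run-map _ s)
        (subst₂ (λ u hs → Run [] u hs []) (map-++ f a b)
          (trans (cong left hs≡) (map-++ _ ha hb)) (run-map _ r)))
    onto : ∀ i → i ∈ left ha ++ right hc ++ left hb
    onto i with splitAt j i in eq
    ... | inj₂ y = ∈-++⁺ʳ (left ha) (∈-++⁺ˡ (subst (_∈ right hc) (splitAt⁻¹-↑ʳ eq) (∈-map⁺ _ (M.onto y))))
    ... | inj₁ x with ∈-++⁻ ha (subst (x ∈_) hs≡ (L.onto x))
    ...   | inj₁ p = ∈-++⁺ˡ (subst (_∈ left ha) (splitAt⁻¹-↑ˡ eq) (∈-map⁺ _ p))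
    ...   | inj₂ p = ∈-++⁺ʳ (left ha) (∈-++⁺ʳ (right hc)
              (subst (_∈ left hb) (splitAt⁻¹-↑ˡ eq) (∈-map⁺ _ p)))
    removal : ∀ (f : Letter → Bool) ba bc {bb} → length ba ≡ length a → length bc ≡ length w →
      Dyck (map f w) → Run {Bool} [] (map f (a ++ w ++ b)) (ba ++ bc ++ bb) [] →
      Run [] (map f w) bc [] × Run [] (map f (a ++ b)) (ba ++ bb) []
    removal f ba bc e₁ e₂ d r
      with run-remove (map f a) (map f b) ba bc (trans e₁ (sym (length-map f a)))
             (trans e₂ (sym (length-map f w))) d (subst (λ u → Run [] u _ []) (maps f) r)
    ... | p , q = p , subst (λ u → Run [] u _ []) (sym (map-++ f a b)) q
    factor : ∀ bs → Run {Bool} [] (upper (a ++ w ++ b)) bs [] → Run [] (lower (a ++ w ++ b)) bs [] →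
      ∃[ φ ] bs ≡ map φ (left ha ++ right hc ++ left hb)
    factor bs r s with split-like a (w ++ b) bs (trans (run-length r) (length-map proj₁ (a ++ w ++ b)))
    ... | ba , bs′ , refl , e₁ , e with split-like w b bs′ e
    ...   | bc , bb , refl , e₂ , e₃
          with removal proj₁ ba bc e₁ e₂ dyck₁ r | removal proj₂ ba bc e₁ e₂ dyck₂ s
    ...     | r₁ , r₂ | s₁ , s₂ with L.factor (ba ++ bb) r₂ s₂ | M.factor bc r₁ s₁
    ...       | φ , p | ψ , q = χ , trans
                  (cong₂ _++_ (proj₁ parts) (cong₂ _++_ (trans q (onRight hc)) (proj₂ parts)))
                  (sym (trans (map-++ χ (left ha) _) (cong (map χ (left ha) ++_) (map-++ χ (right hc) _))))
      where
      χ : Fin (j + k) → Bool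
      χ i = [ φ , ψ ]′ (splitAt j i)
      onLeft : ∀ hs → map φ hs ≡ map χ (left hs)
      onLeft hs = trans (map-cong (λ x → sym (cong [ φ , ψ ]′ (splitAt-↑ˡ j x k))) hs) (map-∘ hs)
      onRight : ∀ hs → map ψ hs ≡ map χ (right hs)
      onRight hs = trans (map-cong (λ x → sym (cong [ φ , ψ ]′ (splitAt-↑ʳ j k x))) hs) (map-∘ hs)
      ++-cancel : ∀ (xs ys : List Bool) {us vs} → length xs ≡ length ys → xs ++ us ≡ ys ++ vs → xs ≡ ys × us ≡ vs
      ++-cancel []       []       _ eq = refl , eq
      ++-cancel (x ∷ xs) (y ∷ ys) l eq with ∷-injective eq
      ... | refl , eq′ with ++-cancel xs ys (ℕ.suc-injective l) eq′
      ...   | refl , e = refl , e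
      parts : ba ≡ map χ (left ha) × bb ≡ map χ (left hb)
      parts with ++-cancel ba (map φ ha) (trans e₁ (sym (trans (length-map φ ha) ea)))
                   (trans p (trans (cong (map φ) hs≡) (map-++ φ ha hb)))
      ... | x , y = trans x (onLeft ha) , trans y (onLeft hb)

-- Non-crossing matchings of an interval and their bracket words

module Arches where

  open Brackets
  open import Data.List.Base using (_++_; length)
  open import Data.List.Properties using (length-++; ++-assoc)
  open import Data.Nat.Base using (_+_; _<ᵇ_)
  open import Data.Nat.Properties
  open import Relation.Binary.Definitions using (tri<; tri≈; tri>)
  open import Relation.Binary.PropositionalEquality

  -- Partners are given by a function on all of ℕ that is constrained only on [lo, hi), so that the
  -- points under or beyond an arch need no renumbering.
  record Matching (f : ℕ → ℕ) (lo hi : ℕ) : Set where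
    field
      lower-bound : ∀ {i} → lo ≤ i → i < hi → lo ≤ f i
      upper-bound : ∀ {i} → lo ≤ i → i < hi → f i < hi
      involutive  : ∀ {i} → lo ≤ i → i < hi → f (f i) ≡ i
      unfixed     : ∀ {i} → lo ≤ i → i < hi → f i ≢ i
      noncrossing : ∀ {i j} → lo ≤ i → j < hi → i < j → j < f i → ¬ (f i < f j)

  data Arches (f : ℕ → ℕ) : ℕ → List Bool → ℕ → Set where
    nil  : ∀ {lo} → Arches f lo [] lo
    arch : ∀ {lo u x v hi} → f lo ≡ x → f x ≡ lo → Arches f (suc lo) u x → Arches f (suc x) v hi →
           Arches f lo (true ∷ u ++ false ∷ v) hi

  arches-end : ∀ {f lo u hi} → Arches f lo u hi → hi ≡ lo + length u
  arches-end {lo = lo} nil = sym (+-identityʳ lo)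
  arches-end {lo = lo} (arch {u = u} {x} {v} {hi} _ _ p q) = begin
    hi                                ≡⟨ arches-end q ⟩
    suc x + length v                  ≡⟨ cong (λ y → suc y + length v) (arches-end p) ⟩
    suc (suc lo + length u) + length v ≡⟨ cong suc (cong suc (+-assoc lo (length u) (length v))) ⟩
    suc (suc (lo + (length u + length v))) ≡⟨ cong suc (sym (trans (+-suc lo _) (cong suc refl))) ⟩
    suc (lo + suc (length u + length v)) ≡⟨ cong (λ y → suc (lo + y)) (sym (+-suc (length u) (length v))) ⟩
    suc (lo + (length u + suc (length v))) ≡⟨ cong (λ y → suc (lo + y)) (sym (length-++ u)) ⟩
    suc (lo + length (u ++ false ∷ v)) ≡⟨ sym (+-suc lo _) ⟩
    lo + suc (length (u ++ false ∷ v)) ∎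
    where
    open ≡-Reasoning

  arches-≤ : ∀ {f lo u hi} → Arches f lo u hi → lo ≤ hi
  arches-≤ {lo = lo} A = subst (lo ≤_) (sym (arches-end A)) (m≤m+n lo _)

  data Position (lo x : ℕ) : ℕ → Set where
    first   : Position lo x lo
    inside  : ∀ {i} → suc lo ≤ i → i < x → Position lo x i
    second  : Position lo x x
    outside : ∀ {i} → suc x ≤ i → Position lo x i

  position : ∀ {lo x i} → lo ≤ i → Position lo x i
  position {lo} {x} {i} lo≤i with <-cmp lo i | <-cmp i x
  ... | tri≈ _ refl _ | _             = first
  ... | tri> _ _ i<lo | _             = ⊥-elim (<⇒≱ i<lo lo≤i)
  ... | tri< lo<i _ _ | tri< i<x _ _  = inside lo<i i<x
  ... | tri< lo<i _ _ | tri≈ _ refl _ = second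
  ... | tri< lo<i _ _ | tri> _ _ x<i  = outside x<i

  -- The arch at lo ends at x. A partner across x would cross this arch, and a partner equal to lo
  -- or x would break the involution; so the matching restricts to the points under the arch and to
  -- those beyond it.
  matching⇒arches : ∀ n {f lo hi} → lo ≤ hi → hi ≤ lo + n → Matching f lo hi → ∃[ u ] Arches f lo u hi
  matching⇒arches n {f} {lo} {hi} lo≤hi hi≤ M with m≤n⇒m<n∨m≡n lo≤hi
  ... | inj₂ refl = [] , nil
  matching⇒arches zero {f} {lo} lo≤hi hi≤ M | inj₁ lo<hi =
    ⊥-elim (<⇒≱ lo<hi (subst (_ ≤_) (+-identityʳ lo) hi≤))
  matching⇒arches (suc n) {f} {lo} {hi} lo≤hi hi≤ M | inj₁ lo<hi =
    _ , arch refl (involutive ≤-refl lo<hi) (proj₂ (matching⇒arches n lo<x x≤ left))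
          (proj₂ (matching⇒arches n x<hi hi≤′ right))
    where
    open Matching M
    x = f lo
    lo<x : lo < x
    lo<x = ≤∧≢⇒< (lower-bound ≤-refl lo<hi) (λ eq → unfixed ≤-refl lo<hi (sym eq))
    x<hi : x < hi
    x<hi = upper-bound ≤-refl lo<hi
    hi≤1 : hi ≤ suc lo + n
    hi≤1 = subst (hi ≤_) (+-suc lo n) hi≤
    x≤ : x ≤ suc lo + n
    x≤ = ≤-trans (<⇒≤ x<hi) hi≤1
    hi≤′ : hi ≤ suc x + n
    hi≤′ = ≤-trans hi≤1 (+-monoˡ-≤ n (s≤s (<⇒≤ lo<x)))
    fx : f x ≡ lo
    fx = involutive ≤-refl lo<hi
    back : ∀ {i j} → lo ≤ i → i < hi → f i ≡ j → i ≡ f j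
    back lo≤i i<hi refl = sym (involutive lo≤i i<hi)
    inner : ∀ {i} → suc lo ≤ i → i < x → suc lo ≤ f i × f i < x
    inner {i} p q = locate (position (lower-bound lo≤i i<hi)) refl
      where
      lo≤i = <⇒≤ p
      i<hi = <-trans q x<hi
      locate : ∀ {j} → Position lo x j → f i ≡ j → suc lo ≤ j × j < x
      locate first        eq = ⊥-elim (<⇒≢ q (back lo≤i i<hi eq))
      locate (inside r s) eq = r , s
      locate second       eq = ⊥-elim (<⇒≢ p (sym (trans (back lo≤i i<hi eq) fx)))
      locate (outside r)  eq = ⊥-elim (noncrossing ≤-refl i<hi p q (subst (x <_) (sym eq) r))
    outer : ∀ {i} → suc x ≤ i → i < hi → suc x ≤ f i
    outer {i} p q = locate (position (lower-bound lo≤i q)) refl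
      where
      lo≤i = <⇒≤ (<-trans lo<x p)
      locate : ∀ {j} → Position lo x j → f i ≡ j → suc x ≤ j
      locate first        eq = ⊥-elim (<⇒≢ p (sym (back lo≤i q eq)))
      locate (inside r s) eq = ⊥-elim (noncrossing ≤-refl (<-trans s x<hi) r s
        (subst (x <_) (back lo≤i q eq) p))
      locate second       eq = ⊥-elim (<⇒≢ (<-trans lo<x p) (sym (trans (back lo≤i q eq) fx)))
      locate (outside r)  eq = r
    left : Matching f (suc lo) x
    left = record
      { lower-bound = λ p q → proj₁ (inner p q)
      ; upper-bound = λ p q → proj₂ (inner p q)
      ; involutive  = λ p q → involutive (<⇒≤ p) (<-trans q x<hi)
      ; unfixed     = λ p q → unfixed (<⇒≤ p) (<-trans q x<hi)
      ; noncrossing = λ p q → noncrossing (<⇒≤ p) (<-trans q x<hi)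
      }
    right : Matching f (suc x) hi
    right = record
      { lower-bound = outer
      ; upper-bound = λ p q → upper-bound (<⇒≤ (<-trans lo<x p)) q
      ; involutive  = λ p q → involutive (<⇒≤ (<-trans lo<x p)) q
      ; unfixed     = λ p q → unfixed (<⇒≤ (<-trans lo<x p)) q
      ; noncrossing = λ p q → noncrossing (<⇒≤ (<-trans lo<x p)) q
      }

  arches⇒matching : ∀ {f lo u hi} → Arches f lo u hi → Matching f lo hi
  arches⇒matching nil = record
    { lower-bound = λ p q → ⊥-elim (<⇒≱ q p)
    ; upper-bound = λ p q → ⊥-elim (<⇒≱ q p)
    ; involutive  = λ p q → ⊥-elim (<⇒≱ q p)
    ; unfixed     = λ p q → ⊥-elim (<⇒≱ q p)
    ; noncrossing = λ p q r s t → ⊥-elim (<⇒≱ (<-trans r q) p)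
    }
  arches⇒matching {f} {lo} {hi = hi} (arch {x = x} refl fx A B) = record
    { lower-bound = λ p q → lower-bound q (position p)
    ; upper-bound = λ p q → upper-bound q (position p)
    ; involutive  = λ p q → involutive q (position p)
    ; unfixed     = λ p q → unfixed q (position p)
    ; noncrossing = λ {i} {j} p q r s → noncrossing q r s (position p) (position {i = j} (≤-trans p (<⇒≤ r)))
    }
    where
    module A = Matching (arches⇒matching A)
    module B = Matching (arches⇒matching B)
    lo<x : lo < x
    lo<x = arches-≤ A
    x<hi : x < hi
    x<hi = arches-≤ B
    lower-bound : ∀ {i} → i < hi → Position lo x i → lo ≤ f i
    lower-bound q first        = <⇒≤ lo<x
    lower-bound q (inside r s) = <⇒≤ (A.lower-bound r s)
    lower-bound q second       = ≤-reflexive (sym fx)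
    lower-bound q (outside r)  = <⇒≤ (<-trans lo<x (B.lower-bound r q))
    upper-bound : ∀ {i} → i < hi → Position lo x i → f i < hi
    upper-bound q first        = x<hi
    upper-bound q (inside r s) = <-trans (A.upper-bound r s) x<hi
    upper-bound q second       = subst (_< hi) (sym fx) (<-trans lo<x x<hi)
    upper-bound q (outside r)  = B.upper-bound r q
    involutive : ∀ {i} → i < hi → Position lo x i → f (f i) ≡ i
    involutive q first        = fx
    involutive q (inside r s) = A.involutive r s
    involutive q second       = cong f fx
    involutive q (outside r)  = B.involutive r q
    unfixed : ∀ {i} → i < hi → Position lo x i → f i ≢ i
    unfixed q first        eq = <⇒≢ lo<x (sym eq)
    unfixed q (inside r s) eq = A.unfixed r s eq
    unfixed q second       eq = <⇒≢ lo<x (trans (sym fx) eq)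
    unfixed q (outside r)  eq = B.unfixed r q eq
    noncrossing : ∀ {i j} → j < hi → i < j → j < f i → Position lo x i → Position lo x j → ¬ (f i < f j)
    noncrossing q r s first         first         t = <-irrefl refl r
    noncrossing q r s first         (inside a b)  t = <-asym t (A.upper-bound a b)
    noncrossing q r s first         second        t = <-irrefl refl s
    noncrossing q r s first         (outside a)   t = <-asym a s
    noncrossing q r s (inside a b)  first         t = <-asym a r
    noncrossing q r s (inside a b)  (inside c d)  t = A.noncrossing a d r s t
    noncrossing q r s (inside a b)  second        t = <-asym s (A.upper-bound a b)
    noncrossing q r s (inside a b)  (outside c)   t = <-asym (<-trans c s) (A.upper-bound a b)
    noncrossing q r s second        _             t = <-asym (<-trans r s) (subst (_< x) (sym fx) lo<x)
    noncrossing q r s (outside a)   first         t = <-asym (<-trans lo<x a) r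
    noncrossing q r s (outside a)   (inside c d)  t = <-asym (<-trans d a) r
    noncrossing q r s (outside a)   second        t = <-asym a r
    noncrossing q r s (outside a)   (outside c)   t = B.noncrossing a q r s t

  arches-cong : ∀ {f g lo u hi} → (∀ {i} → lo ≤ i → i < hi → f i ≡ g i) → Arches f lo u hi → Arches g lo u hi
  arches-cong p nil = nil
  arches-cong {f} {g} {lo} {hi = hi} p (arch {x = x} e₁ e₂ A B) = arch
    (trans (sym (p ≤-refl (<-trans lo<x x<hi))) e₁) (trans (sym (p (<⇒≤ lo<x) x<hi)) e₂)
    (arches-cong (λ r s → p (<⇒≤ r) (<-trans s x<hi)) A)
    (arches-cong (λ r s → p (<⇒≤ (<-trans lo<x r)) s) B)
    where
    lo<x : lo < x
    lo<x = arches-≤ A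
    x<hi : x < hi
    x<hi = arches-≤ B

  first-return : ∀ n m u → length u ≤ n → Path (suc m) u 0 →
    ∃[ v ] ∃[ w ] u ≡ v ++ false ∷ w × Dyck v × Path m w 0
  first-return n       m (false ∷ u) le       (down p) = [] , u , refl , stop , p
  -- The opening bracket leads to height m + 2, so the first return to m + 1 has to be followed by
  -- the first return to m.
  first-return (suc n) m (true ∷ u)  (s≤s le) (up p)   with first-return n (suc m) u le p
  ... | v , w , refl , d , q with first-return n m w
          (≤-trans (≤-trans (n≤1+n _) (m≤n+m _ (length v))) (≤-trans (≤-reflexive (sym (length-++ v))) le)) q
  ...   | v′ , w′ , refl , d′ , q′ = true ∷ v ++ false ∷ v′ , w′ ,
            cong (true ∷_) (sym (++-assoc v (false ∷ v′) (false ∷ w′))) ,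
            up (path-++ (path-raise 1 d) (down d′)) , q′

  dyck⇒arches : ∀ n lo u → length u ≤ n → Dyck u → ∃[ f ] ∃[ hi ] Arches f lo u hi
  dyck⇒arches n       lo []         le       stop   = (λ i → i) , lo , nil
  dyck⇒arches (suc n) lo (true ∷ u) (s≤s le) (up p) with first-return (length u) 0 u ≤-refl p
  ... | v , w , refl , d , q
      with dyck⇒arches n (suc lo) v (≤-trans (m≤m+n _ _) (≤-trans (≤-reflexive (sym (length-++ v))) le)) d
  ...   | f , x , A
      with dyck⇒arches n (suc x) w
             (≤-trans (≤-trans (n≤1+n _) (m≤n+m _ (length v))) (≤-trans (≤-reflexive (sym (length-++ v))) le)) q
  ...     | g , hi , B = k , hi , arch k-lo k-x (arches-cong k-inside A) (arches-cong k-outside B)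
    where
    lo<x : lo < x
    lo<x = arches-≤ A
    k : ℕ → ℕ
    k i with i ≟ lo | i ≟ x | i <? x
    ... | yes _ | _     | _     = x
    ... | no _  | yes _ | _     = lo
    ... | no _  | no _  | yes _ = f i
    ... | no _  | no _  | no _  = g i
    k-lo : k lo ≡ x
    k-lo with lo ≟ lo
    ... | yes _ = refl
    ... | no ¬p = ⊥-elim (¬p refl)
    k-x : k x ≡ lo
    k-x with x ≟ lo | x ≟ x
    ... | yes refl | _     = refl
    ... | no _     | yes _ = refl
    ... | no _     | no ¬p = ⊥-elim (¬p refl)
    k-inside : ∀ {i} → suc lo ≤ i → i < x → f i ≡ k i
    k-inside {i} r s with i ≟ lo | i ≟ x | i <? x
    ... | yes refl | _        | _     = ⊥-elim (<-irrefl refl r)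
    ... | no _     | yes refl | _     = ⊥-elim (<-irrefl refl s)
    ... | no _     | no _     | yes _ = refl
    ... | no _     | no _     | no ¬p = ⊥-elim (¬p s)
    k-outside : ∀ {i} → suc x ≤ i → i < hi → g i ≡ k i
    k-outside {i} r s with i ≟ lo | i ≟ x | i <? x
    ... | yes refl | _        | _     = ⊥-elim (<-asym lo<x r)
    ... | no _     | yes refl | _     = ⊥-elim (<-irrefl refl r)
    ... | no _     | no _     | yes p = ⊥-elim (<-asym p r)
    ... | no _     | no _     | no _  = refl

  arches⇒dyck : ∀ {f lo u hi} → Arches f lo u hi → Dyck u
  arches⇒dyck nil            = stop
  arches⇒dyck (arch _ _ A B) = up (path-++ (path-raise 1 (arches⇒dyck A)) (down (arches⇒dyck B)))

  module _ {A : Set} where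

    along : (ℕ → A) → ℕ → ℕ → List A
    along h lo zero    = []
    along h lo (suc n) = h lo ∷ along h (suc lo) n

    length-along : ∀ h lo n → length (along h lo n) ≡ n
    length-along h lo zero    = refl
    length-along h lo (suc n) = cong suc (length-along h (suc lo) n)

    along-+ : ∀ h lo m n → along h lo (m + n) ≡ along h lo m ++ along h (lo + m) n
    along-+ h lo zero    n = cong (λ k → along h k n) (sym (+-identityʳ lo))
    along-+ h lo (suc m) n = cong (h lo ∷_) (trans (along-+ h (suc lo) m n)
      (cong (λ k → along h (suc lo) m ++ along h k n) (sym (+-suc lo m))))

    along-cong : ∀ {h g : ℕ → A} lo n → (∀ {i} → lo ≤ i → i < lo + n → h i ≡ g i) → along h lo n ≡ along g lo n
    along-cong lo zero    p = refl
    along-cong lo (suc n) p = cong₂ _∷_ (p ≤-refl (m<m+n lo (s≤s z≤n)))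
      (along-cong (suc lo) n (λ {i} r s → p (<⇒≤ r) (subst (i <_) (sym (+-suc lo n)) s)))

    along-arch : ∀ {f lo u x v} (h : ℕ → A) → Arches f (suc lo) u x →
      along h lo (length (true ∷ u ++ false ∷ v)) ≡
        h lo ∷ along h (suc lo) (length u) ++ h x ∷ along h (suc x) (length v)
    along-arch {lo = lo} {u} {x} {v} h A = cong (h lo ∷_) (begin
      along h (suc lo) (length (u ++ false ∷ v))
        ≡⟨ cong (along h (suc lo)) (length-++ u) ⟩
      along h (suc lo) (length u + suc (length v))
        ≡⟨ along-+ h (suc lo) (length u) _ ⟩
      along h (suc lo) (length u) ++ along h (suc lo + length u) (suc (length v))
        ≡⟨ cong (λ k → along h (suc lo) (length u) ++ along h k (suc (length v))) (arches-end A) ⟨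
      along h (suc lo) (length u) ++ along h x (suc (length v)) ∎)
      where
      open ≡-Reasoning

    -- What lies under an arch restores the stack, so the closing bracket finds the colour of its
    -- own partner on top. Together with the converse below, this identifies the lists accepted by
    -- `Run` with the functions constant along arches.
    matched⇒run : ∀ {f lo u hi} (h : ℕ → A) {σ} → Arches f lo u hi →
      (∀ {i} → lo ≤ i → i < hi → h (f i) ≡ h i) → Run σ u (along h lo (length u)) σ
    matched⇒run h nil p = done
    matched⇒run {f} {lo} {hi = hi} h {σ} (arch {u = u} {x} {v} refl fx A B) p =
      subst (λ hs → Run σ (true ∷ u ++ false ∷ v) hs σ) (sym (along-arch h A))
        (push (run-++ (matched⇒run h A (λ r s → p (<⇒≤ r) (<-trans s x<hi)))
          (subst (λ c → Run (h lo ∷ σ) (false ∷ v) (c ∷ along h (suc x) (length v)) σ)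
            (sym (p ≤-refl (<-trans lo<x x<hi)))
            (pop (matched⇒run h B (λ r s → p (<⇒≤ (<-trans lo<x r)) s))))))
      where
      lo<x : lo < x
      lo<x = arches-≤ A
      x<hi : x < hi
      x<hi = arches-≤ B

    run⇒matched : ∀ {f lo u hi} (h : ℕ → A) {σ τ} → Arches f lo u hi → Run σ u (along h lo (length u)) τ →
      τ ≡ σ × (∀ {i} → lo ≤ i → i < hi → h (f i) ≡ h i)
    run⇒matched h nil done = refl , λ p q → ⊥-elim (<⇒≱ q p)
    run⇒matched {f} {lo} {hi = hi} h {σ} {τ} (arch {u = u} {x} {v} refl fx A B) r
      with push r′ ← subst (λ hs → Run σ (true ∷ u ++ false ∷ v) hs τ) (along-arch h A) r
      with run-split u (along h (suc lo) (length u)) (length-along h (suc lo) (length u)) r′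
    ... | _ , rA , rB with run⇒matched h A rA
    ...   | refl , pA = step rB refl
      where
      -- The list has h x at this place while the stack has h lo on top; naming the former c lets
      -- `pop` identify the two.
      step : ∀ {c} → Run (h lo ∷ σ) (false ∷ v) (c ∷ along h (suc x) (length v)) τ → c ≡ h x →
        τ ≡ σ × (∀ {i} → lo ≤ i → i < hi → h (f i) ≡ h i)
      step (pop r) c≡ with run⇒matched h B r
      ... | refl , pB = refl , λ p q → matched q (position p)
        where
        matched : ∀ {i} → i < hi → Position lo x i → h (f i) ≡ h i
        matched q first        = sym c≡
        matched q (inside r s) = pA r s
        matched q second       = trans (cong h fx) c≡
        matched q (outside r)  = pB r q

  -- A bracket opens exactly when its partner lies to the right. Thus the word depends on f alone,
  -- and f may be replaced by a table.
  arches-word : ∀ {f lo u hi} → Arches f lo u hi → u ≡ along (λ i → i <ᵇ f i) lo (length u)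
  arches-word nil = refl
  arches-word {f} {lo} (arch {u = u} {x} {v} refl fx A B) = sym (trans (along-arch (λ i → i <ᵇ f i) A)
    (cong₂ _∷_ (<ᵇ-true (arches-≤ A)) (cong₂ _++_ (sym (arches-word A))
      (cong₂ _∷_ (trans (cong (x <ᵇ_) fx) (≤⇒<ᵇ-false (<⇒≤ (arches-≤ A)))) (sym (arches-word B))))))
    where
    <ᵇ-true : ∀ {m n} → m < n → (m <ᵇ n) ≡ true
    <ᵇ-true {zero}  (s≤s _) = refl
    <ᵇ-true {suc m} (s≤s p) = <ᵇ-true p
    ≤⇒<ᵇ-false : ∀ {m n} → n ≤ m → (m <ᵇ n) ≡ false
    ≤⇒<ᵇ-false {m}     z≤n     = refl
    ≤⇒<ᵇ-false {suc m} (s≤s p) = ≤⇒<ᵇ-false p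

  -- Serves to find the closed word under an arch that belongs to both the upper and the lower
  -- matching.
  arches-factor : ∀ {f lo u hi} → Arches f lo u hi → ∀ {i} → lo ≤ i → i < hi → i < f i →
    ∃[ a ] ∃[ b ] ∃[ c ] u ≡ a ++ true ∷ b ++ false ∷ c × Dyck b × lo + length a ≡ i × f i ≡ suc i + length b
  arches-factor nil p q = ⊥-elim (<⇒≱ q p)
  arches-factor {f} {lo} {hi = hi} (arch {u = u} {x} {v} refl fx A B) p q = locate q (position p)
    where
    locate : ∀ {i} → i < hi → Position lo x i → i < f i → ∃[ a ] ∃[ b ] ∃[ c ]
      true ∷ u ++ false ∷ v ≡ a ++ true ∷ b ++ false ∷ c × Dyck b × lo + length a ≡ i × f i ≡ suc i + length b
    locate q first  lt = [] , u , v , refl , arches⇒dyck A , +-identityʳ lo , arches-end A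
    locate q second lt = ⊥-elim (<-asym (arches-≤ A) (subst (x <_) fx lt))
    locate q (inside r s) lt with arches-factor A r s lt
    ... | a , b , c , refl , d , e₁ , e₂ = true ∷ a , b , c ++ false ∷ v ,
          cong (true ∷_) (trans (++-assoc a (true ∷ b ++ false ∷ c) (false ∷ v))
            (cong (λ l → a ++ true ∷ l) (++-assoc b (false ∷ c) (false ∷ v)))) ,
          d , trans (+-suc lo (length a)) e₁ , e₂
    locate {i} q (outside r) lt with arches-factor B r q lt
    ... | a , b , c , refl , d , e₁ , e₂ = true ∷ u ++ false ∷ a , b , c ,
          cong (true ∷_) (sym (++-assoc u (false ∷ a) (true ∷ b ++ false ∷ c))) , d ,
          trans (cong (lo +_) (cong suc (length-++ u))) (trans (+-suc lo (length u + suc (length a)))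
            (trans (cong suc (trans (sym (+-assoc lo (length u) (suc (length a)))) (+-suc (lo + length u) (length a))))
              (trans (cong (λ y → suc (y + length a)) (sym (arches-end A))) e₁))) , e₂

-- Connected components of two involutions and bounds on their number

module Components where

  open import Defs using (component; closeStep; iterate; loops; _==F_)
  open import Data.Bool.Base using (not; _∧_; _∨_)
  open import Data.Bool.ListAction using (all)
  open import Data.Bool.Properties using (∨-zeroʳ; T-≡)
  import Data.Bool.Properties as Bool
  open import Data.Fin.Base using (Fin; zero; suc; toℕ; remQuot; combine)
  open import Data.Fin.Patterns using (0F; 1F; 2F; 3F)
  open import Data.Fin.Properties using (_≟_; toℕ-injective; all?; ¬∀⟶∃¬; injective⇒≤; combine-remQuot)
  open import Data.Fin.Subset using (∣_∣)
  open import Data.Fin.Subset.Properties using (p⊂q⇒∣p∣<∣q∣; ∣p∣≤n)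
  open import Data.List.Base using (allFin; filterᵇ) renaming (lookup to _!!_)
  open import Data.List.Membership.Propositional using (_∈_)
  open import Data.List.Membership.Propositional.Properties using (∈-filter⁺; ∈-filter⁻; ∈-allFin; ∈-lookup)
  open import Data.List.Relation.Unary.All as All using ([]; _∷_)
  open import Data.List.Relation.Unary.AllPairs using ([]; _∷_)
  open import Data.List.Relation.Unary.Any using (here; there; index)
  open import Data.List.Relation.Unary.Any.Properties using (lookup-index)
  open import Data.List.Relation.Unary.Unique.Propositional using (Unique)
  open import Data.List.Relation.Unary.Unique.Propositional.Properties using (filter⁺; allFin⁺)
  open import Data.Nat.Base using (_*_; _≤ᵇ_)
  open import Data.Nat.Properties using (≤-<-trans; <⇒≱; ≤-antisym; ≤ᵇ⇒≤; ≤⇒≤ᵇ)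
  open import Data.Vec.Base using (Vec; lookup; tabulate)
  open import Data.Vec.Properties using (lookup∘tabulate; []=⇒lookup; lookup⇒[]=)
  open import Function.Base using (_∘_)
  open import Function.Bundles using (Equivalence)
  open import Relation.Binary.PropositionalEquality
  open import Relation.Nullary.Decidable using (T?; _→-dec_)

  true-∨ : ∀ {a b} → a ∨ b ≡ true → a ≡ true ⊎ b ≡ true
  true-∨ {true}  _ = inj₁ refl
  true-∨ {false} e = inj₂ e

  true-∧ : ∀ {a b} → a ∧ b ≡ true → a ≡ true × b ≡ true
  true-∧ {true} e = refl , e

  all⇒ : ∀ {A : Set} {f : A → Bool} {xs x} → all f xs ≡ true → x ∈ xs → f x ≡ true
  all⇒ e (here refl) = proj₁ (true-∧ e)
  all⇒ e (there x∈)  = all⇒ (proj₂ (true-∧ e)) x∈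

  all⇐ : ∀ {A : Set} {f : A → Bool} xs → (∀ x → f x ≡ true) → all f xs ≡ true
  all⇐ []       p = refl
  all⇐ (x ∷ xs) p = cong₂ _∧_ (p x) (all⇐ xs p)

  unique⇒lookup-injective : ∀ {A : Set} {xs : List A} → Unique xs → ∀ i j → xs !! i ≡ xs !! j → i ≡ j
  unique⇒lookup-injective (_ ∷ u)   zero    zero    e = refl
  unique⇒lookup-injective (x∉ ∷ u)  zero    (suc j) e = ⊥-elim (All.lookup x∉ (∈-lookup j) e)
  unique⇒lookup-injective (x∉ ∷ u)  (suc i) zero    e = ⊥-elim (All.lookup x∉ (∈-lookup i) (sym e))
  unique⇒lookup-injective (_ ∷ u)   (suc i) (suc j) e = cong suc (unique⇒lookup-injective u i j e)

  least : ∀ {m} (S : Fin m → Bool) j → S j ≡ true → ∃[ r ] S r ≡ true × (∀ i → S i ≡ true → toℕ r ≤ toℕ i)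
  least {suc m} S j Sj with S zero in eq
  ... | true  = zero , eq , λ _ _ → z≤n
  least {suc m} S zero    Sj | false with () ← trans (sym Sj) eq
  least {suc m} S (suc j) Sj | false with least (S ∘ suc) j Sj
  ... | r , Sr , min = suc r , Sr , λ where
    zero    S0 → ⊥-elim (Bool.not-¬ eq S0)
    (suc i) Si → s≤s (min i Si)

  module _ {m : ℕ} (p q : Vec (Fin m) m)
    (p-involutive : ∀ i → lookup p (lookup p i) ≡ i) (q-involutive : ∀ i → lookup q (lookup q i) ≡ i)
    where

    private
      step = closeStep p q
      P = lookup p
      Q = lookup q

    Stable : (Fin m → Bool) → Set
    Stable S = ∀ j → step S j ≡ true → S j ≡ true

    step-⊇ : ∀ S {j} → S j ≡ true → step S j ≡ true
    step-⊇ S {j} e = cong (_∨ (S (P j) ∨ S (Q j))) e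

    step-P : ∀ S {j} → S j ≡ true → step S (P j) ≡ true
    step-P S {j} e = trans (cong (λ b → S (P j) ∨ b ∨ S (Q (P j))) (trans (cong S (p-involutive j)) e))
      (∨-zeroʳ _)

    step-Q : ∀ S {j} → S j ≡ true → step S (Q j) ≡ true
    step-Q S {j} e = trans (cong (λ b → S (Q j) ∨ S (P (Q j)) ∨ b) (trans (cong S (q-involutive j)) e))
      (trans (cong (S (Q j) ∨_) (∨-zeroʳ _)) (∨-zeroʳ _))

    step-stable : ∀ S → Stable S → Stable (step S)
    step-stable S st j e with true-∨ e
    ... | inj₁ e₁ = e₁
    ... | inj₂ e₁ with true-∨ e₁
    ...   | inj₁ e₂ = subst (λ k → step S k ≡ true) (p-involutive j) (step-P S (st _ e₂))
    ...   | inj₂ e₂ = subst (λ k → step S k ≡ true) (q-involutive j) (step-Q S (st _ e₂))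

    size : (Fin m → Bool) → ℕ
    size S = ∣ tabulate S ∣

    size-< : ∀ S j → step S j ≡ true → S j ≢ true → size S < size (step S)
    size-< S j e ne = p⊂q⇒∣p∣<∣q∣ {p = tabulate S} {q = tabulate (step S)}
      ((λ {x} x∈ → lookup⇒[]= x _ (trans (lookup∘tabulate (step S) x)
          (step-⊇ S (trans (sym (lookup∘tabulate S x)) ([]=⇒lookup x∈)))))
      , j , lookup⇒[]= j _ (trans (lookup∘tabulate (step S) j) e)
      , λ j∈ → ne (trans (sym (lookup∘tabulate S j)) ([]=⇒lookup j∈)))

    -- As long as a closure step changes the set it adds a vertex. After m steps the set is
    -- therefore stable or contains all m vertices, and in the latter case it is stable as well.
    iterate-stable-or-large : ∀ S k → let Sₖ = iterate k step S in Stable Sₖ ⊎ k ≤ size Sₖ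
    iterate-stable-or-large S zero    = inj₂ z≤n
    iterate-stable-or-large S (suc k) with iterate-stable-or-large S k
    ... | inj₁ st = inj₁ (step-stable _ st)
    ... | inj₂ k≤ with all? (λ j → (step (iterate k step S) j Bool.≟ true) →-dec (iterate k step S j Bool.≟ true))
    ...   | yes st = inj₁ (step-stable _ st)
    ...   | no ¬st with ¬∀⟶∃¬ _ _ (λ j → (step (iterate k step S) j Bool.≟ true) →-dec (iterate k step S j Bool.≟ true)) ¬st
    ...     | j , ¬imp = inj₂ (≤-<-trans k≤ (size-< (iterate k step S) j (grows _ _ ¬imp) λ e → ¬imp (λ _ → e)))
      where
      grows : ∀ a b → ¬ (a ≡ true → b ≡ true) → a ≡ true
      grows true  _ _  = refl
      grows false _ ¬i = ⊥-elim (¬i λ ())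

    full⇒stable : ∀ S → m ≤ size S → Stable S
    full⇒stable S m≤ j e with S j Bool.≟ true
    ... | yes e′ = e′
    ... | no ne  = ⊥-elim (<⇒≱ (≤-<-trans m≤ (size-< S j e ne)) (∣p∣≤n (tabulate (step S))))

    component-stable : ∀ i → Stable (component p q i)
    component-stable i with iterate-stable-or-large (_==F i) m
    ... | inj₁ st = st
    ... | inj₂ m≤ = full⇒stable _ m≤

    component-refl : ∀ i → component p q i i ≡ true
    component-refl i = reach m
      where
      reach : ∀ k → iterate k step (_==F i) i ≡ true
      reach zero with i ≟ i
      ... | yes _ = refl
      ... | no ne = ⊥-elim (ne refl)
      reach (suc k) = step-⊇ (iterate k step (_==F i)) (reach k)

    component-P : ∀ i j → component p q i j ≡ true → component p q i (P j) ≡ true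
    component-P i j e = component-stable i (P j) (step-P (component p q i) e)

    component-Q : ∀ i j → component p q i j ≡ true → component p q i (Q j) ≡ true
    component-Q i j e = component-stable i (Q j) (step-Q (component p q i) e)

    -- Each closure step follows an arch, along which h does not change. This is the source of the
    -- universal property of loops.
    component-constant : ∀ {A : Set} (h : Fin m → A) → (∀ j → h (P j) ≡ h j) → (∀ j → h (Q j) ≡ h j) →
      ∀ i j → component p q i j ≡ true → h j ≡ h i
    component-constant h hP hQ i = reach m
      where
      reach : ∀ k j → iterate k step (_==F i) j ≡ true → h j ≡ h i
      reach zero j e with j ≟ i
      ... | yes refl = refl
      reach zero j () | no _
      reach (suc k) j e with true-∨ e
      ... | inj₁ e₁ = reach k j e₁
      ... | inj₂ e₁ with true-∨ e₁
      ...   | inj₁ e₂ = trans (sym (hP j)) (reach k (P j) e₂)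
      ...   | inj₂ e₂ = trans (sym (hQ j)) (reach k (Q j) e₂)

    component-P≡ : ∀ i j → component p q i (P j) ≡ component p q i j
    component-P≡ i j with component p q i j in e₁ | component p q i (P j) in e₂
    ... | true  | true  = refl
    ... | false | false = refl
    ... | true  | false with () ← trans (sym (component-P i j e₁)) e₂
    ... | false | true  with () ← trans (sym (subst (λ k → component p q i k ≡ true) (p-involutive j)
                                    (component-P i (P j) e₂))) e₁

    component-Q≡ : ∀ i j → component p q i (Q j) ≡ component p q i j
    component-Q≡ i j with component p q i j in e₁ | component p q i (Q j) in e₂
    ... | true  | true  = refl
    ... | false | false = refl
    ... | true  | false with () ← trans (sym (component-Q i j e₁)) e₂
    ... | false | true  with () ← trans (sym (subst (λ k → component p q i k ≡ true) (q-involutive j)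
                                    (component-Q i (Q j) e₂))) e₁

    -- Membership in the component of k is itself constant along arches, so `component-constant`
    -- applies to it; symmetry and transitivity come from this.
    component-along : ∀ k i j → component p q i j ≡ true → component p q k j ≡ component p q k i
    component-along k = component-constant (component p q k) (component-P≡ k) (component-Q≡ k)

    component-sym : ∀ i j → component p q i j ≡ true → component p q j i ≡ true
    component-sym i j e = trans (sym (component-along j i j e)) (component-refl j)

    component-trans : ∀ i j k → component p q i j ≡ true → component p q j k ≡ true → component p q i k ≡ true
    component-trans i j k e f = trans (component-along i j k f) e

    isRoot : Fin m → Bool
    isRoot i = all (λ j → not (component p q i j) ∨ (toℕ i ≤ᵇ toℕ j)) (allFin m)

    -- Literally the list whose length defines `loops`, so that positions in it are elements of
    -- `Fin (loops p q)` and can number the loops.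
    roots : List (Fin m)
    roots = filterᵇ isRoot (allFin m)

    roots-unique : Unique roots
    roots-unique = filter⁺ (T? ∘ isRoot) (allFin⁺ m)

    root-least : ∀ {r} → r ∈ roots → ∀ j → component p q r j ≡ true → toℕ r ≤ toℕ j
    root-least {r} r∈ j e with true-∨ (all⇒ {f = λ j → not (component p q r j) ∨ (toℕ r ≤ᵇ toℕ j)}
        (Equivalence.to T-≡ (proj₂ (∈-filter⁻ (T? ∘ isRoot) {xs = allFin m} r∈))) (∈-allFin j))
    ... | inj₁ e₁ with () ← trans (sym (cong not e)) e₁
    ... | inj₂ e₁ = ≤ᵇ⇒≤ _ _ (Equivalence.from T-≡ e₁)

    roots-separated : ∀ {r s} → r ∈ roots → s ∈ roots → component p q r s ≡ true → r ≡ s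
    roots-separated r∈ s∈ e = toℕ-injective
      (≤-antisym (root-least r∈ _ e) (root-least s∈ _ (component-sym _ _ e)))

    rootOf : ∀ j → ∃[ r ] r ∈ roots × component p q j r ≡ true
    rootOf j with least (component p q j) j (component-refl j)
    ... | r , e , min = r , ∈-filter⁺ (T? ∘ isRoot) (∈-allFin r)
          (Equivalence.from T-≡ (all⇐ (allFin m) minimal)) , e
      where
      minimal : ∀ i → not (component p q r i) ∨ (toℕ r ≤ᵇ toℕ i) ≡ true
      minimal i with component p q r i in e′
      ... | false = refl
      ... | true  = Equivalence.to T-≡ (≤⇒≤ᵇ (min i (component-trans j r i e e′)))

    loopOf : Fin m → Fin (loops p q)
    loopOf j = index (proj₁ (proj₂ (rootOf j)))

    loopOf-root : ∀ j → component p q j (roots !! loopOf j) ≡ true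
    loopOf-root j = subst (λ r → component p q j r ≡ true)
      (lookup-index (proj₁ (proj₂ (rootOf j)))) (proj₂ (proj₂ (rootOf j)))

    loopOf-≡ : ∀ i j → component p q i j ≡ true → loopOf i ≡ loopOf j
    loopOf-≡ i j e = unique⇒lookup-injective roots-unique _ _ (roots-separated (∈-lookup (loopOf i)) (∈-lookup (loopOf j))
      (component-trans _ i _ (component-sym _ _ (loopOf-root i)) (component-trans i j _ e (loopOf-root j))))

    loopOf-P : ∀ j → loopOf (P j) ≡ loopOf j
    loopOf-P j = sym (loopOf-≡ j (P j) (component-P j j (component-refl j)))

    loopOf-Q : ∀ j → loopOf (Q j) ≡ loopOf j
    loopOf-Q j = sym (loopOf-≡ j (Q j) (component-Q j j (component-refl j)))

    loopOf-lookup : ∀ k → loopOf (roots !! k) ≡ k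
    loopOf-lookup k = unique⇒lookup-injective roots-unique _ _
      (sym (roots-separated (∈-lookup k) (∈-lookup (loopOf (roots !! k))) (loopOf-root (roots !! k))))

    loopOf-factor : (b : Fin m → Bool) → (∀ j → b (P j) ≡ b j) → (∀ j → b (Q j) ≡ b j) →
      ∀ j → b j ≡ b (roots !! loopOf j)
    loopOf-factor b bP bQ j = sym (component-constant b bP bQ j _ (loopOf-root j))

    -- If every loop contains n distinct points v i e, these points, taken at the roots, embed
    -- `Fin (loops p q * n)` into the m vertices.
    loops-bound : ∀ n (v : Fin m → Fin n → Fin m) → (∀ i e → loopOf (v i e) ≡ loopOf i) →
      (∀ i {e e′} → v i e ≡ v i e′ → e ≡ e′) → loops p q * n ≤ m
    loops-bound n v same inj = injective⇒≤ {f = vertex} vertex-injective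
      where
      vertex : Fin (loops p q * n) → Fin m
      vertex x = v (roots !! proj₁ (remQuot n x)) (proj₂ (remQuot {loops p q} n x))
      vertex-injective : ∀ {x y} → vertex x ≡ vertex y → x ≡ y
      vertex-injective {x} {y} eq = begin
        x ≡⟨ combine-remQuot {loops p q} n x ⟨
        combine (proj₁ (remQuot {loops p q} n x)) (proj₂ (remQuot {loops p q} n x))
          ≡⟨ cong₂ combine k≡ (inj _ (trans eq (cong (λ k → v (roots !! k) (proj₂ (remQuot {loops p q} n y))) (sym k≡)))) ⟩
        combine (proj₁ (remQuot {loops p q} n y)) (proj₂ (remQuot {loops p q} n y))
          ≡⟨ combine-remQuot {loops p q} n y ⟩
        y ∎
        where
        open ≡-Reasoning
        k≡ : proj₁ (remQuot {loops p q} n x) ≡ proj₁ (remQuot {loops p q} n y)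
        k≡ = trans (sym (loopOf-lookup _)) (trans (sym (same _ _)) (trans (cong loopOf eq)
          (trans (same _ _) (loopOf-lookup _))))

    loops*2≤ : (∀ i → P i ≢ i) → loops p q * 2 ≤ m
    loops*2≤ P≢ = loops-bound 2 v same inj
      where
      v : Fin m → Fin 2 → Fin m
      v i 0F = i
      v i 1F = P i
      same : ∀ i e → loopOf (v i e) ≡ loopOf i
      same i 0F = refl
      same i 1F = loopOf-P i
      inj : ∀ i {e e′} → v i e ≡ v i e′ → e ≡ e′
      inj i {0F} {0F} _  = refl
      inj i {0F} {1F} eq = ⊥-elim (P≢ i (sym eq))
      inj i {1F} {0F} eq = ⊥-elim (P≢ i eq)
      inj i {1F} {1F} _  = refl

    -- When the two partners of each point differ, the points i, P i, Q i and P (Q i) of a loop are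
    -- distinct: any coincidence yields a fixed point of P or Q, or a common partner.
    loops*4≤ : (∀ i → P i ≢ i) → (∀ i → Q i ≢ i) → (∀ i → P i ≢ Q i) → loops p q * 4 ≤ m
    loops*4≤ P≢ Q≢ P≢Q = loops-bound 4 v same inj
      where
      v : Fin m → Fin 4 → Fin m
      v i 0F = i
      v i 1F = P i
      v i 2F = Q i
      v i 3F = P (Q i)
      same : ∀ i e → loopOf (v i e) ≡ loopOf i
      same i 0F = refl
      same i 1F = loopOf-P i
      same i 2F = loopOf-Q i
      same i 3F = trans (loopOf-P (Q i)) (loopOf-Q i)
      PQ≢ : ∀ i → P (Q i) ≢ i
      PQ≢ i eq = P≢Q i (trans (cong P (sym eq)) (p-involutive (Q i)))
      PQ≢P : ∀ i → P (Q i) ≢ P i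
      PQ≢P i eq = Q≢ i (trans (sym (p-involutive (Q i))) (trans (cong P eq) (p-involutive i)))
      inj : ∀ i {e e′} → v i e ≡ v i e′ → e ≡ e′
      inj i {0F} {0F} eq = refl
      inj i {0F} {1F} eq = ⊥-elim (P≢ i (sym eq))
      inj i {0F} {2F} eq = ⊥-elim (Q≢ i (sym eq))
      inj i {0F} {3F} eq = ⊥-elim (PQ≢ i (sym eq))
      inj i {1F} {0F} eq = ⊥-elim (P≢ i eq)
      inj i {1F} {1F} eq = refl
      inj i {1F} {2F} eq = ⊥-elim (P≢Q i eq)
      inj i {1F} {3F} eq = ⊥-elim (PQ≢P i (sym eq))
      inj i {2F} {0F} eq = ⊥-elim (Q≢ i eq)
      inj i {2F} {1F} eq = ⊥-elim (P≢Q i (sym eq))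
      inj i {2F} {2F} eq = refl
      inj i {2F} {3F} eq = ⊥-elim (P≢ (Q i) (sym eq))
      inj i {3F} {0F} eq = ⊥-elim (PQ≢ i eq)
      inj i {3F} {1F} eq = ⊥-elim (PQ≢P i eq)
      inj i {3F} {2F} eq = ⊥-elim (P≢ (Q i) eq)
      inj i {3F} {3F} eq = refl

-- Tables of non-crossing pair partitions as Dyck words

module NonCrossing where

  open import Defs using (isPairPartition; isNonCrossing; NC₂; allVecs; allMaps; loops; _==F_; _<F_)
  open Parsing using (FactorClosed; module Kernels)
  open Brackets
  open Arches
  open Components
  open import Data.Bool.Base using (not; _∧_; _∨_)
  open import Data.Bool.Properties using (T-≡)
  import Data.Bool.Properties as Bool
  open import Data.Bool.ListAction using (all)
  open import Data.Fin.Base using (Fin; zero; suc; toℕ; fromℕ<)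
  open import Data.Fin.Properties using (_≟_; toℕ-injective; toℕ<n; fromℕ<-toℕ; toℕ-fromℕ<; injective⇒≤)
  open import Data.List.Base as List using (List; []; _∷_; _++_; map; length; allFin; concatMap; cartesianProductWith)
    renaming (lookup to _!!_)
  open import Data.List.Properties using (length-map; ++-assoc; ++-identityʳ) renaming (∷-injective to ∷ˡ-injective)
  open import Data.List.Membership.Propositional using (_∈_)
  open import Data.List.Membership.Propositional.Properties
    using (∈-filter⁺; ∈-filter⁻; ∈-allFin; ∈-cartesianProductWith⁺; ∈-lookup)
  open import Data.List.Relation.Unary.Any using (here; there; index)
  open import Data.List.Relation.Unary.All using ([])
  open import Data.List.Relation.Unary.AllPairs using ([]; _∷_)
  open import Data.List.Relation.Unary.Any.Properties using (lookup-index)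
  open import Data.List.Relation.Unary.Unique.Propositional using (Unique)
  open import Data.List.Relation.Unary.Unique.Propositional.Properties using (filter⁺; allFin⁺; cartesianProductWith⁺)
  open import Data.Nat.Base using (_+_; _*_; _<ᵇ_)
  open import Data.Nat.Properties
    using (_<?_; _≤?_; <⇒<ᵇ; <ᵇ⇒<; ≤-refl; ≤-reflexive; ≤-trans; <-trans; <⇒≢; +-identityʳ; suc-injective; +-suc; +-cancelˡ-≡; <-cmp; n≮n)
  open import Data.Vec.Base as Vec using (Vec; lookup)
  open import Data.Vec.Properties using (lookup∘tabulate; tabulate∘lookup; tabulate-cong)
    renaming (∷-injective to ∷ᵛ-injective)
  open import Function.Base using (_∘_)
  open import Function.Bundles using (Equivalence)
  open import Relation.Binary.Definitions using (tri<; tri≈; tri>)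
  open import Relation.Binary.PropositionalEquality
  open import Relation.Nullary.Decidable using (T?)

  <⇒<ᵇ≡true : ∀ {a b} → a < b → (a <ᵇ b) ≡ true
  <⇒<ᵇ≡true l = Equivalence.to T-≡ (<⇒<ᵇ l)

  concatMap-map : ∀ {A B C : Set} (f : A → B → C) xs ys →
    concatMap (λ x → map (f x) ys) xs ≡ cartesianProductWith f xs ys
  concatMap-map f []       ys = refl
  concatMap-map f (x ∷ xs) ys = cong (map (f x) ys ++_) (concatMap-map f xs ys)

  allVecs-suc : ∀ {A : Set} (xs : List A) k → allVecs xs (suc k) ≡ cartesianProductWith Vec._∷_ xs (allVecs xs k)
  allVecs-suc xs k = concatMap-map Vec._∷_ xs (allVecs xs k)

  ∈-allVecs : ∀ {A : Set} {xs : List A} → (∀ x → x ∈ xs) → ∀ {k} (v : Vec A k) → v ∈ allVecs xs k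
  ∈-allVecs p Vec.[]      = here refl
  ∈-allVecs {xs = xs} p {suc k} (x Vec.∷ v) = subst ((x Vec.∷ v) ∈_) (sym (allVecs-suc xs k))
    (∈-cartesianProductWith⁺ Vec._∷_ (p x) (∈-allVecs p v))

  allVecs-unique : ∀ {A : Set} {xs : List A} → Unique xs → ∀ k → Unique (allVecs xs k)
  allVecs-unique u zero    = [] ∷ []
  allVecs-unique {xs = xs} u (suc k) = subst Unique (sym (allVecs-suc xs k))
    (cartesianProductWith⁺ Vec._∷_ ∷ᵛ-injective u (allVecs-unique u k))

  -- Counts along a relation rather than a function, so that one encoding relation, read in both
  -- directions, gives equality of two lengths.
  length-≤ : ∀ {A B : Set} {xs : List A} {ys : List B} (R : A → B → Set) → Unique xs →
    (∀ {x} → x ∈ xs → ∃[ y ] y ∈ ys × R x y) →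
    (∀ {x x′ y} → x ∈ xs → x′ ∈ xs → R x y → R x′ y → x ≡ x′) → length xs ≤ length ys
  length-≤ {xs = xs} {ys} R u image inj = injective⇒≤ {f = λ i → index (member i)}
    λ {i} {j} eq → unique⇒lookup-injective u i j (inj (∈-lookup i) (∈-lookup j) (related i)
      (subst (R (xs !! j)) (trans (lookup-index (member j)) (trans (cong (ys !!_) (sym eq)) (sym (lookup-index (member i))))) (related j)))
    where
    member : ∀ i → proj₁ (image (∈-lookup {xs = xs} i)) ∈ ys
    member i = proj₁ (proj₂ (image (∈-lookup {xs = xs} i)))
    related : ∀ i → R (xs !! i) (proj₁ (image (∈-lookup {xs = xs} i)))
    related i = proj₂ (proj₂ (image (∈-lookup {xs = xs} i)))

  open FactorClosed closed-factorClosed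
  open Kernels closed-factorClosed

  zip-split : ∀ a {b} a′ {b′} w → length a ≡ length a′ → upper w ≡ a ++ b → lower w ≡ a′ ++ b′ →
    ∃[ v ] ∃[ v′ ] w ≡ v ++ v′ × (upper v ≡ a × lower v ≡ a′) × (upper v′ ≡ b × lower v′ ≡ b′)
  zip-split []      []       w       len e e′ = [] , w , refl , (refl , refl) , (e , e′)
  zip-split (_ ∷ a) (_ ∷ a′) (x ∷ w) len e e′
    with ∷ˡ-injective e | ∷ˡ-injective e′
  ... | refl , f | refl , f′ with zip-split a a′ w (suc-injective len) f f′
  ...   | v , v′ , refl , (refl , refl) , r = x ∷ v , v′ , refl , (refl , refl) , r

  -- The word B under a common arch is closed, which settles the case of nonempty B. If B is empty
  -- the arch is a two-letter closed word: either it lies behind the first letter, or it opens w,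
  -- and then what follows is closed by `remove` and nonempty since w has more than two letters.
  factor⇒reducible : ∀ w a {b c} a′ {b′ c′} → Closed w → 2 < length w →
    upper w ≡ a ++ true ∷ b ++ false ∷ c → lower w ≡ a′ ++ true ∷ b′ ++ false ∷ c′ →
    length a ≡ length a′ → length b ≡ length b′ → Dyck b → Dyck b′ → Reducible w
  factor⇒reducible w a {b} a′ {b′} cl 2<w e e′ la lb d d′ with zip-split a a′ w la e e′
  ... | A , (true , true) ∷ BC , refl , _ , (eBC , eBC′)
      with zip-split b b′ BC lb (proj₂ (∷ˡ-injective eBC)) (proj₂ (∷ˡ-injective eBC′))
  ...   | B , (false , false) ∷ C , refl , (refl , refl) , _ = reduce A B C cl (d , d′) 2<w
    where
    x y : Letter
    x = true , true
    y = false , false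
    xy-closed : Closed (x ∷ y ∷ [])
    xy-closed = up (down stop) , up (down stop)
    reduce : ∀ A B C → Closed (A ++ x ∷ B ++ y ∷ C) → Closed B → 2 < length (A ++ x ∷ B ++ y ∷ C) →
      Reducible (A ++ x ∷ B ++ y ∷ C)
    reduce []      (z ∷ B) C       _ cB _ = [] , _ , refl , z ∷ B , y ∷ C , refl , (λ ()) , cB
    reduce (_ ∷ A) (z ∷ B) C       _ cB _ = A ++ x ∷ [] , _ , sym (++-assoc A (x ∷ []) _) ,
                                            z ∷ B , y ∷ C , refl , (λ ()) , cB
    reduce (_ ∷ A) []      C       _ cB _ = A , _ , refl , x ∷ y ∷ [] , C , refl , (λ ()) , xy-closed
    reduce []      []      []      _ cB (s≤s (s≤s ()))
    reduce []      []      (z ∷ C) cl cB _ = y ∷ [] , z ∷ C , refl , z ∷ C , [] ,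
      sym (++-identityʳ (z ∷ C)) , (λ ()) , remove [] {x ∷ y ∷ []} (z ∷ C) xy-closed cl

  module _ {m′ : ℕ} where

    m : ℕ
    m = suc m′

    -- Out-of-range points go to `zero`, which exists because m is a successor; the empty system is
    -- treated separately.
    clamp : ℕ → Fin m
    clamp i with i <? m
    ... | yes i<m = fromℕ< i<m
    ... | no _    = zero

    clamp-toℕ : ∀ i → clamp (toℕ i) ≡ i
    clamp-toℕ i with toℕ i <? m
    ... | yes i<m = fromℕ<-toℕ i i<m
    ... | no i≮m  = ⊥-elim (i≮m (toℕ<n i))

    toℕ-clamp : ∀ {i} → i < m → toℕ (clamp i) ≡ i
    toℕ-clamp {i} i<m with i <? m
    ... | yes p = toℕ-fromℕ< p
    ... | no ¬p = ⊥-elim (¬p i<m)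

    onℕ : Vec (Fin m) m → ℕ → ℕ
    onℕ p i = toℕ (lookup p (clamp i))

    onℕ-toℕ : ∀ p i → onℕ p (toℕ i) ≡ toℕ (lookup p i)
    onℕ-toℕ p i = cong (λ j → toℕ (lookup p j)) (clamp-toℕ i)

    clamp-onℕ : ∀ p i → clamp (onℕ p i) ≡ lookup p (clamp i)
    clamp-onℕ p i = clamp-toℕ (lookup p (clamp i))

    wordOf : Vec (Fin m) m → List Bool
    wordOf p = along (λ i → i <ᵇ onℕ p i) 0 m

    isNC : Vec (Fin m) m → Bool
    isNC p = isPairPartition p ∧ isNonCrossing p

    ∈-NC₂⁺ : ∀ p → isNC p ≡ true → p ∈ NC₂ m
    ∈-NC₂⁺ p e = ∈-filter⁺ (T? ∘ isNC) (∈-allVecs ∈-allFin p) (Equivalence.from T-≡ e)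

    ∈-NC₂⁻ : ∀ {p} → p ∈ NC₂ m → isNC p ≡ true
    ∈-NC₂⁻ p∈ = Equivalence.to T-≡ (proj₂ (∈-filter⁻ (T? ∘ isNC) {xs = allMaps m} p∈))

    NC₂-unique : Unique (NC₂ m)
    NC₂-unique = filter⁺ (T? ∘ isNC) (allVecs-unique (allFin⁺ m) m)

    ==F-true : ∀ {i j : Fin m} → i ==F j ≡ true → i ≡ j
    ==F-true {i} {j} e with i ≟ j
    ... | yes p = p

    ==F-refl : ∀ (i : Fin m) → i ==F i ≡ true
    ==F-refl i with i ≟ i
    ... | yes _ = refl
    ... | no ¬p = ⊥-elim (¬p refl)

    ==F-false : ∀ {i j : Fin m} → i ≢ j → i ==F j ≡ false
    ==F-false {i} {j} ne with i ≟ j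
    ... | yes p = ⊥-elim (ne p)
    ... | no _  = refl

    paired : Vec (Fin m) m → Fin m → Bool
    paired p i = not (lookup p i ==F i) ∧ (lookup p (lookup p i) ==F i)

    uncrossed : Vec (Fin m) m → Fin m → Fin m → Bool
    uncrossed p i j = not ((i <F j) ∧ (j <F lookup p i) ∧ (lookup p i <F lookup p j))

    nc-paired : ∀ {p} → isNC p ≡ true → ∀ i → paired p i ≡ true
    nc-paired {p} e i = all⇒ {f = paired p} {xs = allFin m} (proj₁ (true-∧ {isPairPartition p} e)) (∈-allFin i)

    nc-uncrossed : ∀ {p} → isNC p ≡ true → ∀ i j → uncrossed p i j ≡ true
    nc-uncrossed {p} e i j = all⇒ {f = uncrossed p i} {xs = allFin m}
      (all⇒ {f = λ i → all (uncrossed p i) (allFin m)} {xs = allFin m}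
        (proj₂ (true-∧ {isPairPartition p} e)) (∈-allFin i)) (∈-allFin j)

    nc-involutive : ∀ {p} → isNC p ≡ true → ∀ i → lookup p (lookup p i) ≡ i
    nc-involutive {p} e i = ==F-true (proj₂ (true-∧ {not (lookup p i ==F i)} (nc-paired {p} e i)))

    nc-unfixed : ∀ {p} → isNC p ≡ true → ∀ i → lookup p i ≢ i
    nc-unfixed {p} e i eq with () ← trans (sym (cong not (trans (cong (_==F i) eq) (==F-refl i))))
      (proj₁ (true-∧ {not (lookup p i ==F i)} (nc-paired {p} e i)))

    nc-noncrossing : ∀ {p} → isNC p ≡ true → ∀ i j →
      toℕ i < toℕ j → toℕ j < toℕ (lookup p i) → ¬ (toℕ (lookup p i) < toℕ (lookup p j))
    nc-noncrossing {p} e i j r s t with () ← trans (sym (nc-uncrossed {p} e i j))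
      (cong not (cong₂ _∧_ (<⇒<ᵇ≡true r) (cong₂ _∧_ (<⇒<ᵇ≡true s) (<⇒<ᵇ≡true t))))

    nc⇒matching : ∀ {p} → isNC p ≡ true → Matching (onℕ p) 0 m
    nc⇒matching {p} e = record
      { lower-bound = λ _ _ → z≤n
      ; upper-bound = λ {i} _ _ → toℕ<n (lookup p (clamp i))
      ; involutive  = λ {i} _ q → trans (cong (λ j → toℕ (lookup p j)) (clamp-onℕ p i))
          (trans (cong toℕ (nc-involutive {p} e (clamp i))) (toℕ-clamp q))
      ; unfixed     = λ {i} _ q eq → nc-unfixed {p} e (clamp i)
          (toℕ-injective (trans eq (sym (toℕ-clamp q))))
      ; noncrossing = λ {i} {j} _ q r s t → nc-noncrossing {p} e (clamp i) (clamp j)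
          (subst₂ _<_ (sym (toℕ-clamp (<-trans r q))) (sym (toℕ-clamp q)) r)
          (subst (_< onℕ p i) (sym (toℕ-clamp q)) s) t
      }

    matching⇒nc : ∀ {p} → Matching (onℕ p) 0 m → isNC p ≡ true
    matching⇒nc {p} M = cong₂ _∧_
      (all⇐ (allFin m) (λ i → cong₂ _∧_ (cong not (==F-false (λ eq → unfixed z≤n (toℕ<n i)
          (trans (onℕ-toℕ p i) (cong toℕ eq)))))
        (trans (cong (_==F i) (toℕ-injective (trans (sym (trans (cong (onℕ p) (onℕ-toℕ p i)) (onℕ-toℕ p (lookup p i))))
          (involutive z≤n (toℕ<n i))))) (==F-refl i))))
      (all⇐ (allFin m) λ i → all⇐ (allFin m) λ j → ok i j)
      where
      open Matching M
      ok : ∀ i j → uncrossed p i j ≡ true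
      ok i j with i <F j in e₁ | j <F lookup p i in e₂ | lookup p i <F lookup p j in e₃
      ... | false | _     | _     = refl
      ... | true  | false | _     = refl
      ... | true  | true  | false = refl
      ... | true  | true  | true  = ⊥-elim (noncrossing z≤n (toℕ<n j) (lt e₁)
            (subst (toℕ j <_) (sym (onℕ-toℕ p i)) (lt e₂)) (subst₂ _<_ (sym (onℕ-toℕ p i)) (sym (onℕ-toℕ p j)) (lt e₃)))
        where
        lt : ∀ {a b} → (a <ᵇ b) ≡ true → a < b
        lt e = <ᵇ⇒< _ _ (Equivalence.from T-≡ e)

    arches-wordOf : ∀ {p u} → Arches (onℕ p) 0 u m → u ≡ wordOf p
    arches-wordOf A = trans (arches-word A) (cong (along _ 0) (sym (arches-end A)))

    nc⇒arches : ∀ {p} → isNC p ≡ true → Arches (onℕ p) 0 (wordOf p) m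
    nc⇒arches {p} e with matching⇒arches m z≤n ≤-refl (nc⇒matching {p} e)
    ... | u , A = subst (λ u → Arches (onℕ p) 0 u m) (arches-wordOf {p} A) A

    length-wordOf : ∀ p → length (wordOf p) ≡ m
    length-wordOf p = length-along _ 0 m

    nc-run : ∀ {A : Set} {p} → isNC p ≡ true → (h : Fin m → A) → (∀ i → h (lookup p i) ≡ h i) →
      Run [] (wordOf p) (along (h ∘ clamp) 0 m) []
    nc-run {p = p} e h hp = subst (λ n → Run [] (wordOf p) (along (h ∘ clamp) 0 n) []) (length-wordOf p)
      (matched⇒run (h ∘ clamp) (nc⇒arches {p} e) (λ {i} _ _ → trans (cong h (clamp-onℕ p i)) (hp (clamp i))))

    run-nc : ∀ {A : Set} {p} → isNC p ≡ true → (h : ℕ → A) → Run [] (wordOf p) (along h 0 m) [] →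
      ∀ i → h (toℕ (lookup p i)) ≡ h (toℕ i)
    run-nc {p = p} e h r i = trans (cong h (sym (onℕ-toℕ p i)))
      (proj₂ (run⇒matched h (nc⇒arches {p} e)
        (subst (λ n → Run [] (wordOf p) (along h 0 n) []) (sym (length-wordOf p)) r)) z≤n (toℕ<n i))

    along-clamp : ∀ {A : Set} (h : Fin m → A) (g : ℕ → A) → (∀ i → g (toℕ i) ≡ h i) →
      along (h ∘ clamp) 0 m ≡ along g 0 m
    along-clamp h g eq = along-cong 0 m λ {i} _ i<m →
      trans (sym (eq (clamp i))) (cong g (toℕ-clamp i<m))

    wordOf-injective : ∀ {p q} → isNC p ≡ true → isNC q ≡ true → wordOf p ≡ wordOf q → p ≡ q
    wordOf-injective {p} {q} ep eq words = trans (sym (tabulate∘lookup p))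
      (trans (tabulate-cong same) (tabulate∘lookup q))
      where
      -- The indicator of the arch of p at i is a valid colouring for q as well.
      same : ∀ i → lookup p i ≡ lookup q i
      same i = decide (true-∨ on-arch)
        where
        h : Fin m → Bool
        h j = (j ==F i) ∨ (lookup p j ==F i)
        hp : ∀ j → h (lookup p j) ≡ h j
        hp j = trans (cong (λ k → (lookup p j ==F i) ∨ (k ==F i)) (nc-involutive {p} ep j)) (Bool.∨-comm (lookup p j ==F i) _)
        h-q : h (lookup q i) ≡ h i
        h-q = trans (cong h (sym (clamp-toℕ (lookup q i))))
          (trans (run-nc {p = q} eq (h ∘ clamp) (subst (λ u → Run [] u (along (h ∘ clamp) 0 m) []) words (nc-run {p = p} ep h hp)) i) (cong h (clamp-toℕ i)))
        on-arch : h (lookup q i) ≡ true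
        on-arch = trans h-q (cong (_∨ (lookup p i ==F i)) (==F-refl i))
        decide : (lookup q i ==F i) ≡ true ⊎ (lookup p (lookup q i) ==F i) ≡ true → lookup p i ≡ lookup q i
        decide (inj₁ e) = ⊥-elim (nc-unfixed {q} eq i (==F-true e))
        decide (inj₂ e) = trans (cong (lookup p) (sym (==F-true e))) (nc-involutive {p} ep (lookup q i))

    wordOf-surjective : ∀ u → Dyck u → length u ≡ m → ∃[ p ] isNC p ≡ true × wordOf p ≡ u
    wordOf-surjective u d len with dyck⇒arches (length u) 0 u ≤-refl d
    ... | f , hi , A = p , matching⇒nc {p} (arches⇒matching A′) , sym (arches-wordOf {p} A′)
      where
      hi≡ : hi ≡ m
      hi≡ = trans (arches-end A) len
      p : Vec (Fin m) m
      p = Vec.tabulate (λ i → clamp (f (toℕ i)))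
      open Matching (subst (Matching f 0) hi≡ (arches⇒matching A))
      agree : ∀ {i} → 0 ≤ i → i < m → f i ≡ onℕ p i
      agree {i} _ i<m = sym (trans (cong toℕ (lookup∘tabulate (λ i → clamp (f (toℕ i))) (clamp i)))
        (trans (cong (toℕ ∘ clamp ∘ f) (toℕ-clamp i<m)) (toℕ-clamp (upper-bound z≤n i<m))))
      A′ : Arches (onℕ p) 0 u m
      A′ = arches-cong agree (subst (Arches f 0 u) hi≡ A)

    nth : List Bool → ℕ → Bool
    nth []       _       = false
    nth (b ∷ bs) zero    = b
    nth (b ∷ bs) (suc i) = nth bs i

    along-nth : ∀ bs n → length bs ≡ n → bs ≡ along (nth bs) 0 n
    along-nth bs n refl = shifted bs 0 (nth bs) (λ _ → refl)
      where
      shifted : ∀ cs lo h → (∀ i → h (lo + i) ≡ nth cs i) → cs ≡ along h lo (length cs)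
      shifted []       lo h eq = refl
      shifted (c ∷ cs) lo h eq = cong₂ _∷_ (sym (trans (cong h (sym (+-identityʳ lo))) (eq 0)))
        (shifted cs (suc lo) h (λ i → trans (cong h (sym (+-suc lo i))) (eq (suc i))))

    map-along : ∀ {A B : Set} (φ : A → B) h lo n → map φ (along h lo n) ≡ along (φ ∘ h) lo n
    map-along φ h lo zero    = refl
    map-along φ h lo (suc n) = cong (φ (h lo) ∷_) (map-along φ h (suc lo) n)

    ∈-along : ∀ {A : Set} (h : ℕ → A) lo n i → h (lo + toℕ {n} i) ∈ along h lo n
    ∈-along h lo (suc n) zero    = here (cong h (+-identityʳ lo))
    ∈-along h lo (suc n) (suc i) = there (subst (_∈ along h (suc lo) n)
      (cong h (sym (+-suc lo (toℕ i)))) (∈-along h (suc lo) n i))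

    module Meandric (w : List Letter) (p q : Vec (Fin m) m) (p-nc : isNC p ≡ true) (q-nc : isNC q ≡ true)
      (upper≡ : upper w ≡ wordOf p) (lower≡ : lower w ≡ wordOf q) where

      private
        P² = nc-involutive {p} p-nc
        Q² = nc-involutive {q} q-nc

      -- Links the closure-based count to the universal property: a colouring constant along arches
      -- is determined by its values at the roots, which gives φ.
      labelling : LoopLabelling w (loops p q)
      labelling = record
        { labels   = along (loop ∘ clamp) 0 m
        ; upperRun = subst (λ u → Run [] u (along (loop ∘ clamp) 0 m) []) (sym upper≡) (nc-run {p = p} p-nc loop (loopOf-P p q P² Q²))
        ; lowerRun = subst (λ u → Run [] u (along (loop ∘ clamp) 0 m) []) (sym lower≡) (nc-run {p = q} q-nc loop (loopOf-Q p q P² Q²))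
        ; onto     = λ k → subst (_∈ _) (trans (cong loop (clamp-toℕ (rs !! k))) (loopOf-lookup p q P² Q² k))
                       (∈-along (loop ∘ clamp) 0 m (rs !! k))
        ; factor   = factor
        }
        where
        loop = loopOf p q P² Q²
        rs = roots p q P² Q²
        factor : ∀ bs → Run {Bool} [] (upper w) bs [] → Run [] (lower w) bs [] →
          ∃[ φ ] bs ≡ map φ (along (loop ∘ clamp) 0 m)
        factor bs r s = φ , trans bs≡ (trans (sym (along-clamp (φ ∘ loop) (nth bs) b≡))
                              (sym (map-along φ (loop ∘ clamp) 0 m)))
          where
          φ : Fin (loops p q) → Bool
          φ k = nth bs (toℕ (rs !! k))
          bs≡ : bs ≡ along (nth bs) 0 m
          bs≡ = along-nth bs m (trans (run-length r) (trans (cong length upper≡) (length-wordOf p)))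
          b≡ : ∀ j → nth bs (toℕ j) ≡ φ (loop j)
          b≡ = loopOf-factor p q P² Q² (nth bs ∘ toℕ)
            (run-nc {p = p} p-nc (nth bs) (subst₂ (λ u bs → Run [] u bs []) upper≡ bs≡ r))
            (run-nc {p = q} q-nc (nth bs) (subst₂ (λ u bs → Run [] u bs []) lower≡ bs≡ s))

      loops-lower : 1 ≤ loops p q
      -- The loop of the first point inhabits `Fin (loops p q)`, so this number is not zero.
      loops-lower with loops p q | loopOf p q P² Q² zero
      ... | suc _ | _ = s≤s z≤n

      loops-upper : loops p q * 2 ≤ m
      loops-upper = loops*2≤ p q P² Q² (nc-unfixed {p} p-nc)

      w-closed : Closed w
      w-closed = subst Dyck (sym upper≡) (arches⇒dyck (nc⇒arches {p} p-nc))
               , subst Dyck (sym lower≡) (arches⇒dyck (nc⇒arches {q} q-nc))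
      w-length : length w ≡ m
      w-length = trans (sym (length-map proj₁ w)) (trans (cong length upper≡) (length-wordOf p))

      common⇒reducible : 2 < m → ∀ i → toℕ i < toℕ (lookup p i) → lookup p i ≡ lookup q i → Reducible w
      common⇒reducible 2<m i lt same =
        factor⇒reducible w a a′ w-closed (subst (2 <_) (sym w-length) 2<m)
          (trans upper≡ e) (trans lower≡ e′) (trans a≡ (sym a′≡))
          (+-cancelˡ-≡ (suc (toℕ i)) _ _ (trans (sym f≡) (trans same′ f′≡))) d d′
        where
        same′ : onℕ p (toℕ i) ≡ onℕ q (toℕ i)
        same′ = trans (onℕ-toℕ p i) (trans (cong toℕ same) (sym (onℕ-toℕ q i)))
        lt′ : toℕ i < onℕ p (toℕ i)
        lt′ = subst (toℕ i <_) (sym (onℕ-toℕ p i)) lt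
        pFactor = arches-factor (nc⇒arches {p} p-nc) z≤n (toℕ<n i) lt′
        qFactor = arches-factor (nc⇒arches {q} q-nc) z≤n (toℕ<n i) (subst (toℕ i <_) same′ lt′)
        a  = proj₁ pFactor
        a′ = proj₁ qFactor
        e   = proj₁ (proj₂ (proj₂ (proj₂ pFactor)))
        d   = proj₁ (proj₂ (proj₂ (proj₂ (proj₂ pFactor))))
        a≡  = proj₁ (proj₂ (proj₂ (proj₂ (proj₂ (proj₂ pFactor)))))
        f≡  = proj₂ (proj₂ (proj₂ (proj₂ (proj₂ (proj₂ pFactor)))))
        e′  = proj₁ (proj₂ (proj₂ (proj₂ qFactor)))
        d′  = proj₁ (proj₂ (proj₂ (proj₂ (proj₂ qFactor))))
        a′≡ = proj₁ (proj₂ (proj₂ (proj₂ (proj₂ (proj₂ qFactor)))))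
        f′≡ = proj₂ (proj₂ (proj₂ (proj₂ (proj₂ (proj₂ qFactor)))))

      -- An arch common to both sides would make w reducible. Hence no loop has only two points, and
      -- each has at least four.
      loops-irreducible : 2 < m → ¬ Reducible w → loops p q * 4 ≤ m
      loops-irreducible 2<m irr = loops*4≤ p q P² Q² (nc-unfixed {p} p-nc) (nc-unfixed {q} q-nc) distinct
        where
        distinct : ∀ i → lookup p i ≢ lookup q i
        distinct i eq with <-cmp (toℕ i) (toℕ (lookup p i))
        ... | tri< lt _ _ = irr (common⇒reducible 2<m i lt eq)
        ... | tri≈ _ e _  = nc-unfixed {p} p-nc i (sym (toℕ-injective e))
        -- At the right end of a common arch, the argument is applied to its left end `lookup p i`.
        ... | tri> _ _ gt = irr (common⇒reducible 2<m (lookup p i)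
                (subst (toℕ (lookup p i) <_) (cong toℕ (sym (P² i))) gt)
                (trans (P² i) (trans (sym (Q² i)) (cong (lookup q) (sym eq)))))

-- The multiplicative weight and its relation to the numbers M

module Meanders where

  open import Defs using (NC₂; loops; F)
  open PowerSeries
  open WordSeries
  open Parsing using (FactorClosed; module Kernels; module Inflation)
  open Brackets
  open NonCrossing
  open import Data.Bool.Base using (if_then_else_; T)
  open import Data.Bool.Properties using (T-≡)
  import Data.Integer.Base as ℤ
  open import Data.Integer.Base using (ℤ; +_)
  import Data.Integer.Properties as ℤ
  open import Data.Integer.Properties using (+-*-commutativeRing)
  open import Data.List.Base using (_++_; map; length; filterᵇ; concatMap; cartesianProductWith)
  open import Data.List.Properties using (length-++; length-map; ∷-injective)
  open import Data.List.Membership.Propositional using (_∈_)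
  open import Data.List.Membership.Propositional.Properties
    using (∈-filter⁺; ∈-filter⁻; ∈-cartesianProductWith⁺; ∈-cartesianProductWith⁻)
  open import Data.List.Relation.Unary.All using ([]; _∷_)
  open import Data.List.Relation.Unary.AllPairs using ([]; _∷_)
  open import Data.List.Relation.Unary.Any using (here; there)
  open import Data.List.Relation.Unary.Unique.Propositional using (Unique)
  open import Data.List.Relation.Unary.Unique.Propositional.Properties using (filter⁺; cartesianProductWith⁺)
  open import Data.Nat.Base using (_+_; _*_; _∸_; _≡ᵇ_; _<ᵇ_)
  open import Data.Nat.Properties
  open import Data.Vec.Base using (Vec)
  open import Function.Base using (_∘_)
  open import Function.Bundles using (Equivalence)
  open import Relation.Binary.PropositionalEquality
  open import Relation.Nullary.Decidable using (T?)

  open FactorClosed closed-factorClosed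
  open Kernels closed-factorClosed

  -- The bound for irreducible words asks for more than two letters because the two-point loop is
  -- irreducible and has one loop on two points.
  record LoopCount (w : List Letter) : Set where
    field
      count       : ℕ
      labelling   : LoopLabelling w count
      positive    : 1 ≤ length w → 1 ≤ count
      bounded     : count * 2 ≤ length w
      irreducible : 2 < length w → ¬ Reducible w → count * 4 ≤ length w

  split-length : ∀ {w m} → length w ≡ m → length (upper w) ≡ m × length (lower w) ≡ m
  split-length {w} len = trans (length-map proj₁ w) len , trans (length-map proj₂ w) len

  closed⇒systems : ∀ {m′ w} → Closed w → length w ≡ suc m′ → ∃[ p ] ∃[ q ]
    (isNC {m′} p ≡ true × isNC {m′} q ≡ true) × (upper w ≡ wordOf p × lower w ≡ wordOf q)
  closed⇒systems {w = w} (d , d′) len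
    with wordOf-surjective (upper w) d (proj₁ (split-length {w} len))
       | wordOf-surjective (lower w) d′ (proj₂ (split-length {w} len))
  ... | p , p-nc , e | q , q-nc , e′ = p , q , (p-nc , q-nc) , (sym e , sym e′)

  loopCount : ∀ w → Closed w → LoopCount w
  loopCount [] cl = record
    { count = 0
    ; labelling = record
      { labels = [] ; upperRun = done ; lowerRun = done ; onto = λ ()
      ; factor = λ { [] r s → (λ ()) , refl } }
    ; positive = λ () ; bounded = z≤n ; irreducible = λ () }
  loopCount (x ∷ w) cl with closed⇒systems {w = x ∷ w} cl refl
  ... | p , q , (p-nc , q-nc) , (e , e′) = record
    { count = loops p q ; labelling = labelling ; positive = λ _ → loops-lower
    ; bounded = loops-upper ; irreducible = loops-irreducible }
    where
    open Meandric (x ∷ w) p q p-nc q-nc e e′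

  path-parity : ∀ {m u n} → Path m u n → ∃[ k ] m + length u ≡ n + k * 2
  path-parity {m} stop = 0 , refl
  path-parity {m} (up {u = u} p) with path-parity p
  ... | k , e = k , trans (+-suc m (length u)) e
  path-parity {suc m} {n = n} (down {u = u} p) with path-parity p
  ... | k , e = suc k , trans (cong suc (+-suc m (length u))) (trans (cong suc (cong suc e))
          (sym (trans (+-suc n _) (cong suc (+-suc n (k * 2))))))

  closed-even : ∀ {w} → Closed w → ∃[ k ] length w ≡ k * 2
  closed-even {w} (d , _) with path-parity d
  ... | k , e = k , trans (sym (length-map proj₁ w)) e

  -- The exponent n - loops of q for a system on 2n points. It takes a proof of closedness as
  -- argument; `excess-≡` shows that any half-length and any labelling give the same value.
  excess : ∀ w → Closed w → ℕ
  excess w cl = proj₁ (closed-even cl) ∸ LoopCount.count (loopCount w cl)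

  excess-≡ : ∀ w (cl : Closed w) {k l} → length w ≡ k * 2 → LoopLabelling w l → excess w cl ≡ k ∸ l
  excess-≡ w cl {k} e L = cong₂ _∸_ (*-cancelʳ-≡ _ k 2 (trans (sym (proj₂ (closed-even cl))) e))
    (labelling-unique (LoopCount.labelling (loopCount w cl)) L)

  ∸-+-∸ : ∀ {a b c d} → c ≤ a → d ≤ b → (a + b) ∸ (c + d) ≡ (a ∸ c) + (b ∸ d)
  ∸-+-∸ {a} {b} {c} {d} c≤a d≤b = begin
    (a + b) ∸ (c + d)             ≡⟨ cong₂ (λ x y → (x + y) ∸ (c + d)) (sym (m∸n+n≡m c≤a)) (sym (m∸n+n≡m d≤b)) ⟩
    ((a ∸ c + c) + (b ∸ d + d)) ∸ (c + d) ≡⟨ cong (_∸ (c + d)) (+-+-swap (a ∸ c) c (b ∸ d) d) ⟩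
    ((a ∸ c + (b ∸ d)) + (c + d)) ∸ (c + d) ≡⟨ m+n∸n≡m (a ∸ c + (b ∸ d)) (c + d) ⟩
    (a ∸ c) + (b ∸ d) ∎
    where
    open ≡-Reasoning
    +-+-swap : ∀ w x y z → (w + x) + (y + z) ≡ (w + y) + (x + z)
    +-+-swap w x y z = trans (+-assoc w x (y + z)) (trans (cong (λ k → w + k) (trans (sym (+-assoc x y z))
      (trans (cong (_+ z) (+-comm x y)) (+-assoc y x z)))) (sym (+-assoc w y (x + z))))

  count-≤ : ∀ w (cl : Closed w) → LoopCount.count (loopCount w cl) ≤ proj₁ (closed-even cl)
  count-≤ w cl = *-cancelʳ-≤ _ _ 2 (≤-trans (LoopCount.bounded (loopCount w cl)) (≤-reflexive (proj₂ (closed-even cl))))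

  -- Half-lengths add, and so do loops by `labelling-insert`. Truncated subtraction respects this
  -- because there are never more loops than half the number of points.
  excess-insert : ∀ a {c} b (acb : Closed (a ++ c ++ b)) (c-cl : Closed c) (ab : Closed (a ++ b)) →
    excess (a ++ c ++ b) acb ≡ excess c c-cl + excess (a ++ b) ab
  excess-insert a {c} b acb c-cl ab = trans
    (excess-≡ _ acb {k = K ab + K c-cl} len
      (labelling-insert a b c-cl (LoopCount.labelling (loopCount _ ab)) (LoopCount.labelling (loopCount c c-cl))))
    (trans (∸-+-∸ (count-≤ _ ab) (count-≤ c c-cl)) (+-comm (excess (a ++ b) ab) _))
    where
    K : ∀ {w} → Closed w → ℕ
    K cl = proj₁ (closed-even cl)
    open ≡-Reasoning
    len : length (a ++ c ++ b) ≡ (K ab + K c-cl) * 2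
    len = begin
      length (a ++ c ++ b)                ≡⟨ length-++ a ⟩
      length a + length (c ++ b)          ≡⟨ cong (λ k → length a + k) (trans (length-++ c) (+-comm (length c) _)) ⟩
      length a + (length b + length c)    ≡⟨ +-assoc (length a) _ _ ⟨
      length a + length b + length c      ≡⟨ cong (_+ length c) (length-++ a) ⟨
      length (a ++ b) + length c          ≡⟨ cong₂ _+_ (proj₂ (closed-even ab)) (proj₂ (closed-even c-cl)) ⟩
      K ab * 2 + K c-cl * 2               ≡⟨ *-distribʳ-+ 2 (K ab) (K c-cl) ⟨
      (K ab + K c-cl) * 2 ∎

  open Series +-*-commutativeRing public using () renaming
    (Coeffs to ℤSeries; seriesRing to ℤ⟦q⟧; _≋_ to _≋ᶻ_; _⊗_ to _⊗ᶻ_; const to constᶻ; shift to shiftᶻ; shift-⊗ to shift-⊗ᶻ; const-⊗ to const-⊗ᶻ)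

  monomial : ℕ → ℤSeries
  monomial zero    = constᶻ (+ 1)
  monomial (suc e) = shiftᶻ (monomial e)

  monomial-+ : ∀ a b → monomial (a + b) ≋ᶻ monomial a ⊗ᶻ monomial b
  monomial-+ zero    b n = sym (trans (const-⊗ᶻ (+ 1) (monomial b) n) (ℤ.*-identityˡ _))
  monomial-+ (suc a) b n = trans (shifted n) (sym (shift-⊗ᶻ (monomial a) (monomial b) n))
    where
    shifted : shiftᶻ (monomial (a + b)) ≋ᶻ shiftᶻ (monomial a ⊗ᶻ monomial b)
    shifted zero    = refl
    shifted (suc n) = monomial-+ a b n

  monomial-≡ᵇ : ∀ e r → monomial e r ≡ (if e ≡ᵇ r then + 1 else + 0)
  monomial-≡ᵇ zero    zero    = refl
  monomial-≡ᵇ zero    (suc r) = refl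
  monomial-≡ᵇ (suc e) zero    = refl
  monomial-≡ᵇ (suc e) (suc r) = monomial-≡ᵇ e r

  monomial-≢ : ∀ e r → e ≢ r → monomial e r ≡ + 0
  monomial-≢ zero    zero    ne = ⊥-elim (ne refl)
  monomial-≢ zero    (suc r) ne = refl
  monomial-≢ (suc e) zero    ne = refl
  monomial-≢ (suc e) (suc r) ne = monomial-≢ e r (ne ∘ cong suc)

  weight : List Letter → ℤSeries
  weight w with closed? w
  ... | yes cl = monomial (excess w cl)
  ... | no _   = λ _ → + 0

  weight-closed : ∀ w → ¬ Closed w → weight w ≋ᶻ λ _ → + 0
  weight-closed w ¬cl n with closed? w
  ... | yes cl = ⊥-elim (¬cl cl)
  ... | no _   = refl

  weight-insert : ∀ a {c} b → Closed c → weight (a ++ c ++ b) ≋ᶻ weight c ⊗ᶻ weight (a ++ b)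
  weight-insert a {c} b c-cl n with closed? (a ++ c ++ b) | closed? c | closed? (a ++ b)
  ... | yes acb | yes cl | yes ab = trans (cong (λ e → monomial e n) (excess-insert a b acb cl ab))
          (monomial-+ (excess c cl) (excess (a ++ b) ab) n)
  ... | yes acb | yes cl | no ¬ab = ⊥-elim (¬ab (remove a b cl acb))
  ... | no ¬acb | yes cl | yes ab = ⊥-elim (¬acb (insert a b cl ab))
  ... | no _    | yes cl | no _   = sym (zeroʳ (monomial (excess c cl)) n)
    where
    open CommutativeRing ℤ⟦q⟧ using (zeroʳ)
  ... | _       | no ¬cl | _      = ⊥-elim (¬cl c-cl)

  alphabet : List Letter
  alphabet = (true , true) ∷ (true , false) ∷ (false , true) ∷ (false , false) ∷ []

  open Words ℤ⟦q⟧ alphabet public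
  open Inflation ℤ⟦q⟧ alphabet closed-factorClosed weight weight-closed weight-insert public
    using (kernel; kernel-irreducible; inflate-kernel)

  total : ∀ {B : Set} → List B → (B → ℤ) → ℤ
  total []       f = + 0
  total (x ∷ xs) f = f x ℤ.+ total xs f

  total-++ : ∀ {B : Set} xs ys (f : B → ℤ) → total (xs ++ ys) f ≡ total xs f ℤ.+ total ys f
  total-++ []       ys f = sym (ℤ.+-identityˡ _)
  total-++ (x ∷ xs) ys f = trans (cong (ℤ._+_ (f x)) (total-++ xs ys f)) (sym (ℤ.+-assoc (f x) _ _))

  total-map : ∀ {B C : Set} (g : B → C) xs f → total (map g xs) f ≡ total xs (f ∘ g)
  total-map g []       f = refl
  total-map g (x ∷ xs) f = cong (ℤ._+_ (f (g x))) (total-map g xs f)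

  total-cong : ∀ {B : Set} xs {f g : B → ℤ} → (∀ x → f x ≡ g x) → total xs f ≡ total xs g
  total-cong []       p = refl
  total-cong (x ∷ xs) p = cong₂ ℤ._+_ (p x) (total-cong xs p)

  total-cartesianProductWith : ∀ {B C D : Set} (g : B → C → D) xs ys f →
    total (cartesianProductWith g xs ys) f ≡ total xs (λ x → total ys (λ y → f (g x y)))
  total-cartesianProductWith g []       ys f = refl
  total-cartesianProductWith g (x ∷ xs) ys f = trans (total-++ (map (g x) ys) _ f)
    (cong₂ ℤ._+_ (total-map (g x) ys f) (total-cartesianProductWith g xs ys f))

  total-indicator : ∀ {B : Set} xs (b : B → Bool) →
    total xs (λ x → if b x then + 1 else + 0) ≡ + length (filterᵇ b xs)
  total-indicator []       b = refl
  total-indicator (x ∷ xs) b with b x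
  ... | true  = cong (λ k → + 1 ℤ.+ k) (total-indicator xs b)
  ... | false = trans (ℤ.+-identityˡ _) (total-indicator xs b)

  words : ℕ → List (List Letter)
  words zero    = [] ∷ []
  words (suc N) = cartesianProductWith _∷_ alphabet (words N)

  sumOver-total : ∀ as (f : Letter → ℤSeries) r → sumOver as f r ≡ total as (λ a → f a r)
  sumOver-total []       f r = refl
  sumOver-total (a ∷ as) f r = cong (ℤ._+_ (f a r)) (sumOver-total as f r)

  generating-total : ∀ f N r → generating f N r ≡ total (words N) (λ w → f w r)
  generating-total f zero    r = sym (ℤ.+-identityʳ _)
  generating-total f (suc N) r = trans (sumOver-total alphabet (λ a → generating (after a f) N) r)
    (trans (total-cong alphabet (λ a → generating-total (after a f) N r))
      (sym (total-cartesianProductWith _∷_ alphabet (words N) (λ w → f w r))))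

  generating-cong-length : ∀ {f g : List Letter → ℤSeries} N r → (∀ w → length w ≡ N → f w r ≡ g w r) →
    generating f N r ≡ generating g N r
  generating-cong-length zero    r p = p [] refl
  generating-cong-length {f} {g} (suc N) r p = trans (sumOver-total alphabet (λ a → generating (after a f) N) r)
    (trans (total-cong alphabet (λ a → generating-cong-length {after a f} {after a g} N r
        (λ w e → p (a ∷ w) (cong suc e))))
      (sym (sumOver-total alphabet (λ a → generating (after a g) N) r)))

  generating-vanishes : ∀ f N r → (∀ w → length w ≡ N → f w r ≡ + 0) → generating f N r ≡ + 0
  generating-vanishes f N r p = trans (generating-cong-length {g = λ _ _ → + 0} N r p) (generating-0 N r)

  ∈-alphabet : ∀ x → x ∈ alphabet
  ∈-alphabet (true  , true)  = here refl
  ∈-alphabet (true  , false) = there (here refl)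
  ∈-alphabet (false , true)  = there (there (here refl))
  ∈-alphabet (false , false) = there (there (there (here refl)))

  ∈-words : ∀ w {N} → length w ≡ N → w ∈ words N
  ∈-words []      refl = here refl
  ∈-words (x ∷ w) refl = ∈-cartesianProductWith⁺ _∷_ (∈-alphabet x) (∈-words w refl)

  words-length : ∀ N {w} → w ∈ words N → length w ≡ N
  words-length zero    (here refl) = refl
  words-length (suc N) w∈ with ∈-cartesianProductWith⁻ _∷_ alphabet (words N) w∈
  ... | _ , _ , _ , v∈ , refl = cong suc (words-length N v∈)

  words-unique : ∀ N → Unique (words N)
  words-unique zero    = [] ∷ []
  words-unique (suc N) = cartesianProductWith⁺ _∷_ ∷-injective alphabet-unique (words-unique N)
    where
    alphabet-unique : Unique alphabet
    alphabet-unique = ((λ ()) ∷ (λ ()) ∷ (λ ()) ∷ []) ∷ ((λ ()) ∷ (λ ()) ∷ []) ∷ ((λ ()) ∷ []) ∷ [] ∷ []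

  hasExcess : ℕ → List Letter → Bool
  hasExcess r w with closed? w
  ... | yes cl = excess w cl ≡ᵇ r
  ... | no _   = false

  weight-indicator : ∀ w r → weight w r ≡ (if hasExcess r w then + 1 else + 0)
  weight-indicator w r with closed? w
  ... | yes cl = monomial-≡ᵇ (excess w cl) r
  ... | no _   = refl

  hasExcess⁻ : ∀ r w → hasExcess r w ≡ true → ∃[ cl ] excess w cl ≡ r
  hasExcess⁻ r w e with closed? w
  ... | yes cl = cl , ≡ᵇ⇒≡ _ _ (Equivalence.from T-≡ e)

  hasExcess⁺ : ∀ r w → Closed w → (∀ cl → excess w cl ≡ r) → hasExcess r w ≡ true
  hasExcess⁺ r w cl e with closed? w
  ... | yes cl′ = Equivalence.to T-≡ (≡⇒≡ᵇ _ _ (e cl′))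
  ... | no ¬cl  = ⊥-elim (¬cl cl)

  letters-≡ : ∀ (w v : List Letter) → upper w ≡ upper v → lower w ≡ lower v → w ≡ v
  letters-≡ []      []      _ _  = refl
  letters-≡ (x ∷ w) (y ∷ v) e e′ with ∷-injective e | ∷-injective e′
  ... | refl , f | refl , f′ = cong (x ∷_) (letters-≡ w v f f′)

  merge : ∀ (u v : List Bool) → length u ≡ length v → ∃[ w ] upper w ≡ u × lower w ≡ v
  merge []      []      _ = [] , refl , refl
  merge (x ∷ u) (y ∷ v) e with merge u v (suc-injective e)
  ... | w , refl , refl = (x , y) ∷ w , refl , refl

  module _ (n′ r : ℕ) where

    private
      n = suc n′
      -- `2 * n` reduces to `suc m′`, so the tables counted by `M` are those of the previous module
      -- by definition.
      m′ = n′ + suc (n′ + 0)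

      pairs : List (Vec _ (suc m′) × Vec _ (suc m′))
      pairs = concatMap (λ p → map (p ,_) (NC₂ (suc m′))) (NC₂ (suc m′))

      hasLoops : Vec _ (suc m′) × Vec _ (suc m′) → Bool
      hasLoops pq = loops (proj₁ pq) (proj₂ pq) ≡ᵇ (n ∸ r)

      Encodes : List Letter → Vec _ (suc m′) × Vec _ (suc m′) → Set
      Encodes w (p , q) = upper w ≡ wordOf p × lower w ≡ wordOf q

      pairs≡ : pairs ≡ cartesianProductWith _,_ (NC₂ (suc m′)) (NC₂ (suc m′))
      pairs≡ = concatMap-map _,_ (NC₂ (suc m′)) (NC₂ (suc m′))

      pairs-unique : Unique pairs
      pairs-unique = subst Unique (sym pairs≡)
        (cartesianProductWith⁺ _,_ (λ { refl → refl , refl }) NC₂-unique NC₂-unique)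

      ∈-pairs⁻ : ∀ {p q} → (p , q) ∈ pairs → isNC p ≡ true × isNC q ≡ true
      ∈-pairs⁻ pq∈ with ∈-cartesianProductWith⁻ _,_ (NC₂ (suc m′)) (NC₂ (suc m′)) (subst (_ ∈_) pairs≡ pq∈)
      ... | _ , _ , p∈ , q∈ , refl = ∈-NC₂⁻ p∈ , ∈-NC₂⁻ q∈

      encode : r ≤ n → ∀ {w} → w ∈ filterᵇ (hasExcess r) (words (suc m′)) →
        ∃[ pq ] pq ∈ filterᵇ hasLoops pairs × Encodes w pq
      encode r≤n {w} w∈ with ∈-filter⁻ (T? ∘ hasExcess r) {xs = words (suc m′)} w∈
      ... | w∈′ , h with hasExcess⁻ r w (Equivalence.to T-≡ h) | words-length (suc m′) w∈′
      ...   | cl , e | len with closed⇒systems {m′} {w} cl len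
      ...     | p , q , (p-nc , q-nc) , (e₁ , e₂) = (p , q) ,
                ∈-filter⁺ (T? ∘ hasLoops) (subst ((p , q) ∈_) (sym pairs≡)
                  (∈-cartesianProductWith⁺ _,_ (∈-NC₂⁺ p p-nc) (∈-NC₂⁺ q q-nc)))
                  (≡⇒≡ᵇ _ _ (trans (sym (m∸[m∸n]≡n l≤n)) (cong (n ∸_) (trans (sym (excess-≡ w cl (trans len m≡) labelling)) e)))) ,
                (e₁ , e₂)
        where
        open Meandric w p q p-nc q-nc e₁ e₂
        m≡ : suc m′ ≡ n * 2
        m≡ = *-comm 2 n
        l≤n : loops p q ≤ n
        l≤n = *-cancelʳ-≤ _ _ 2 (≤-trans loops-upper (≤-reflexive m≡))

      decode : r ≤ n → ∀ {pq} → pq ∈ filterᵇ hasLoops pairs →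
        ∃[ w ] w ∈ filterᵇ (hasExcess r) (words (suc m′)) × Encodes w pq
      decode r≤n {p , q} pq∈ with ∈-filter⁻ (T? ∘ hasLoops) {xs = pairs} pq∈
      ... | pq∈′ , h with ∈-pairs⁻ pq∈′ | merge (wordOf p) (wordOf q) (trans (length-wordOf p) (sym (length-wordOf q)))
      ...   | p-nc , q-nc | w , e₁ , e₂ = w , ∈-filter⁺ (T? ∘ hasExcess r) (∈-words w len)
                (Equivalence.from T-≡ (hasExcess⁺ r w w-closed λ cl → trans (excess-≡ w cl {n} {loops p q} (trans len (*-comm 2 n)) labelling)
                  (trans (cong (n ∸_) (≡ᵇ⇒≡ (loops p q) (n ∸ r) h)) (m∸[m∸n]≡n r≤n)))) , (e₁ , e₂)
        where
        open Meandric w p q p-nc q-nc e₁ e₂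
        len : length w ≡ suc m′
        len = trans (sym (length-map proj₁ w)) (trans (cong length e₁) (length-wordOf p))

    -- For r < n, words with excess r correspond to pairs of tables with n - r loops, and both sides
    -- are counted through `Encodes`. For r ≥ n the series F has coefficient 0, while a system with
    -- at least one loop has excess below n.
    generating-weight : generating weight (2 * n) r ≡ F r n
    generating-weight with r <ᵇ n in eq
    ... | true = trans (generating-total weight (2 * n) r)
          (trans (total-cong (words (2 * n)) (λ w → weight-indicator w r))
            (trans (total-indicator (words (2 * n)) (hasExcess r)) (cong +_ (≤-antisym
              (length-≤ Encodes (filter⁺ (T? ∘ hasExcess r) (words-unique (2 * n))) (encode r≤n)
                (λ { {w} {v} _ _ (e₁ , e₂) (f₁ , f₂) → letters-≡ w v (trans e₁ (sym f₁)) (trans e₂ (sym f₂)) }))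
              (length-≤ (λ pq w → Encodes w pq) (filter⁺ (T? ∘ hasLoops) pairs-unique) (decode r≤n) same)))))
      where
      r≤n : r ≤ n
      r≤n = <⇒≤ (<ᵇ⇒< _ _ (Equivalence.from T-≡ eq))
      same : ∀ {pq pq′ w} → pq ∈ filterᵇ hasLoops pairs → pq′ ∈ filterᵇ hasLoops pairs →
        Encodes w pq → Encodes w pq′ → pq ≡ pq′
      same {p , q} {p′ , q′} a b (e₁ , e₂) (f₁ , f₂)
        with ∈-pairs⁻ (proj₁ (∈-filter⁻ (T? ∘ hasLoops) {xs = pairs} a))
           | ∈-pairs⁻ (proj₁ (∈-filter⁻ (T? ∘ hasLoops) {xs = pairs} b))
      ... | pn , qn | pn′ , qn′ = cong₂ _,_ (wordOf-injective pn pn′ (trans (sym e₁) f₁))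
                                            (wordOf-injective qn qn′ (trans (sym e₂) f₂))
    ... | false = generating-vanishes weight (2 * n) r vanishes
      where
      n≤r : n ≤ r
      n≤r = ≮⇒≥ λ r<n → subst T eq (<⇒<ᵇ r<n)
      vanishes : ∀ w → length w ≡ 2 * n → weight w r ≡ + 0
      vanishes w len with closed? w
      ... | no _   = refl
      ... | yes cl = monomial-≢ (excess w cl) r (<⇒≢ (≤-trans excess<n n≤r))
        where
        open LoopCount (loopCount w cl)
        excess<n : excess w cl < n
        excess<n = subst (_< n) (sym (excess-≡ w cl (trans len (*-comm 2 n)) labelling))
          (∸-monoʳ-< {n} {count} {0} (positive (≤-trans (s≤s z≤n) (≤-reflexive (sym len))))
            (*-cancelʳ-≤ _ _ 2 (≤-trans bounded (≤-reflexive (trans len (*-comm 2 n))))))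

-- The coefficients κₚ of the irreducible systems

module IrreducibleSystems where

  open Parsing using (FactorClosed; module Kernels)
  open Brackets
  open Meanders
  open import Data.Integer.Base using (+_)
  open import Data.List.Base using (length)
  open import Data.Nat.Base using (_+_; _*_; _∸_)
  open import Data.Nat.Properties
  open import Relation.Binary.PropositionalEquality
  open import Relation.Nullary.Decidable using (toWitnessFalse)

  open FactorClosed closed-factorClosed
  open Kernels closed-factorClosed

  weight-closed-0 : ∀ w r → (Closed w → weight w r ≡ + 0) → weight w r ≡ + 0
  weight-closed-0 w r p = by (closed? w)
    where
    by : Dec (Closed w) → weight w r ≡ + 0
    by (yes cl) = p cl
    by (no ¬cl) = weight-closed w ¬cl r

  kernel-0 : ∀ w r → (Closed w → ¬ Reducible w → weight w r ≡ + 0) → kernel w r ≡ + 0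
  kernel-0 w r p with reducible? w
  ... | yes _   = refl
  ... | no irr = weight-closed-0 w r (λ cl → p cl irr)

  weight-≢ : ∀ w r → (∀ (cl : Closed w) → excess w cl ≢ r) → weight w r ≡ + 0
  weight-≢ w r p with closed? w
  ... | yes cl = monomial-≢ (excess w cl) r (p cl)
  ... | no _   = refl

  weight-≡ : ∀ w e r → Closed w → (∀ cl → excess w cl ≡ e) → weight w r ≡ monomial e r
  weight-≡ w e r cl p with closed? w
  ... | yes cl′ = cong (λ e → monomial e r) (p cl′)
  ... | no ¬cl  = ⊥-elim (¬cl cl)

  kernels-odd : ∀ N r → (∀ k → N ≢ k * 2) → generating kernel N r ≡ + 0
  kernels-odd N r odd = generating-vanishes kernel N r λ w len → kernel-0 w r λ cl _ →
    ⊥-elim (odd (proj₁ (closed-even cl)) (trans (sym len) (proj₂ (closed-even cl))))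

  -- With c loops on 2p points the exponent is r = p - c. Here c ≥ 1 gives r < p, and 4c ≤ 2p gives
  -- p ≤ 2r; the hypothesis 2 ≤ p puts aside the two-point loop.
  kernels-support : ∀ p r → 2 ≤ p → ¬ (r < p × p ≤ r * 2) → generating kernel (p * 2) r ≡ + 0
  kernels-support p r 2≤p out = generating-vanishes kernel (p * 2) r λ w len → kernel-0 w r λ cl irr →
    weight-≢ w r λ cl excess≡ → out (bounds w len cl irr excess≡)
    where
    bounds : ∀ w → length w ≡ p * 2 → (cl : Closed w) → ¬ Reducible w → excess w cl ≡ r → r < p × p ≤ r * 2
    bounds w len cl irr refl = subst (λ r → r < p × p ≤ r * 2) (sym e) (p∸c<p , p≤)
      where
      open LoopCount (loopCount w cl) renaming (irreducible to loops-irreducible)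
      e : excess w cl ≡ p ∸ count
      e = excess-≡ w cl len labelling
      4≤len : 4 ≤ length w
      4≤len = ≤-trans (*-monoˡ-≤ 2 2≤p) (≤-reflexive (sym len))
      1≤count : 1 ≤ count
      1≤count = positive (≤-trans (s≤s z≤n) 4≤len)
      count*2≤p : count * 2 ≤ p
      count*2≤p = *-cancelʳ-≤ _ _ 2 (≤-trans (≤-reflexive (*-assoc count 2 2))
        (≤-trans (loops-irreducible (≤-trans (n≤1+n 3) 4≤len) irr) (≤-reflexive len)))
      p∸c<p : p ∸ count < p
      p∸c<p = ∸-monoʳ-< {p} {count} {0} 1≤count (≤-trans (m≤m*n count 2) count*2≤p)
      open ≤-Reasoning
      p≤ : p ≤ (p ∸ count) * 2
      p≤ = begin
        p                   ≡⟨ m+n∸n≡m p p ⟨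
        p + p ∸ p ≤⟨ ∸-monoʳ-≤ (p + p) count*2≤p ⟩
        p + p ∸ count * 2 ≡⟨ cong (λ k → p + k ∸ count * 2) (+-identityʳ p) ⟨
        2 * p ∸ count * 2   ≡⟨ cong (_∸ count * 2) (*-comm 2 p) ⟩
        p * 2 ∸ count * 2   ≡⟨ *-distribʳ-∸ 2 p count ⟨
        (p ∸ count) * 2 ∎

  kernels-0 : ∀ r → generating kernel 0 r ≡ monomial 0 r
  kernels-0 r = refl

  -- This is κ₁ = 1, the source of the term t Y². Of the sixteen two-letter words all but the single
  -- loop evaluate to 0.
  kernels-2 : ∀ r → generating kernel 2 r ≡ monomial 0 r
  kernels-2 r = trans (generating-cong-length {kernel} {single} 2 r λ w len → only w len) (single-total r)
    where
    w₀ : List Letter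
    w₀ = (true , true) ∷ (false , false) ∷ []
    single : List Letter → ℤSeries
    single ((true , true) ∷ (false , false) ∷ []) = monomial 0
    single _                                      = λ _ → + 0
    single-total : ∀ r → generating single 2 r ≡ monomial 0 r
    single-total zero    = refl
    single-total (suc r) = refl
    w₀-closed : Closed w₀
    w₀-closed = up (down stop) , up (down stop)
    excess-0 : (cl : Closed w₀) → excess w₀ cl ≡ 0
    -- The half-length is 1 and there is at least one loop, hence the difference is 0.
    excess-0 cl = trans (excess-≡ w₀ cl {1} refl labelling) (m≤n⇒m∸n≡0 (positive (s≤s z≤n)))
      where
      open LoopCount (loopCount w₀ cl)
    kernel-w₀ : kernel w₀ r ≡ monomial 0 r
    kernel-w₀ = trans (kernel-irreducible w₀ (toWitnessFalse {a? = reducible? w₀} _) r)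
      (weight-≡ w₀ 0 r w₀-closed excess-0)
    only : ∀ w → length w ≡ 2 → kernel w r ≡ single w r
    only ((true  , true)  ∷ (false , false) ∷ []) _ = kernel-w₀
    only ((true  , true ) ∷ (true  , true ) ∷ []) _ = refl
    only ((true  , true ) ∷ (true  , false) ∷ []) _ = refl
    only ((true  , true ) ∷ (false , true ) ∷ []) _ = refl
    only ((true  , false) ∷ (true  , true ) ∷ []) _ = refl
    only ((true  , false) ∷ (true  , false) ∷ []) _ = refl
    only ((true  , false) ∷ (false , true ) ∷ []) _ = refl
    only ((true  , false) ∷ (false , false) ∷ []) _ = refl
    only ((false , true ) ∷ (true  , true ) ∷ []) _ = refl
    only ((false , true ) ∷ (true  , false) ∷ []) _ = refl
    only ((false , true ) ∷ (false , true ) ∷ []) _ = refl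
    only ((false , true ) ∷ (false , false) ∷ []) _ = refl
    only ((false , false) ∷ (true  , true ) ∷ []) _ = refl
    only ((false , false) ∷ (true  , false) ∷ []) _ = refl
    only ((false , false) ∷ (false , true ) ∷ []) _ = refl
    only ((false , false) ∷ (false , false) ∷ []) _ = refl

-- Composition and inversion of integer power series

module Composition where

  open import Defs hiding (F)
  open PowerSeries
  open WordSeries using (module Horner)
  open import Data.Integer.Base using (ℤ; +_; -_; _+_; _*_)
  open import Data.Integer.Properties
  open import Data.List.Base using (_++_; length; [_])
  open import Data.List.Properties using (length-++)
  open import Data.Nat.Base as ℕ using (ℕ; zero; suc; _∸_; _≤_; _<_; z≤n; s≤s)
  import Data.Nat.Properties as ℕ
  open import Algebra.Solver.Ring.NaturalCoefficients.Default +-*-commutativeSemiring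
    using (solve; _:=_; _:*_; _:+_)
  open import Relation.Binary.PropositionalEquality hiding ([_])

  open Series +-*-commutativeRing public using () renaming
    (seriesRing to ℤ⟦w⟧; _≋_ to _≋ʷ_; _⊗_ to _⊗ʷ_; _⊕_ to _⊕ʷ_; _·_ to _·ʷ_; const to constʷ; shift to shiftʷ; tail to tailʷ; zeroˢ to zeroʷ; ⊗-cong to ⊗ʷ-cong; ⊗-comm to ⊗ʷ-comm; ⊗-assoc to ⊗ʷ-assoc; ⊗-distribʳ to ⊗ʷ-distribʳ; ·-⊗ to ·-⊗ʷ; const-⊗ to const-⊗ʷ; zero-⊗ to zero-⊗ʷ)
  open Horner ℤ⟦w⟧ public using () renaming (horner to hornerʷ)

  Upto : ℕ → PS → PS → Set
  Upto N f g = ∀ i → i ≤ N → f i ≡ g i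

  ⊗-upto : ∀ N {f f′ g g′} → Upto N f f′ → Upto N g g′ → Upto N (f ⊗ʷ g) (f′ ⊗ʷ g′)
  ⊗-upto N p q zero    le = cong₂ _*_ (p 0 z≤n) (q 0 z≤n)
  ⊗-upto (suc N) p q (suc i) (s≤s le) = cong₂ _+_ (cong₂ _*_ (p 0 z≤n) (q (suc i) (s≤s le)))
    (⊗-upto N (λ i le → p (suc i) (s≤s le)) (λ i le → q i (ℕ.m≤n⇒m≤1+n le)) i le)

  -- A factor without constant term gains one coefficient of precision; inductions on the precision
  -- rest on this.
  ⊗-upto-suc : ∀ N {g h h′} → g 0 ≡ + 0 → Upto N h h′ → Upto (suc N) (g ⊗ʷ h) (g ⊗ʷ h′)
  ⊗-upto-suc N {g} {h} {h′} g0 p zero    le = trans (cong (_* h 0) g0) (trans (*-zeroˡ (h 0))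
    (sym (trans (cong (_* h′ 0) g0) (*-zeroˡ (h′ 0)))))
  ⊗-upto-suc N {g} {h} {h′} g0 p (suc i) (s≤s le) = cong₂ _+_
    (trans (cong (_* h (suc i)) g0) (trans (*-zeroˡ (h (suc i))) (sym (trans (cong (_* h′ (suc i)) g0) (*-zeroˡ (h′ (suc i)))))))
    (⊗-upto N {tailʷ g} (λ _ _ → refl) p i le)

  sumTo-cong : ∀ N {f g : ℕ → ℤ} → (∀ i → i ≤ N → f i ≡ g i) → sumTo N f ≡ sumTo N g
  sumTo-cong zero    p = p 0 z≤n
  sumTo-cong (suc N) p = cong₂ _+_ (sumTo-cong N (λ i le → p i (ℕ.m≤n⇒m≤1+n le))) (p (suc N) ℕ.≤-refl)

  sumTo-front : ∀ N f → sumTo (suc N) f ≡ f 0 + sumTo N (λ i → f (suc i))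
  sumTo-front zero    f = refl
  sumTo-front (suc N) f = trans (cong (_+ f (suc (suc N))) (sumTo-front N f)) (+-assoc (f 0) _ _)

  sumTo-+ : ∀ N f g → sumTo N (λ i → f i + g i) ≡ sumTo N f + sumTo N g
  sumTo-+ zero    f g = refl
  sumTo-+ (suc N) f g = trans (cong (_+ (f (suc N) + g (suc N))) (sumTo-+ N f g))
    (solve 4 (λ a b x y → a :+ b :+ (x :+ y) := a :+ x :+ (b :+ y)) refl (sumTo N f) (sumTo N g) (f (suc N)) (g (suc N)))

  sumTo-* : ∀ N c f → sumTo N (λ i → c * f i) ≡ c * sumTo N f
  sumTo-* zero    c f = refl
  sumTo-* (suc N) c f = trans (cong (_+ c * f (suc N)) (sumTo-* N c f)) (sym (*-distribˡ-+ c _ _))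

  sumTo-extend : ∀ N k f → (∀ i → N < i → f i ≡ + 0) → sumTo (k ℕ.+ N) f ≡ sumTo N f
  sumTo-extend N zero    f p = refl
  sumTo-extend N (suc k) f p = trans (cong₂ _+_ (sumTo-extend N k f p) (p (suc k ℕ.+ N) (s≤s (ℕ.m≤n+m N k))))
    (+-identityʳ _)

  ⊛-⊗ : ∀ f g → f ⊛ g ≋ʷ f ⊗ʷ g
  ⊛-⊗ f g zero    = refl
  ⊛-⊗ f g (suc N) = trans (sumTo-front N (λ i → f i * g (suc N ∸ i)))
    (cong (λ x → f 0 * g (suc N) + x) (⊛-⊗ (tailʷ f) g N))

  one-const : one ≋ʷ constʷ (+ 1)
  one-const zero    = refl
  one-const (suc n) = refl

  const-one : ∀ c N → constʷ c N ≡ c * one N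
  const-one c zero    = sym (*-identityʳ c)
  const-one c (suc N) = sym (*-zeroʳ c)

  sumTo-⊗ : ∀ B g (h : ℕ → PS) N → (g ⊗ʷ (λ M → sumTo B (λ n → h n M))) N ≡ sumTo B (λ n → (g ⊗ʷ h n) N)
  sumTo-⊗ zero    g h N = refl
  sumTo-⊗ (suc B) g h N = trans (⊗ʷ-comm g _ N) (trans (⊗ʷ-distribʳ g (λ M → sumTo B (λ n → h n M)) (h (suc B)) N)
    (cong₂ _+_ (trans (⊗ʷ-comm _ g N) (sumTo-⊗ B g h N)) (⊗ʷ-comm (h (suc B)) g N)))

  ⊗-· : ∀ c f g → f ⊗ʷ (c ·ʷ g) ≋ʷ c ·ʷ (f ⊗ʷ g)
  ⊗-· c f g n = trans (⊗ʷ-comm f (c ·ʷ g) n) (trans (·-⊗ʷ c g f n) (cong (c *_) (⊗ʷ-comm g f n)))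

  module _ (G : PS) (G-0 : G 0 ≡ + 0) where

    power-0 : ∀ n N → N < n → (G ^ˢ n) N ≡ + 0
    power-0 (suc n) N (s≤s N≤n) = trans (⊛-⊗ G (G ^ˢ n) N) (low N N≤n)
      where
      low : ∀ N → N ≤ n → (G ⊗ʷ (G ^ˢ n)) N ≡ + 0
      low zero    le = cong (_* (G ^ˢ n) 0) G-0
      low (suc N) le = trans (⊗-upto-suc N {G} {G ^ˢ n} {zeroʷ} G-0
        (λ i i≤N → power-0 n i (ℕ.≤-<-trans i≤N le)) (suc N) ℕ.≤-refl)
        (trans (⊗ʷ-comm G zeroʷ (suc N)) (zero-⊗ʷ G (suc N)))

    horner-sumTo : ∀ B f N → hornerʷ (suc B) (λ n → constʷ (f n)) G N ≡ sumTo B (λ n → f n * (G ^ˢ n) N)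
    horner-sumTo zero    f N = trans (cong (_+_ (constʷ (f 0) N)) (trans (⊗ʷ-comm G zeroʷ N) (zero-⊗ʷ G N)))
      (trans (+-identityʳ _) (const-one (f 0) N))
    horner-sumTo (suc B) f N = begin
      constʷ (f 0) N + (G ⊗ʷ hornerʷ (suc B) (λ n → constʷ (f (suc n))) G) N
        ≡⟨ cong₂ _+_ (const-one (f 0) N) (⊗ʷ-cong {G} (λ _ → refl) (horner-sumTo B (tailʷ f)) N) ⟩
      f 0 * one N + (G ⊗ʷ (λ M → sumTo B (λ n → f (suc n) * (G ^ˢ n) M))) N
        ≡⟨ cong (_+_ (f 0 * one N)) (sumTo-⊗ B G (λ n M → f (suc n) * (G ^ˢ n) M) N) ⟩
      f 0 * one N + sumTo B (λ n → (G ⊗ʷ (f (suc n) ·ʷ (G ^ˢ n))) N)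
        ≡⟨ cong (_+_ (f 0 * one N)) (sumTo-cong B (λ n _ → trans (⊗-· (f (suc n)) G (G ^ˢ n) N)
             (cong (f (suc n) *_) (sym (⊛-⊗ G (G ^ˢ n) N))))) ⟩
      f 0 * one N + sumTo B (λ n → f (suc n) * (G ^ˢ suc n) N)
        ≡⟨ sumTo-front B (λ n → f n * (G ^ˢ n) N) ⟨
      sumTo (suc B) (λ n → f n * (G ^ˢ n) N) ∎
      where
      open ≡-Reasoning

    -- Since Gⁿ starts at degree n, every truncation reaching degree N gives the same coefficient.
    -- The slack k lets one truncation serve all coefficients up to a bound.
    ∘-horner : ∀ k f N → hornerʷ (suc (k ℕ.+ N)) (λ n → constʷ (f n)) G N ≡ (f ∘ˢ G) N
    ∘-horner k f N = trans (horner-sumTo (k ℕ.+ N) f N) (sumTo-extend N k _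
      (λ n N<n → trans (cong (f n *_) (power-0 n N N<n)) (*-zeroʳ (f n))))

    -- The first Horner step, from f = f 0 + x · tail f. The factor G in front of the recursive
    -- occurrence makes it usable for induction on precision.
    ∘-rec : ∀ f → f ∘ˢ G ≋ʷ constʷ (f 0) ⊕ʷ G ⊗ʷ (tailʷ f ∘ˢ G)
    ∘-rec f zero = trans (*-identityʳ (f 0)) (sym (trans (cong (λ x → f 0 + x * (tailʷ f ∘ˢ G) 0) G-0) (+-identityʳ (f 0))))
    ∘-rec f (suc N) = trans (sym (∘-horner 0 f (suc N))) (cong (λ x → + 0 + x)
      (⊗-upto-suc N {G} G-0 agree (suc N) ℕ.≤-refl))
      where
      agree : Upto N (hornerʷ (suc N) (λ n → constʷ (f (suc n))) G) (tailʷ f ∘ˢ G)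
      agree i i≤N = trans (cong (λ B → hornerʷ (suc B) (λ n → constʷ (f (suc n))) G i) (sym (ℕ.m∸n+n≡m i≤N)))
        (∘-horner (N ∸ i) (tailʷ f) i)

    ∘-upto : ∀ {f g} N → Upto N f g → Upto N (f ∘ˢ G) (g ∘ˢ G)
    ∘-upto N p i i≤N = sumTo-cong i (λ n n≤i → cong (_* (G ^ˢ n) i) (p n (ℕ.≤-trans n≤i i≤N)))

    ∘-cong : ∀ {f g} → f ≋ʷ g → (f ∘ˢ G) ≋ʷ (g ∘ˢ G)
    ∘-cong p N = ∘-upto N (λ i _ → p i) N ℕ.≤-refl

    ∘-⊕ : ∀ f g → (f ⊕ʷ g) ∘ˢ G ≋ʷ (f ∘ˢ G) ⊕ʷ (g ∘ˢ G)
    ∘-⊕ f g N = trans (sumTo-cong N (λ n _ → *-distribʳ-+ ((G ^ˢ n) N) (f n) (g n)))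
      (sumTo-+ N (λ n → f n * (G ^ˢ n) N) (λ n → g n * (G ^ˢ n) N))

    ∘-· : ∀ c f → (c ·ʷ f) ∘ˢ G ≋ʷ c ·ʷ (f ∘ˢ G)
    ∘-· c f N = trans (sumTo-cong N (λ n _ → *-assoc c (f n) _)) (sumTo-* N c (λ n → f n * (G ^ˢ n) N))

    ∘-zero : zeroʷ ∘ˢ G ≋ʷ zeroʷ
    ∘-zero N = trans (sumTo-cong N (λ n _ → *-zeroˡ ((G ^ˢ n) N))) (zeros N)
      where
      zeros : ∀ N → sumTo N (λ _ → + 0) ≡ + 0
      zeros zero    = refl
      zeros (suc N) = trans (+-identityʳ _) (zeros N)

    ∘-const : ∀ c → constʷ c ∘ˢ G ≋ʷ constʷ c
    ∘-const c N = trans (∘-rec (constʷ c) N) (trans (cong (_+_ (constʷ c N))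
      (trans (⊗ʷ-cong {G} (λ _ → refl) ∘-zero N) (trans (⊗ʷ-comm G zeroʷ N) (zero-⊗ʷ G N)))) (+-identityʳ _))

    ∘-shift : ∀ f → shiftʷ f ∘ˢ G ≋ʷ G ⊗ʷ (f ∘ˢ G)
    ∘-shift f N = trans (∘-rec (shiftʷ f) N) (trans (cong (_+ (G ⊗ʷ (f ∘ˢ G)) N) (zeros N)) (+-identityˡ _))
      where
      zeros : ∀ N → constʷ (+ 0) N ≡ + 0
      zeros zero    = refl
      zeros (suc N) = refl

    -- Both sides are unfolded by `∘-rec`. The remaining product `tailʷ f ⊗ʷ g` stands behind a
    -- factor G, so it is needed only to precision one lower, where the induction hypothesis holds.
    ∘-⊗-upto : ∀ N f g → Upto N ((f ⊗ʷ g) ∘ˢ G) ((f ∘ˢ G) ⊗ʷ (g ∘ˢ G))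
    ∘-⊗-upto N f g i i≤N = begin
      ((f ⊗ʷ g) ∘ˢ G) i
        ≡⟨ ∘-rec (f ⊗ʷ g) i ⟩
      constʷ (f 0 * g 0) i + (G ⊗ʷ ((f 0 ·ʷ tailʷ g ⊕ʷ tailʷ f ⊗ʷ g) ∘ˢ G)) i
        ≡⟨ cong (_+_ (constʷ (f 0 * g 0) i)) (trans (⊗ʷ-cong {G} (λ _ → refl)
             (λ j → trans (∘-⊕ (f 0 ·ʷ tailʷ g) (tailʷ f ⊗ʷ g) j) (cong (_+ ((tailʷ f ⊗ʷ g) ∘ˢ G) j) (∘-· (f 0) (tailʷ g) j))) i)
             (distribˡʷ G (f 0 ·ʷ (tailʷ g ∘ˢ G)) ((tailʷ f ⊗ʷ g) ∘ˢ G) i)) ⟩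
      constʷ (f 0 * g 0) i + ((G ⊗ʷ (f 0 ·ʷ (tailʷ g ∘ˢ G))) i + (G ⊗ʷ ((tailʷ f ⊗ʷ g) ∘ˢ G)) i)
        ≡⟨ cong₂ _+_ (const-* i) (cong₂ _+_ (⊗-· (f 0) G (tailʷ g ∘ˢ G) i) (ih N i≤N)) ⟩
      f 0 * constʷ (g 0) i + (f 0 * (G ⊗ʷ (tailʷ g ∘ˢ G)) i + (G ⊗ʷ ((tailʷ f ∘ˢ G) ⊗ʷ (g ∘ˢ G))) i)
        ≡⟨ solve 4 (λ a x y z → a :* x :+ (a :* y :+ z) := a :* (x :+ y) :+ z) refl (f 0) (constʷ (g 0) i) _ _ ⟩
      f 0 * (constʷ (g 0) i + (G ⊗ʷ (tailʷ g ∘ˢ G)) i) + (G ⊗ʷ ((tailʷ f ∘ˢ G) ⊗ʷ (g ∘ˢ G))) i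
        ≡⟨ cong₂ _+_ (trans (cong (f 0 *_) (sym (∘-rec g i))) (sym (const-⊗ʷ (f 0) (g ∘ˢ G) i)))
             (sym (⊗ʷ-assoc G (tailʷ f ∘ˢ G) (g ∘ˢ G) i)) ⟩
      (constʷ (f 0) ⊗ʷ (g ∘ˢ G)) i + ((G ⊗ʷ (tailʷ f ∘ˢ G)) ⊗ʷ (g ∘ˢ G)) i
        ≡⟨ ⊗ʷ-distribʳ (g ∘ˢ G) (constʷ (f 0)) (G ⊗ʷ (tailʷ f ∘ˢ G)) i ⟨
      ((constʷ (f 0) ⊕ʷ G ⊗ʷ (tailʷ f ∘ˢ G)) ⊗ʷ (g ∘ˢ G)) i
        ≡⟨ ⊗ʷ-cong {g = g ∘ˢ G} (∘-rec f) (λ _ → refl) i ⟨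
      ((f ∘ˢ G) ⊗ʷ (g ∘ˢ G)) i ∎
      where
      open ≡-Reasoning
      open CommutativeRing ℤ⟦w⟧ using () renaming (distribˡ to distribˡʷ)
      const-* : ∀ i → constʷ (f 0 * g 0) i ≡ f 0 * constʷ (g 0) i
      const-* zero    = refl
      const-* (suc i) = sym (*-zeroʳ (f 0))
      ih : ∀ N → i ≤ N → (G ⊗ʷ ((tailʷ f ⊗ʷ g) ∘ˢ G)) i ≡ (G ⊗ʷ ((tailʷ f ∘ˢ G) ⊗ʷ (g ∘ˢ G))) i
      ih zero    z≤n = trans (cong (_* ((tailʷ f ⊗ʷ g) ∘ˢ G) 0) G-0)
        (sym (cong (_* ((tailʷ f ∘ˢ G) ⊗ʷ (g ∘ˢ G)) 0) G-0))
      ih (suc N) le = ⊗-upto-suc N {G} G-0 (∘-⊗-upto N (tailʷ f) g) i le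

    ∘-⊗ : ∀ f g → (f ⊗ʷ g) ∘ˢ G ≋ʷ (f ∘ˢ G) ⊗ʷ (g ∘ˢ G)
    ∘-⊗ f g N = ∘-⊗-upto N f g N ℕ.≤-refl

  nth-< : ∀ (xs ys : List ℤ) i → i < length xs → nth (xs ++ ys) i ≡ nth xs i
  nth-< (x ∷ xs) ys zero    p       = refl
  nth-< (x ∷ xs) ys (suc i) (s≤s p) = nth-< xs ys i p

  nth-length : ∀ (xs : List ℤ) y → nth (xs ++ [ y ]) (length xs) ≡ y
  nth-length []       y = refl
  nth-length (x ∷ xs) y = nth-length xs y

  length-invList : ∀ f N → length (invList f N) ≡ suc N
  length-invList f zero    = refl
  length-invList f (suc N) = trans (length-++ (invList f N)) (trans (cong (ℕ._+ 1) (length-invList f N)) (ℕ.+-comm (suc N) 1))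

  -- Each coefficient of `inv₁` is read from a list of its own; this says that these lists are
  -- prefixes of one another, so that the recursion refers to `inv₁` itself.
  invList-prefix : ∀ f k N → nth (invList f (k ℕ.+ N)) N ≡ inv₁ f N
  invList-prefix f zero    N = refl
  invList-prefix f (suc k) N = trans (nth-< (invList f (k ℕ.+ N)) _ N
    (subst (N <_) (sym (length-invList f (k ℕ.+ N))) (s≤s (ℕ.m≤n+m N k)))) (invList-prefix f k N)

  sumFrom1-sumTo : ∀ N f → sumFrom1 (suc N) f ≡ sumTo N (λ i → f (suc i))
  sumFrom1-sumTo zero    f = +-identityˡ _
  sumFrom1-sumTo (suc N) f = cong (_+ f (suc (suc N))) (sumFrom1-sumTo N f)

  inv₁-suc : ∀ f N → inv₁ f (suc N) ≡ - (tailʷ f ⊗ʷ inv₁ f) N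
  inv₁-suc f N = trans (trans (cong (nth (invList f (suc N))) (sym (length-invList f N))) (nth-length (invList f N) _))
    (cong -_ (trans (sumFrom1-sumTo N (λ i → f i * nth (invList f N) (suc N ∸ i)))
      (trans (sumTo-cong N (λ i i≤N → cong (f (suc i) *_)
        (trans (cong (λ k → nth (invList f k) (N ∸ i)) (sym (ℕ.m+[n∸m]≡n i≤N))) (invList-prefix f i (N ∸ i)))))
        (⊛-⊗ (tailʷ f) (inv₁ f) N))))

  inv₁-inverse : ∀ f → f 0 ≡ + 1 → f ⊗ʷ inv₁ f ≋ʷ constʷ (+ 1)
  inv₁-inverse f f0 zero    = cong (_* + 1) f0
  inv₁-inverse f f0 (suc N) = trans (cong (_+ (tailʷ f ⊗ʷ inv₁ f) N)
    (trans (cong (_* inv₁ f (suc N)) f0) (trans (*-identityˡ _) (inv₁-suc f N)))) (+-inverseˡ ((tailʷ f ⊗ʷ inv₁ f) N))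

  X-⊗ : ∀ f → X ⊗ʷ f ≋ʷ shiftʷ f
  X-⊗ f zero    = refl
  X-⊗ f (suc n) = trans (cong₂ _+_ (*-zeroˡ (f (suc n))) (trans (⊗ʷ-cong {g = f} tail-X (λ _ → refl) n)
    (trans (const-⊗ʷ (+ 1) f n) (*-identityˡ (f n))))) (+-identityˡ (f n))
    where
    tail-X : tailʷ X ≋ʷ constʷ (+ 1)
    tail-X zero    = refl
    tail-X (suc n) = refl

-- Series in two variables: halving exponents, exchanging variables, substituting for t

module Bivariate where

  open PowerSeries
  open WordSeries using (module Horner)
  open Composition
  open import Defs using (PS; _∘ˢ_)
  import Data.Nat.Base as ℕ
  import Data.Integer.Base as ℤ
  import Data.Integer.Properties as ℤ
  open import Relation.Binary.PropositionalEquality as ≡ using (_≡_)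

  module Evens (R : CommutativeRing 0ℓ 0ℓ) where

    open CommutativeRing R
    open Series R
    open Horner seriesRing
    open CommutativeRing seriesRing using () renaming
      (refl to ≋-refl; sym to ≋-sym; trans to ≋-trans; +-cong to ⊕-cong; +-identityˡ to ⊕-identityˡ)

    Even : Coeffs → Set
    Even f = ∀ n → f (suc (n ℕ.* 2)) ≈ 0#

    -- Words of length 2n belong to tⁿ, so exponents have to be halved; this respects products as
    -- soon as one factor is even.
    evens : Coeffs → Coeffs
    evens f n = f (n ℕ.* 2)

    evens-⊗ : ∀ f g → Even f → evens (f ⊗ g) ≋ evens f ⊗ evens g
    evens-⊗ f g ev zero    = refl
    evens-⊗ f g ev (suc n) = +-congˡ (trans (+-cong (trans (*-congʳ (ev 0)) (zeroˡ _))
      (evens-⊗ (tail (tail f)) g (λ n → ev (suc n)) n)) (+-identityˡ _))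

    even-⊗ : ∀ f g → Even f → Even g → Even (f ⊗ g)
    even-⊗ f g ev ev′ zero    = trans (+-cong (trans (*-congˡ (ev′ 0)) (zeroʳ _))
      (trans (*-congʳ (ev 0)) (zeroˡ _))) (+-identityˡ _)
    even-⊗ f g ev ev′ (suc n) = trans (+-cong (trans (*-congˡ (ev′ (suc n))) (zeroʳ _))
      (trans (+-cong (trans (*-congʳ (ev 0)) (zeroˡ _)) (even-⊗ (tail (tail f)) g (λ n → ev (suc n)) ev′ n))
        (+-identityˡ _))) (+-identityˡ _)

    -- With the odd coefficients absent, two Horner steps merge into one multiplication by s². This
    -- is why κₚ comes with the power Y²ᵖ.
    horner-pairs : ∀ n (c : ℕ → Coeffs) s → (∀ k → c (suc (k ℕ.* 2)) ≋ zeroˢ) →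
      horner (n ℕ.* 2) c s ≋ horner n (λ p → c (p ℕ.* 2)) (s ⊗ s)
    horner-pairs zero    c s odd = ≋-refl
    horner-pairs (suc n) c s odd = ⊕-cong {c 0} ≋-refl (≋-trans
      (⊗-cong {s} ≋-refl (≋-trans (⊕-cong (odd 0) ≋-refl) (⊕-identityˡ _)))
      (≋-trans (≋-sym (⊗-assoc s s _))
        (⊗-cong {s ⊗ s} ≋-refl (horner-pairs n (λ j → c (suc (suc j))) s (λ k → odd (suc k))))))

    evens-horner : ∀ n (c : ℕ → Coeffs) s → Even s → evens (horner n c s) ≋ horner n (λ p → evens (c p)) (evens s)
    evens-horner zero    c s ev k = refl
    evens-horner (suc n) c s ev k = +-congˡ (trans (evens-⊗ s _ ev k)
      (⊗-cong {evens s} ≋-refl (evens-horner n (λ j → c (suc j)) s ev) k))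

    shift-⊗-shift : ∀ f → shift f ⊗ shift f ≋ shift (shift (f ⊗ f))
    shift-⊗-shift f n = trans (shift-⊗ f (shift f) n) (shifted n)
      where
      shifted : shift (f ⊗ shift f) ≋ shift (shift (f ⊗ f))
      shifted zero    = refl
      shifted (suc n) = trans (⊗-comm f (shift f) n) (shift-⊗ f f n)

    even-shift² : ∀ f → Even f → Even (shift (shift f))
    even-shift² f ev zero    = refl
    even-shift² f ev (suc n) = ev n

    evens-shift² : ∀ f → evens (shift (shift f)) ≋ shift (evens f)
    evens-shift² f zero    = refl
    evens-shift² f (suc n) = refl

    evens-const : ∀ c → evens (const c) ≋ const c
    evens-const c zero    = refl
    evens-const c (suc n) = refl

  open Series ℤ⟦w⟧ public using () renaming
    (seriesRing to ℤ⟦w⟧⟦q⟧; Coeffs to PS²; _≋_ to _≋²_; _⊗_ to _⊗²_; _⊕_ to _⊕²_; _·_ to _·²_; const to const²; shift to shift²; tail to tail²; ⊗-cong to ⊗²-cong; ⊗-assoc to ⊗²-assoc; ·-⊗ to ·-⊗²; const-⊗ to const-⊗²; ⊗-suc to ⊗²-suc)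
  open Horner ℤ⟦w⟧⟦q⟧ public using () renaming (horner to horner²)

  -- The rings `ℤ⟦q⟧` and `ℤ⟦w⟧` are one and the same, so `PS²` holds series in t over ℤ⟦q⟧ as well
  -- as series in q over ℤ⟦w⟧. Exchanging the indices changes which variable is the outer one.
  swap : PS² → PS²
  swap f r n = f n r

  -- The definition of `_⊗²_` peels the outer variable of F. This recursion peels the inner one and
  -- thereby matches the product of the swapped series.
  swap-suc : ∀ F G r n → (F ⊗² G) r (suc n) ≡
    ((λ i → F i 0) ⊗ʷ (λ j → G j (suc n))) r ℤ.+ ((λ i → tailʷ (F i)) ⊗² G) r n
  swap-suc F G zero    n = ≡.refl
  swap-suc F G (suc r) n = ≡.trans (≡.cong (ℤ._+_ ((F 0 ⊗ʷ G (suc r)) (suc n))) (swap-suc (tail² F) G r n))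
    (solve 4 (λ a b x y → a :+ b :+ (x :+ y) := a :+ x :+ (b :+ y)) ≡.refl
      (F 0 0 ℤ.* G (suc r) (suc n)) ((tailʷ (F 0) ⊗ʷ G (suc r)) n) _ _)
    where
    open import Algebra.Solver.Ring.NaturalCoefficients.Default ℤ.+-*-commutativeSemiring
      using (solve; _:=_; _:*_; _:+_)

  swap-zero : ∀ F G r → (F ⊗² G) r 0 ≡ ((λ i → F i 0) ⊗ʷ (λ j → G j 0)) r
  swap-zero F G zero    = ≡.refl
  swap-zero F G (suc r) = ≡.cong (ℤ._+_ (F 0 0 ℤ.* G (suc r) 0)) (swap-zero (tail² F) G r)

  swap-⊗ : ∀ f g n r → (f ⊗² g) n r ≡ (swap f ⊗² swap g) r n
  swap-⊗ f g zero    r = ≡.sym (swap-zero (swap f) (swap g) r)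
  swap-⊗ f g (suc n) r = ≡.trans (≡.cong (ℤ._+_ ((f 0 ⊗ʷ g (suc n)) r)) (swap-⊗ (tail² f) g n r))
    (≡.sym (swap-suc (swap f) (swap g) r n))

  -- Turns series in t with coefficients in ℤ⟦q⟧ into series in q with coefficients in ℤ⟦w⟧, t = G(w).
  module Substitute (G : PS) (G-0 : G 0 ≡ ℤ.+ 0) where

    Φ : PS² → PS²
    Φ f r = swap f r ∘ˢ G

    Φ-⊕ : ∀ f g → Φ (f ⊕² g) ≋² Φ f ⊕² Φ g
    Φ-⊕ f g r = ∘-⊕ G G-0 (swap f r) (swap g r)

    ∘-⊗² : ∀ F H r → ((F ⊗² H) r ∘ˢ G) ≋ʷ ((λ i → F i ∘ˢ G) ⊗² (λ i → H i ∘ˢ G)) r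
    ∘-⊗² F H zero    = ∘-⊗ G G-0 (F 0) (H 0)
    ∘-⊗² F H (suc r) N = ≡.trans (∘-⊕ G G-0 (F 0 ⊗ʷ H (suc r)) ((tail² F ⊗² H) r) N)
      (≡.cong₂ ℤ._+_ (∘-⊗ G G-0 (F 0) (H (suc r)) N) (∘-⊗² (tail² F) H r N))

    Φ-⊗ : ∀ f g → Φ (f ⊗² g) ≋² Φ f ⊗² Φ g
    Φ-⊗ f g r N = ≡.trans (∘-cong G G-0 (λ n → swap-⊗ f g n r) N) (∘-⊗² (swap f) (swap g) r N)

    Φ-shift : ∀ f → Φ (shift² f) ≋² const² G ⊗² Φ f
    Φ-shift f r N = ≡.trans (∘-cong G G-0 (shifted r) N)
      (≡.trans (∘-shift G G-0 (swap f r) N) (≡.sym (const-⊗² G (Φ f) r N)))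
      where
      shifted : ∀ r → swap (shift² f) r ≋ʷ shiftʷ (swap f r)
      shifted r zero    = ≡.refl
      shifted r (suc n) = ≡.refl

    constants : PS → PS²
    constants c r = constʷ (c r)

    Φ-const : ∀ c → Φ (const² c) ≋² constants c
    Φ-const c r N = ≡.trans (∘-cong G G-0 constant N) (∘-const G G-0 (c r) N)
      where
      constant : swap (const² c) r ≋ʷ constʷ (c r)
      constant zero    = ≡.refl
      constant (suc n) = ≡.refl

    Φ-horner : ∀ n (c : ℕ → PS) s → Φ (horner² n (λ p → const² (c p)) s) ≋² horner² n (λ p → constants (c p)) (Φ s)
    Φ-horner zero    c s r N = ∘-zero G G-0 N
    Φ-horner (suc n) c s r N = ≡.trans (Φ-⊕ (const² (c 0)) (s ⊗² h) r N)
      (≡.cong₂ ℤ._+_ (Φ-const (c 0) r N) (≡.trans (Φ-⊗ s h r N)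
        (⊗²-cong {Φ s} (λ _ _ → ≡.refl) (Φ-horner n (λ j → c (suc j)) s) r N)))
      where h = horner² n (λ p → const² (c (suc p))) s

    Φ-upto : ∀ {f g} N → (∀ n → n ≤ N → f n ≋ʷ g n) → ∀ r → Upto N (Φ f r) (Φ g r)
    Φ-upto N p r = ∘-upto G G-0 N (λ n n≤N → p n n≤N r)

-- The functional equation for Y, before and after substitution

module FunctionalEquation where

  open import Defs using (PS; F; substT; _∘ˢ_)
  open PowerSeries
  open Meanders
  open IrreducibleSystems
  open Composition
  open Bivariate
  open import Data.Integer.Base using (+_)
  open import Data.Nat.Base using (_*_)
  open import Data.Nat.Properties using (*-comm; *-monoˡ-≤; ≤-trans; ≤-reflexive; n≤1+n; suc-injective)
  open import Relation.Binary.PropositionalEquality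

  open Evens ℤ⟦q⟧
  open Substitute substT refl

  open CommutativeRing ℤ⟦w⟧⟦q⟧ using () renaming (refl to ≋-refl; trans to ≋-trans; +-cong to ⊕²-cong)

  horner²-cong : ∀ n {c d : ℕ → PS²} {s t} → (∀ p → c p ≋² d p) → s ≋² t → horner² n c s ≋² horner² n d t
  horner²-cong zero    p q = ≋-refl
  horner²-cong (suc n) p q = ⊕²-cong (p 0) (⊗²-cong q (horner²-cong n (λ j → p (suc j)) q))

  suc-*2-≢ : ∀ n k → suc (n * 2) ≢ k * 2
  suc-*2-≢ (suc n) (suc k) eq = suc-*2-≢ n k (suc-injective (suc-injective eq))

  systems : PS²
  systems = evens (generating weight)

  κ : ℕ → PS
  κ p = generating kernel (p * 2)

  -- The hypothesis on r is needed at n = 0: the empty system counts in `systems` for r = 0, whereas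
  -- the coefficient of F is 0.
  systems-F : ∀ r n → 1 ≤ r → systems n r ≡ F r n
  systems-F (suc r) zero    _ = refl
  systems-F r       (suc n) _ = trans (cong (λ N → generating weight N r) (*-comm (suc n) 2)) (generating-weight n r)

  weight-even : Even (generating weight)
  weight-even n r = generating-vanishes weight (suc (n * 2)) r λ w len → weight-closed-0 w r λ cl →
    ⊥-elim (suc-*2-≢ n (proj₁ (closed-even cl)) (trans (sym len) (proj₂ (closed-even cl))))

  -- Every word of length 2n is the sum over its parses by `inflate-kernel`, which
  -- `generating-inflate` turns into a sum of κ-terms in t Z; halving exponents then replaces (t Z)²
  -- by t Y².
  systems-upto : ∀ B n → n ≤ B →
    systems n ≋ʷ horner² (suc B) (λ p → const² (κ p)) (shift² (systems ⊗² systems)) n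
  systems-upto B n n≤B r = begin
    Z (n * 2) r
      ≡⟨ generating-cong-length (n * 2) r (λ w len → inflate-kernel B′ w
           (≤-trans (≤-reflexive len) (≤-trans (*-monoˡ-≤ 2 n≤B) (n≤1+n _))) r) ⟨
    generating (inflate weight B′ kernel) (n * 2) r
      ≡⟨ generating-inflate weight B′ kernel (n * 2) r ⟩
    horner² (suc B * 2) (λ j → const² (generating kernel j)) (shift² Z) (n * 2) r
      ≡⟨ horner-pairs (suc B) (λ j → const² (generating kernel j)) (shift² Z) odd (n * 2) r ⟩
    evens (horner² (suc B) (λ p → const² (κ p)) (shift² Z ⊗² shift² Z)) n r
      ≡⟨ horner²-cong (suc B) (λ p → ≋-refl {const² (κ p)}) (shift-⊗-shift Z) (n * 2) r ⟩
    evens (horner² (suc B) (λ p → const² (κ p)) (shift² (shift² (Z ⊗² Z)))) n r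
      ≡⟨ evens-horner (suc B) (λ p → const² (κ p)) (shift² (shift² (Z ⊗² Z)))
           (even-shift² (Z ⊗² Z) (even-⊗ Z Z weight-even weight-even)) n r ⟩
    horner² (suc B) (λ p → evens (const² (κ p))) (evens (shift² (shift² (Z ⊗² Z)))) n r
      ≡⟨ horner²-cong (suc B) (λ p → evens-const (κ p)) (≋-trans (evens-shift² (Z ⊗² Z)) shifted) n r ⟩
    horner² (suc B) (λ p → const² (κ p)) (shift² (systems ⊗² systems)) n r ∎
    where
    open ≡-Reasoning
    -- With this bound `suc B′` is `suc B * 2`, the even number of Horner terms that `horner-pairs`
    -- requires.
    B′ = suc (B * 2)
    Z = generating weight
    odd : ∀ k → const² (generating kernel (suc (k * 2))) ≋² λ _ _ → + 0
    odd k zero    r = kernels-odd (suc (k * 2)) r (suc-*2-≢ k)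
    odd k (suc n) r = refl
    shifted : shift² (evens (Z ⊗² Z)) ≋² shift² (systems ⊗² systems)
    shifted zero    = λ _ → refl
    shifted (suc n) = evens-⊗ Z Z weight-even n

  Ŷ : PS²
  Ŷ = Φ systems

  Ŷ-F : ∀ r → 1 ≤ r → Ŷ r ≋ʷ F r ∘ˢ substT
  Ŷ-F r 1≤r = ∘-cong substT refl (λ n → systems-F r n 1≤r)

  Ŷ-upto : ∀ B r → Upto B (Ŷ r) (horner² (suc B) (λ p → constants (κ p)) (const² substT ⊗² (Ŷ ⊗² Ŷ)) r)
  Ŷ-upto B r i i≤B = trans (Φ-upto B (systems-upto B) r i i≤B)
    (trans (Φ-horner (suc B) κ (shift² (systems ⊗² systems)) r i)
      (horner²-cong (suc B) (λ p → ≋-refl {constants (κ p)}) (λ r N → trans (Φ-shift (systems ⊗² systems) r N)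
        (⊗²-cong {const² substT} (λ _ _ → refl) (Φ-⊗ systems systems) r N)) r i))

-- Rational functions with denominator a power of 1 - w

module Supports where

  open import Defs using (PS; oneMinusX; X)
  open PowerSeries
  open Composition
  open Bivariate
  open import Data.Integer.Base as ℤ using (ℤ; +_)
  import Data.Integer.Properties as ℤ
  open import Data.Nat.Base using (_+_; _*_)
  open import Data.Nat.Properties
  open import Data.Nat.Tactic.RingSolver using (solve-∀)
  open import Relation.Binary.PropositionalEquality

  open CommutativeRing ℤ⟦w⟧ using () renaming (refl to ≋-refl; sym to ≋-sym; trans to ≋-trans;
    distribˡ to ⊗-distribˡ; *-identityˡ to ⊗-identityˡ; zeroʳ to ⊗-zeroʳ; commutativeSemiring to ℤ⟦w⟧-semiring)

  Supported : ℕ → ℕ → PS → Set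
  Supported lo hi f = (∀ i → i < lo → f i ≡ + 0) × (∀ i → hi < i → f i ≡ + 0)

  product-low : ∀ i l l′ f g → (∀ j → j < l → f j ≡ + 0) → (∀ j → j < l′ → g j ≡ + 0) → i < l + l′ → (f ⊗ʷ g) i ≡ + 0
  product-low zero    zero    l′ f g p q lt = trans (cong (ℤ._*_ (f 0)) (q 0 lt)) (ℤ.*-zeroʳ (f 0))
  product-low zero    (suc l) l′ f g p q lt = cong (ℤ._* g 0) (p 0 (s≤s z≤n))
  product-low (suc i) zero    l′ f g p q lt = cong₂ ℤ._+_ (trans (cong (ℤ._*_ (f 0)) (q (suc i) lt)) (ℤ.*-zeroʳ (f 0)))
    (product-low i zero l′ (tailʷ f) g (λ _ ()) q (<-trans (n<1+n i) lt))
  product-low (suc i) (suc l) l′ f g p q (s≤s lt) = cong₂ ℤ._+_ (trans (cong (ℤ._* g (suc i)) (p 0 (s≤s z≤n))) (ℤ.*-zeroˡ (g (suc i))))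
    (product-low i l l′ (tailʷ f) g (λ j j<l → p (suc j) (s≤s j<l)) q lt)

  product-high : ∀ i d d′ f g → (∀ j → d < j → f j ≡ + 0) → (∀ j → d′ < j → g j ≡ + 0) → d + d′ < i → (f ⊗ʷ g) i ≡ + 0
  product-high (suc i) zero    d′ f g p q lt = cong₂ ℤ._+_ (trans (cong (ℤ._*_ (f 0)) (q (suc i) lt)) (ℤ.*-zeroʳ (f 0)))
    (trans (⊗ʷ-cong {tailʷ f} {zeroʷ} (λ j → p (suc j) (s≤s z≤n)) (λ _ → refl) i) (zero-⊗ʷ g i))
  product-high (suc i) (suc d) d′ f g p q (s≤s lt) = cong₂ ℤ._+_
    (trans (cong (ℤ._*_ (f 0)) (q (suc i) (s≤s (≤-trans (m≤n+m d′ d) (<⇒≤ lt))))) (ℤ.*-zeroʳ (f 0)))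
    (product-high i d d′ (tailʷ f) g (λ j d<j → p (suc j) (s≤s d<j)) q lt)

  supported-⊗ : ∀ {l h l′ h′ f g} → Supported l h f → Supported l′ h′ g → Supported (l + l′) (h + h′) (f ⊗ʷ g)
  supported-⊗ (p , q) (p′ , q′) = (λ i → product-low i _ _ _ _ p p′) , (λ i → product-high i _ _ _ _ q q′)

  supported-cong : ∀ {l h f g} → f ≋ʷ g → Supported l h f → Supported l h g
  supported-cong e (p , q) = (λ i lt → trans (sym (e i)) (p i lt)) , (λ i lt → trans (sym (e i)) (q i lt))

  supported-weaken : ∀ {l h l′ h′ f} → l′ ≤ l → h ≤ h′ → Supported l h f → Supported l′ h′ f
  supported-weaken l′≤l h≤h′ (p , q) = (λ i lt → p i (<-≤-trans lt l′≤l)) , (λ i lt → q i (≤-<-trans h≤h′ lt))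

  supported-⊕ : ∀ {l h f g} → Supported l h f → Supported l h g → Supported l h (f ⊕ʷ g)
  supported-⊕ (p , q) (p′ , q′) = (λ i lt → cong₂ ℤ._+_ (p i lt) (p′ i lt)) , (λ i lt → cong₂ ℤ._+_ (q i lt) (q′ i lt))

  powers : ℕ → PS
  powers zero    = constʷ (+ 1)
  powers (suc e) = oneMinusX ⊗ʷ powers e

  powers-+ : ∀ e e′ → powers (e + e′) ≋ʷ powers e ⊗ʷ powers e′
  powers-+ zero    e′ = ≋-sym (⊗-identityˡ (powers e′))
  powers-+ (suc e) e′ = ≋-trans (⊗ʷ-cong {oneMinusX} ≋-refl (powers-+ e e′)) (≋-sym (⊗ʷ-assoc oneMinusX (powers e) (powers e′)))

  supported-const : ∀ c → Supported 0 0 (constʷ c)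
  supported-const c = (λ _ ()) , λ { (suc i) _ → refl }

  supported-powers : ∀ e → Supported 0 e (powers e)
  supported-powers zero    = supported-const (+ 1)
  supported-powers (suc e) = supported-⊗ ((λ _ ()) , λ { (suc (suc i)) _ → refl ; (suc zero) (s≤s ()) }) (supported-powers e)

  -- f = w^lo P / (1 − w)^e with P a polynomial of degree at most hi − lo.
  Rational : ℕ → ℕ → ℕ → PS → Set
  Rational lo hi e f = Supported lo hi (powers e ⊗ʷ f)

  rational-cong : ∀ {l h e f g} → f ≋ʷ g → Rational l h e f → Rational l h e g
  rational-cong {e = e} p = supported-cong (⊗ʷ-cong {powers e} ≋-refl p)

  rational-⊕ : ∀ {l h e f g} → Rational l h e f → Rational l h e g → Rational l h e (f ⊕ʷ g)
  rational-⊕ {e = e} {f} {g} p q = supported-cong (≋-sym (⊗-distribˡ (powers e) f g)) (supported-⊕ p q)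

  rational-0 : ∀ {l h e f} → f ≋ʷ zeroʷ → Rational l h e f
  rational-0 {e = e} p = supported-cong (≋-sym (≋-trans (⊗ʷ-cong {powers e} ≋-refl p) (⊗-zeroʳ (powers e))))
    ((λ _ _ → refl) , (λ _ _ → refl))

  rational-⊗ : ∀ {l h e l′ h′ e′ f g} → Rational l h e f → Rational l′ h′ e′ g →
    Rational (l + l′) (h + h′) (e + e′) (f ⊗ʷ g)
  rational-⊗ {e = e} {e′ = e′} {f} {g} p q = supported-cong
    (≋-trans (solve 4 (λ a b c d → (a :* b) :* (c :* d) := (a :* c) :* (b :* d)) ≋-refl (powers e) f (powers e′) g)
      (⊗ʷ-cong {g = f ⊗ʷ g} (≋-sym (powers-+ e e′)) ≋-refl))
    (supported-⊗ p q)
    where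
    open import Algebra.Solver.Ring.NaturalCoefficients.Default ℤ⟦w⟧-semiring using (solve; _:=_; _:*_)

  -- Expanding the fraction by (1-w)ᵏ raises pole order and degree bound by k and keeps the lowest
  -- exponent.
  rational-convert : ∀ k {l h e l′ h′ e′ f} → l′ ≤ l → k + h ≤ h′ → k + e ≡ e′ → Rational l h e f → Rational l′ h′ e′ f
  rational-convert k {e = e} {f = f} l≤ h≤ refl p = supported-weaken l≤ h≤ (supported-cong
    (≋-trans (≋-sym (⊗ʷ-assoc (powers k) (powers e) f)) (⊗ʷ-cong {g = f} (≋-sym (powers-+ k e)) ≋-refl))
    (supported-⊗ (supported-powers k) p))

  rational-divide : ∀ {l h e f} → Rational l h e (oneMinusX ⊗ʷ f) → Rational l h (suc e) f
  rational-divide {e = e} {f} = supported-cong (≋-trans (≋-sym (⊗ʷ-assoc (powers e) oneMinusX f))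
    (⊗ʷ-cong {g = f} (⊗ʷ-comm (powers e) oneMinusX) ≋-refl))

  rational-polynomial : ∀ {l h f} → Supported l h f → Rational l h 0 f
  rational-polynomial p = supported-cong (≋-sym (⊗-identityˡ _)) p

  -- Being of this form is a condition on single coefficients of the numerator, each of which
  -- depends on finitely many coefficients of f.
  rational-limit : ∀ {l h e f} → (∀ N → ∃[ g ] Rational l h e g × Upto N f g) → Rational l h e f
  rational-limit {e = e} {f} lim =
    (λ i lt → let (g , (p , _) , u) = lim i in trans (agree i g u) (p i lt)) ,
    (λ i lt → let (g , (_ , q) , u) = lim i in trans (agree i g u) (q i lt))
    where
    agree : ∀ i g → Upto i f g → (powers e ⊗ʷ f) i ≡ (powers e ⊗ʷ g) i
    agree i g u = ⊗-upto i {powers e} (λ _ _ → refl) u i ≤-refl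

  convolution-closed : ∀ {Q : PS → Set} → (∀ f g → Q f → Q g → Q (f ⊕ʷ g)) →
    ∀ m f g → (∀ i j → i + j ≡ m → Q (f i ⊗ʷ g j)) → Q ((f ⊗² g) m)
  convolution-closed Q+ zero    f g p = p 0 0 refl
  convolution-closed {Q} Q+ (suc m) f g p = Q+ (f 0 ⊗ʷ g (suc m)) ((tail² f ⊗² g) m) (p 0 (suc m) refl)
    (convolution-closed {Q} Q+ m (tail² f) g (λ i j e → p (suc i) j (cong suc e)))

  -- The shape of the coefficient of q^m in w^p times a product of copies of V.
  Shape : ℕ → ℕ → PS → Set
  Shape p zero    = Rational p p 0
  Shape p (suc a) = Rational (p + (a + 2)) (p + (4 * a + 2)) (suc (2 * a))

  shape-⊕ : ∀ {p} m {f g} → Shape p m f → Shape p m g → Shape p m (f ⊕ʷ g)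
  shape-⊕ zero    {f} {g} = rational-⊕ {e = 0} {f} {g}
  shape-⊕ (suc a) {f} {g} = rational-⊕ {e = suc (2 * a)} {f} {g}

  shape-0 : ∀ {p} m {f} → f ≋ʷ zeroʷ → Shape p m f
  shape-0 zero    = rational-0 {e = 0}
  shape-0 (suc a) = rational-0 {e = suc (2 * a)}

  -- For two positive indices the pole orders add up to (2i-1) + (2j-1) = 2(i+j)-2, one short of the
  -- shape, so the fraction is expanded by 1-w. Apart from p + p′, its degree becomes 4(i+j)-3 and
  -- its lowest exponent i+j+2, within the bounds 4(i+j)-2 and i+j+1.
  shape-⊗ : ∀ p p′ i j {f g} → Shape p i f → Shape p′ j g → Shape (p + p′) (i + j) (f ⊗ʷ g)
  shape-⊗ p p′ zero    zero    {f} {g} = rational-⊗ {e = 0} {e′ = 0} {f} {g}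
  shape-⊗ p p′ zero    (suc b) {f} {g} r s = rational-convert 0 {e = suc (2 * b)} {f = f ⊗ʷ g} (≤-reflexive (+-assoc p p′ _))
    (≤-reflexive (sym (+-assoc p p′ _))) refl (rational-⊗ {e = 0} {e′ = suc (2 * b)} {f} {g} r s)
  shape-⊗ p p′ (suc a) zero    {f} {g} r s = rational-convert 0 {f = f ⊗ʷ g} (≤-reflexive (eq₁ p p′ a))
    (≤-reflexive (eq₂ p p′ a)) (eq₃ a) (rational-⊗ {e = suc (2 * a)} {e′ = 0} {f} {g} r s)
    where
    eq₁ : ∀ p p′ a → (p + p′) + ((a + 0) + 2) ≡ (p + (a + 2)) + p′
    eq₁ = solve-∀
    eq₂ : ∀ p p′ a → (p + (4 * a + 2)) + p′ ≡ (p + p′) + (4 * (a + 0) + 2)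
    eq₂ = solve-∀
    eq₃ : ∀ a → suc (2 * a) + 0 ≡ suc (2 * (a + 0))
    eq₃ = solve-∀
  shape-⊗ p p′ (suc a) (suc b) {f} {g} r s = rational-convert 1 {f = f ⊗ʷ g}
    (≤-trans (n≤1+n _) (≤-reflexive (eq₁ p p′ a b)))
    (≤-trans (n≤1+n _) (≤-reflexive (eq₂ p p′ a b)))
    (eq₃ a b) (rational-⊗ {e = suc (2 * a)} {e′ = suc (2 * b)} {f} {g} r s)
    where
    eq₁ : ∀ p p′ a b → suc ((p + p′) + ((a + suc b) + 2)) ≡ (p + (a + 2)) + (p′ + (b + 2))
    eq₁ = solve-∀
    eq₂ : ∀ p p′ a b → suc (1 + ((p + (4 * a + 2)) + (p′ + (4 * b + 2)))) ≡ (p + p′) + (4 * (a + suc b) + 2)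
    eq₂ = solve-∀
    eq₃ : ∀ a b → 1 + (suc (2 * a) + suc (2 * b)) ≡ suc (2 * (a + suc b))
    eq₃ = solve-∀

  shape-⊗² : ∀ p p′ m f g → (∀ i → i ≤ m → Shape p i (f i)) → (∀ j → j ≤ m → Shape p′ j (g j)) →
    Shape (p + p′) m ((f ⊗² g) m)
  shape-⊗² p p′ m f g r s = convolution-closed {Q = Shape (p + p′) m} (λ f g → shape-⊕ m {f} {g}) m f g
    λ { i j refl → shape-⊗ p p′ i j {f i} {g j} (r i (m≤m+n i j)) (s j (m≤n+m j i)) }

  shape-const-X : ∀ m → Shape 1 m (const² X m)
  shape-const-X zero    = rational-polynomial {f = X} ((λ { zero _ → refl ; (suc _) (s≤s ()) }) , λ { (suc (suc i)) _ → refl ; (suc zero) (s≤s ()) })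
  shape-const-X (suc m) = shape-0 {1} (suc m) ≋-refl

-- The recursion for the coefficients Vᵣ and their shape

module Expansion where

  open import Defs using (PS; X; onePlusX; oneMinusX; inv₁; _^ˢ_; substT)
  open PowerSeries
  open Meanders using (monomial)
  open IrreducibleSystems
  open Composition
  open Bivariate
  open FunctionalEquation
  open Supports
  open import Data.Integer.Base as ℤ using (ℤ; +_)
  import Data.Integer.Properties as ℤ
  open import Algebra.Properties.Group (CommutativeRing.+-group ℤ.+-*-commutativeRing) using () renaming (∙-cancelʳ to +-cancelʳᶻ)
  open import Data.Nat.Base using (_+_; _*_)
  open import Data.Nat.Properties
  open import Data.Nat.Tactic.RingSolver using (solve-∀)
  open import Relation.Binary.PropositionalEquality
  open import Relation.Nullary.Decidable using (_×-dec_)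

  private
    open Substitute substT refl using (constants)
    module W = CommutativeRing ℤ⟦w⟧
    module Q = CommutativeRing ℤ⟦w⟧⟦q⟧
    module WSolver where
      open import Algebra.Solver.Ring.NaturalCoefficients.Default W.commutativeSemiring public using (solve; _:=_; _:*_)
    module QSolver where
      open import Algebra.Solver.Ring.NaturalCoefficients.Default Q.commutativeSemiring public using (solve; _:=_; _:*_; _:+_)
    module ℤSolver where
      open import Algebra.Solver.Ring.NaturalCoefficients.Default ℤ.+-*-commutativeSemiring public using (solve; _:=_; _:+_)

  u : PS
  u = inv₁ onePlusX

  onePlusX-u : onePlusX ⊗ʷ u ≋ʷ constʷ (+ 1)
  onePlusX-u = inv₁-inverse onePlusX refl

  square : onePlusX ^ˢ 2 ≋ʷ onePlusX ⊗ʷ onePlusX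
  square = W.trans (⊛-⊗ onePlusX (onePlusX ^ˢ 1)) (⊗ʷ-cong {onePlusX} W.refl
    (W.trans (⊛-⊗ onePlusX (onePlusX ^ˢ 0)) (W.trans (⊗ʷ-cong {onePlusX} W.refl one-const) (W.*-identityʳ onePlusX))))

  -- Uniqueness of inverses: multiplying by ((1+w) u)² = 1 trades the inverse of (1+w)² for u².
  substT-u : substT ≋ʷ X ⊗ʷ (u ⊗ʷ u)
  substT-u = W.trans (⊛-⊗ X c) (⊗ʷ-cong {X} W.refl (W.trans (W.sym (W.*-identityˡ c))
    (W.trans (⊗ʷ-cong {g = c} (W.sym (W.trans (⊗ʷ-cong onePlusX-u onePlusX-u) (W.*-identityˡ _))) W.refl)
      (W.trans (WSolver.solve 3 (λ b u c → ((b :* u) :* (b :* u)) :* c := (u :* u) :* ((b :* b) :* c)) W.refl onePlusX u c)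
        (W.trans (⊗ʷ-cong {u ⊗ʷ u} W.refl (W.trans (⊗ʷ-cong {g = c} (W.sym square) W.refl) (inv₁-inverse (onePlusX ^ˢ 2) refl)))
          (W.*-identityʳ _))))))
    where
    open WSolver
    c = inv₁ (onePlusX ^ˢ 2)

  V : PS²
  V r = u ⊗ʷ Ŷ r

  onePlusX-V : ∀ r → onePlusX ⊗ʷ V r ≋ʷ Ŷ r
  onePlusX-V r = W.trans (W.sym (⊗ʷ-assoc onePlusX u (Ŷ r))) (W.trans (⊗ʷ-cong {g = Ŷ r} onePlusX-u W.refl) (W.*-identityˡ (Ŷ r)))

  const²-* : ∀ a c → const² (a ⊗ʷ c) ≋² const² a ⊗² const² c
  const²-* a c r = W.trans (at r) (W.sym (const-⊗² a (const² c) r))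
    where
    at : ∀ r → const² (a ⊗ʷ c) r ≋ʷ a ⊗ʷ const² c r
    at zero    = W.refl
    at (suc r) = W.sym (W.zeroʳ a)

  s : PS²
  s = const² X ⊗² (V ⊗² V)

  s-Ŷ : const² substT ⊗² (Ŷ ⊗² Ŷ) ≋² s
  s-Ŷ = Q.trans (⊗²-cong {g = Ŷ ⊗² Ŷ} const-substT Q.refl)
    (Q.trans (QSolver.solve 3 (λ x u y → (x :* (u :* u)) :* (y :* y) := x :* ((u :* y) :* (u :* y))) Q.refl (const² X) (const² u) Ŷ)
      (⊗²-cong {const² X} Q.refl (⊗²-cong (const-⊗² u Ŷ) (const-⊗² u Ŷ))))
    where
    open QSolver
    const-substT : const² substT ≋² const² X ⊗² (const² u ⊗² const² u)
    const-substT = Q.trans at (Q.trans (const²-* X (u ⊗ʷ u)) (⊗²-cong {const² X} Q.refl (const²-* u u)))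
      where
      at : const² substT ≋² const² (X ⊗ʷ (u ⊗ʷ u))
      at zero    = substT-u
      at (suc r) = W.refl

  K : ℕ → PS²
  K p = constants (κ p)

  -- The sum of κₚ s^(p-2) over 2 ≤ p ≤ N + 1; accordingly `rest N` is the truncated sum of κₚ wᵖ
  -- V²ᵖ.
  H : ℕ → PS²
  H N = horner² N (λ j → K (2 + j)) s

  K-1 : K 1 ≋² Q.1#
  K-1 zero    = λ i → cong (λ c → constʷ c i) (kernels-2 0)
  K-1 (suc r) zero    = kernels-2 (suc r)
  K-1 (suc r) (suc i) = refl

  onePlusX-⊗ : ∀ f → onePlusX ⊗ʷ f ≋ʷ f ⊕ʷ shiftʷ f
  onePlusX-⊗ f zero    = trans (ℤ.*-identityˡ (f 0)) (sym (ℤ.+-identityʳ (f 0)))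
  onePlusX-⊗ f (suc i) = cong₂ ℤ._+_ (ℤ.*-identityˡ (f (suc i)))
    (trans (⊗ʷ-cong {g = f} tail-1+X W.refl i) (W.*-identityˡ f i))
    where
    tail-1+X : tailʷ onePlusX ≋ʷ constʷ (+ 1)
    tail-1+X zero    = refl
    tail-1+X (suc i) = refl

  s-shift : ∀ r → s r ≋ʷ shiftʷ ((V ⊗² V) r)
  s-shift r = W.trans (const-⊗² X (V ⊗² V) r) (X-⊗ ((V ⊗² V) r))

  rest : ℕ → PS²
  rest N = s ⊗² (s ⊗² H N)

  -- The first two Horner steps are split off, with κ₀ = κ₁ = 1. The remaining N terms suffice for
  -- the coefficients up to N.
  V-equation : ∀ N r i → i ≤ N →
    V r i ℤ.+ shiftʷ (V r) i ≡ constʷ (monomial 0 r) i ℤ.+ (shiftʷ ((V ⊗² V) r) i ℤ.+ rest N r i)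
  V-equation N r i i≤N = begin
    V r i ℤ.+ shiftʷ (V r) i       ≡⟨ onePlusX-⊗ (V r) i ⟨
    (onePlusX ⊗ʷ V r) i            ≡⟨ onePlusX-V r i ⟩
    Ŷ r i                          ≡⟨ Ŷ-upto (suc N) r i (m≤n⇒m≤1+n i≤N) ⟩
    horner² (2 + N) K (const² substT ⊗² (Ŷ ⊗² Ŷ)) r i
                                   ≡⟨ horner²-cong (2 + N) (λ p → Q.refl {K p}) s-Ŷ r i ⟩
    K 0 r i ℤ.+ (s ⊗² (K 1 ⊕² s ⊗² H N)) r i
      ≡⟨ cong (ℤ._+_ (K 0 r i)) (trans (Q.distribˡ s (K 1) (s ⊗² H N) r i)
           (cong (λ x → x ℤ.+ rest N r i) (trans (⊗²-cong {s} Q.refl K-1 r i) (trans (Q.*-identityʳ s r i) (s-shift r i))))) ⟩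
    K 0 r i ℤ.+ (shiftʷ ((V ⊗² V) r) i ℤ.+ rest N r i)
      ≡⟨ cong (λ c → constʷ c i ℤ.+ (shiftʷ ((V ⊗² V) r) i ℤ.+ rest N r i)) (kernels-0 r) ⟩
    constʷ (monomial 0 r) i ℤ.+ (shiftʷ ((V ⊗² V) r) i ℤ.+ rest N r i) ∎
    where
    open ≡-Reasoning

  κ-0 : ∀ p r → 2 ≤ p → ¬ (r < p × p ≤ r * 2) → K p r ≋ʷ zeroʷ
  κ-0 p r 2≤p out zero    = kernels-support p r 2≤p out
  κ-0 p r 2≤p out (suc i) = refl

  rest-0 : ∀ N → rest N 0 ≋ʷ zeroʷ
  rest-0 N = W.trans (⊗ʷ-cong {s 0} W.refl (W.trans (⊗ʷ-cong {s 0} W.refl (horner-0 N 2 ≤-refl)) (W.zeroʳ (s 0)))) (W.zeroʳ (s 0))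
    where
    horner-0 : ∀ n p → 2 ≤ p → horner² n (λ j → K (p + j)) s 0 ≋ʷ zeroʷ
    horner-0 zero    p 2≤p i = refl
    horner-0 (suc n) p 2≤p i = cong₂ ℤ._+_
      (trans (cong (λ k → K k 0 i) (+-identityʳ p)) (κ-0 p 0 2≤p (λ { (_ , p≤0) → <⇒≱ (≤-trans (s≤s z≤n) 2≤p) p≤0 }) i))
      (trans (⊗ʷ-cong {s 0} W.refl (λ i → trans (horner²-cong n {s = s} (λ j r i → cong (λ k → K k r i) (+-suc p j)) Q.refl 0 i) (horner-0 n (suc p) (m≤n⇒m≤1+n 2≤p) i)) i)
        (W.zeroʳ (s 0) i))

  -- At q = 0 the equation is V₀ + w V₀ = 1 + w V₀². The factors w make each coefficient a function
  -- of the previous ones, and 1 is a solution.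
  V-0-upto : ∀ N → Upto N (V 0) (constʷ (+ 1))
  V-0-upto N zero _ = trans (sym (ℤ.+-identityʳ (V 0 0))) (trans (V-equation 0 0 0 z≤n)
    (cong (λ x → + 1 ℤ.+ (+ 0 ℤ.+ x)) (rest-0 0 0)))
  V-0-upto (suc N) (suc i) (s≤s i≤N) = +-cancelʳᶻ (constʷ (+ 1) i) _ _ (begin
    V 0 (suc i) ℤ.+ constʷ (+ 1) i     ≡⟨ cong (ℤ._+_ (V 0 (suc i))) (V-0-upto N i i≤N) ⟨
    V 0 (suc i) ℤ.+ V 0 i              ≡⟨ V-equation (suc i) 0 (suc i) ≤-refl ⟩
    + 0 ℤ.+ ((V 0 ⊗ʷ V 0) i ℤ.+ rest (suc i) 0 (suc i))
      ≡⟨ cong (λ x → + 0 ℤ.+ ((V 0 ⊗ʷ V 0) i ℤ.+ x)) (rest-0 (suc i) (suc i)) ⟩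
    + 0 ℤ.+ ((V 0 ⊗ʷ V 0) i ℤ.+ + 0)
      ≡⟨ cong (ℤ._+_ (+ 0)) (ℤ.+-identityʳ ((V 0 ⊗ʷ V 0) i)) ⟩
    + 0 ℤ.+ (V 0 ⊗ʷ V 0) i
      ≡⟨ cong (ℤ._+_ (+ 0)) (trans (⊗-upto N {V 0} {constʷ (+ 1)} {V 0} (V-0-upto N) (V-0-upto N) i i≤N) (W.*-identityˡ (constʷ (+ 1)) i)) ⟩
    + 0 ℤ.+ constʷ (+ 1) i ∎)
    where
    open ≡-Reasoning

  V-0 : V 0 ≋ʷ constʷ (+ 1)
  V-0 i = V-0-upto i i ≤-refl

  -- The terms of (V ⊗² V) (suc a) in which both indices are positive.
  mixed : ℕ → PS
  mixed zero    = zeroʷ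
  mixed (suc a) = (tail² V ⊗² tail² V) a

  -- Because V₀ = 1, the unknown V (suc a) enters the square just twice and linearly; `mixed`
  -- contains earlier coefficients only.
  V² : ∀ a → (V ⊗² V) (suc a) ≋ʷ (V (suc a) ⊕ʷ V (suc a)) ⊕ʷ mixed a
  V² zero    = W.trans (W.+-cong (W.trans (⊗ʷ-cong {g = V 1} V-0 W.refl) (W.*-identityˡ (V 1)))
    (W.trans (⊗ʷ-cong {V 1} W.refl V-0) (W.*-identityʳ (V 1)))) (W.sym (W.+-identityʳ _))
  V² (suc a) i = trans (cong₂ ℤ._+_ (trans (⊗ʷ-cong {g = V (suc (suc a))} V-0 W.refl i) (W.*-identityˡ _ i))
      (trans (⊗²-suc (tail² V) V a i) (cong (ℤ._+_ ((tail² V ⊗² tail² V) a i))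
        (trans (⊗ʷ-cong {V (suc (suc a))} W.refl V-0 i) (W.*-identityʳ (V (suc (suc a))) i)))))
    (ℤSolver.solve 3 (λ x y z → x :+ (y :+ z) := x :+ z :+ y) refl
      (V (suc (suc a)) i) (mixed (suc a) i) (V (suc (suc a)) i))
    where
    open ℤSolver

  oneMinusX-⊗ : ∀ f → oneMinusX ⊗ʷ f ≋ʷ λ i → f i ℤ.- shiftʷ f i
  oneMinusX-⊗ f zero    = trans (ℤ.*-identityˡ (f 0)) (sym (ℤ.+-identityʳ (f 0)))
  oneMinusX-⊗ f (suc i) = cong₂ ℤ._+_ (ℤ.*-identityˡ (f (suc i)))
    (trans (⊗ʷ-cong {g = f} tail-1-X W.refl i) (trans (const-⊗ʷ (ℤ.- + 1) f i) (ℤ.-1*i≡-i (f i))))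
    where
    tail-1-X : tailʷ oneMinusX ≋ʷ constʷ (ℤ.- + 1)
    tail-1-X zero    = refl
    tail-1-X (suc i) = refl

  -- Comparing V + wV on the left with 2wV + w · mixed + rest on the right leaves V - wV.
  oneMinusX-V : ∀ a N → Upto N (oneMinusX ⊗ʷ V (suc a)) (X ⊗ʷ mixed a ⊕ʷ rest N (suc a))
  oneMinusX-V a N i i≤N = trans (oneMinusX-⊗ (V (suc a)) i) (solve-for (V (suc a) i) (shiftʷ (V (suc a)) i) (begin
    V (suc a) i ℤ.+ shiftʷ (V (suc a)) i ≡⟨ V-equation N (suc a) i i≤N ⟩
    constʷ (+ 0) i ℤ.+ (shiftʷ ((V ⊗² V) (suc a)) i ℤ.+ rest N (suc a) i)
      ≡⟨ cong₂ ℤ._+_ (const-0 i) (cong (λ x → x ℤ.+ rest N (suc a) i) (shifted i)) ⟩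
    + 0 ℤ.+ ((shiftʷ (V (suc a)) i ℤ.+ shiftʷ (V (suc a)) i) ℤ.+ shiftʷ (mixed a) i ℤ.+ rest N (suc a) i)
      ≡⟨ cong (λ x → + 0 ℤ.+ ((shiftʷ (V (suc a)) i ℤ.+ shiftʷ (V (suc a)) i) ℤ.+ x ℤ.+ rest N (suc a) i)) (X-⊗ (mixed a) i) ⟨
    + 0 ℤ.+ ((shiftʷ (V (suc a)) i ℤ.+ shiftʷ (V (suc a)) i) ℤ.+ (X ⊗ʷ mixed a) i ℤ.+ rest N (suc a) i) ∎))
    where
    open ≡-Reasoning
    const-0 : ∀ i → constʷ (+ 0) i ≡ + 0
    const-0 zero    = refl
    const-0 (suc i) = refl
    shifted : ∀ i → shiftʷ ((V ⊗² V) (suc a)) i ≡ (shiftʷ (V (suc a)) i ℤ.+ shiftʷ (V (suc a)) i) ℤ.+ shiftʷ (mixed a) i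
    shifted zero    = refl
    shifted (suc i) = V² a i
    solve-for : ∀ v w {m t} → v ℤ.+ w ≡ + 0 ℤ.+ ((w ℤ.+ w) ℤ.+ m ℤ.+ t) → v ℤ.- w ≡ m ℤ.+ t
    solve-for v w {m} {t} e = +-cancelʳᶻ (w ℤ.+ w) _ _ (begin
      (v ℤ.- w) ℤ.+ (w ℤ.+ w)      ≡⟨ ℤ.+-assoc v (ℤ.- w) (w ℤ.+ w) ⟩
      v ℤ.+ (ℤ.- w ℤ.+ (w ℤ.+ w))  ≡⟨ cong (ℤ._+_ v) (trans (sym (ℤ.+-assoc (ℤ.- w) w w)) (trans (cong (λ x → x ℤ.+ w) (ℤ.+-inverseˡ w)) (ℤ.+-identityˡ w))) ⟩
      v ℤ.+ w                      ≡⟨ trans e (ℤ.+-identityˡ _) ⟩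
      (w ℤ.+ w) ℤ.+ m ℤ.+ t        ≡⟨ ℤSolver.solve 3 (λ x y z → x :+ y :+ z := y :+ z :+ x) refl (w ℤ.+ w) m t ⟩
      m ℤ.+ t ℤ.+ (w ℤ.+ w) ∎)
      where
      open ℤSolver

  module Step (a : ℕ) (V-shape : ∀ m → m < suc a → Shape 0 m (V m)) where

    -- The shape of (1-w) V (suc a): that of V (suc a) with the pole order lowered by one.
    Goal : PS → Set
    Goal = Rational (a + 2) (4 * a + 2) (2 * a)

    goal-⊕ : ∀ f g → Goal f → Goal g → Goal (f ⊕ʷ g)
    goal-⊕ f g = rational-⊕ {e = 2 * a} {f} {g}

    -- With a = i + j + 1 the pole orders (2i+1) + (2j+1) are exactly 2a, and the factor X brings
    -- the degree to 4a+1.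
    goal-mixed : Goal (X ⊗ʷ mixed a)
    goal-mixed = by a refl
      where
      by : ∀ b → a ≡ b → Goal (X ⊗ʷ mixed b)
      by zero    _    = rational-0 {e = 2 * a} {f = X ⊗ʷ zeroʷ} (W.zeroʳ X)
      by (suc b) refl = rational-cong {e = 2 * a} (·-⊗² X (tail² V) (tail² V) b)
        (convolution-closed {Goal} goal-⊕ b (X ·² tail² V) (tail² V) term)
        where
        term : ∀ i j → i + j ≡ b → Goal ((X ⊗ʷ V (suc i)) ⊗ʷ V (suc j))
        term i j refl = rational-convert 0 {e = suc (2 * i) + suc (2 * j)} {f = (X ⊗ʷ V (suc i)) ⊗ʷ V (suc j)}
          (≤-trans (n≤1+n _) (≤-trans (n≤1+n _) (≤-reflexive (eq₁ i j))))
          (≤-trans (n≤1+n _) (≤-reflexive (eq₂ i j))) (eq₃ i j)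
          (rational-⊗ {e = suc (2 * i)} {e′ = suc (2 * j)} {X ⊗ʷ V (suc i)} {V (suc j)}
            (shape-⊗ 1 0 0 (suc i) {X} {V (suc i)} (shape-const-X 0) (V-shape (suc i) (s≤s (s≤s (m≤m+n i j)))))
            (V-shape (suc j) (s≤s (s≤s (m≤n+m j i)))))
          where
          eq₁ : ∀ i j → 2 + (suc (i + j) + 2) ≡ (1 + 0 + (i + 2)) + (0 + (j + 2))
          eq₁ = solve-∀
          eq₂ : ∀ i j → suc (1 + 0 + (4 * i + 2) + (0 + (4 * j + 2))) ≡ 4 * suc (i + j) + 2
          eq₂ = solve-∀
          eq₃ : ∀ i j → suc (2 * i) + suc (2 * j) ≡ 2 * suc (i + j)
          eq₃ = solve-∀

    s-shape : ∀ m → m < suc a → Shape 1 m (s m)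
    s-shape m m<r = shape-⊗² 1 0 m (const² X) (V ⊗² V) (λ i _ → shape-const-X i)
      (λ j j≤m → shape-⊗² 0 0 j V V (λ i i≤j → V-shape i (≤-<-trans (≤-trans i≤j j≤m) m<r))
        (λ i i≤j → V-shape i (≤-<-trans (≤-trans i≤j j≤m) m<r)))

    -- Here t stands for sᵖ. By the support of κₚ only the terms with j < p ≤ 2j count, in
    -- particular j ≥ 1; hence only t i with i ≤ a occurs, and V (suc a) does not enter.
    goal-term : ∀ p t → 2 ≤ p → (∀ m → m < suc a → Shape p m (t m)) → Goal ((t ⊗² K p) (suc a))
    goal-term p t 2≤p t-shape = convolution-closed {Goal} goal-⊕ (suc a) t (K p) term
      where
      nonzero : ∀ i j → i + j ≡ suc a → j < p → p ≤ j * 2 → Goal (t i ⊗ʷ K p j)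
      -- The extreme case: t 0 is a multiple of wᵖ with a+2 ≤ p ≤ 2a+2. The smallest p gives the
      -- lowest exponent of `Goal`; the largest, after expansion by (1-w)^(2a), gives its degree
      -- 4a+2.
      nonzero zero    (suc .a) refl j<p p≤ = rational-convert (2 * a) {e = 0} {f = t 0 ⊗ʷ K p (suc a)}
        (≤-trans (≤-reflexive (+-comm a 2)) (≤-trans j<p (m≤m+n p 0)))
        (≤-trans (+-monoʳ-≤ (2 * a) (≤-trans (≤-reflexive (+-identityʳ p)) p≤)) (≤-reflexive (eq a))) (+-identityʳ (2 * a))
        (rational-⊗ {e = 0} {e′ = 0} {t 0} {K p (suc a)} (t-shape 0 (s≤s z≤n))
          (rational-polynomial {f = K p (suc a)} (supported-const (κ p (suc a)))))
        where
        eq : ∀ a → 2 * a + suc a * 2 ≡ 4 * a + 2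
        eq = solve-∀
      nonzero (suc i) zero    e j<p p≤ = ⊥-elim (<⇒≱ (≤-trans (s≤s z≤n) 2≤p) p≤)
      nonzero (suc i) (suc j) e j<p p≤ with trans (sym (+-suc i j)) (suc-injective e)
      -- The missing pole order is 2j+1, and p ≤ 2j+2 bounds the degree by 4(i+j)+5, one below the
      -- allowed 4a+2 with a = i+j+1.
      ... | refl = rational-convert (suc (2 * j)) {e = suc (2 * i) + 0} {f = t (suc i) ⊗ʷ K p (suc j)}
        (≤-trans (≤-reflexive (eq₁ i j)) (≤-trans (+-monoˡ-≤ (i + 2) (<⇒≤ j<p)) (m≤m+n _ 0)))
        (≤-trans (≤-reflexive (eq₂ i j p)) (≤-trans (+-monoʳ-≤ (suc (2 * j) + (4 * i + 2)) p≤)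
          (≤-trans (n≤1+n _) (≤-reflexive (eq₃ i j))))) (eq₄ i j)
        (rational-⊗ {e = suc (2 * i)} {e′ = 0} {t (suc i)} {K p (suc j)}
          (t-shape (suc i) (s≤s (s≤s (m≤m+n i j))))
          (rational-polynomial {f = K p (suc j)} (supported-const (κ p (suc j)))))
        where
        eq₁ : ∀ i j → suc (i + j) + 2 ≡ suc j + (i + 2)
        eq₁ = solve-∀
        eq₂ : ∀ i j p → suc (2 * j) + (p + (4 * i + 2) + 0) ≡ suc (2 * j) + (4 * i + 2) + p
        eq₂ = solve-∀
        eq₃ : ∀ i j → suc (suc (2 * j) + (4 * i + 2) + suc j * 2) ≡ 4 * suc (i + j) + 2
        eq₃ = solve-∀
        eq₄ : ∀ i j → suc (2 * j) + (suc (2 * i) + 0) ≡ 2 * suc (i + j)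
        eq₄ = solve-∀
      term : ∀ i j → i + j ≡ suc a → Goal (t i ⊗ʷ K p j)
      term i j e with (j <? p) ×-dec (p ≤? j * 2)
      ... | yes (j<p , p≤) = nonzero i j e j<p p≤
      ... | no out = rational-0 {e = 2 * a} {f = t i ⊗ʷ K p j} (W.trans (⊗ʷ-cong {t i} W.refl (κ-0 p j 2≤p out)) (W.zeroʳ (t i)))

    -- The Horner scheme is unrolled with t as accumulator for sᵖ, so that each κₚ meets a factor of
    -- known shape.
    goal-horner : ∀ n p t (c : ℕ → PS²) → (∀ j → c j ≡ K (p + j)) → 2 ≤ p → (∀ m → m < suc a → Shape p m (t m)) →
      Goal ((t ⊗² horner² n c s) (suc a))
    goal-horner zero    p t c c≡ 2≤p t-shape = rational-0 {e = 2 * a} (Q.zeroʳ t (suc a))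
    goal-horner (suc n) p t c c≡ 2≤p t-shape = rational-cong {e = 2 * a}
      (W.sym (W.trans (Q.distribˡ t (c 0) (s ⊗² h) (suc a))
        (W.+-cong (⊗²-cong {t} Q.refl (λ r i → cong (λ f → f r i) (trans (c≡ 0) (cong K (+-identityʳ p)))) (suc a))
          (Q.sym (⊗²-assoc t s h) (suc a)))))
      (goal-⊕ ((t ⊗² K p) (suc a)) (((t ⊗² s) ⊗² h) (suc a)) (goal-term p t 2≤p t-shape)
        (goal-horner n (suc p) (t ⊗² s) (λ j → c (suc j)) (λ j → trans (c≡ (suc j)) (cong K (+-suc p j)))
          (m≤n⇒m≤1+n 2≤p) ts-shape))
      where
      h = horner² n (λ j → c (suc j)) s
      ts-shape : ∀ m → m < suc a → Shape (suc p) m ((t ⊗² s) m)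
      ts-shape m m<r = subst (λ k → Shape k m ((t ⊗² s) m)) (+-comm p 1)
        (shape-⊗² p 1 m t s (λ i i≤m → t-shape i (≤-<-trans i≤m m<r)) (λ i i≤m → s-shape i (≤-<-trans i≤m m<r)))

    goal-rest : ∀ N → Goal (rest N (suc a))
    goal-rest N = rational-cong {e = 2 * a} (⊗²-assoc s s (H N) (suc a))
      (goal-horner N 2 (s ⊗² s) (λ j → K (2 + j)) (λ _ → refl) ≤-refl λ m m<r →
        shape-⊗² 1 1 m s s (λ i i≤m → s-shape i (≤-<-trans i≤m m<r)) (λ i i≤m → s-shape i (≤-<-trans i≤m m<r)))

    -- The right-hand side of `oneMinusX-V` changes with the precision N, whereas its shape does
    -- not; hence the passage through `rational-limit` before dividing by 1-w.
    V-shape-suc : Shape 0 (suc a) (V (suc a))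
    V-shape-suc = rational-divide {e = 2 * a} {V (suc a)} (rational-limit {e = 2 * a} {oneMinusX ⊗ʷ V (suc a)} λ N →
      X ⊗ʷ mixed a ⊕ʷ rest N (suc a) , goal-⊕ (X ⊗ʷ mixed a) (rest N (suc a)) goal-mixed (goal-rest N) , oneMinusX-V a N)

  V-shape : ∀ m → Shape 0 m (V m)
  V-shape m = below (suc m) m ≤-refl
    where
    below : ∀ n m → m < n → Shape 0 m (V m)
    below (suc n) zero    _         = rational-polynomial {f = V 0} (supported-cong (W.sym V-0) (supported-const (+ 1)))
    below (suc n) (suc a) (s≤s a<n) = Step.V-shape-suc a (λ m m≤a → below n m (≤-trans m≤a a<n))

-- Extraction of the polynomial and the final identity

open import Defs
open Composition
open Bivariate
open FunctionalEquation
open Supports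
open Expansion
open import Data.Nat using (_*_; _∸_; _+_)
import Data.Nat.Properties as ℕ
open import Data.Nat.Tactic.RingSolver using (solve-∀)
open import Data.Vec using (Vec; []; _∷_)
open import Data.Integer using (ℤ; +_)
open import Data.Product using (∃)
open import Relation.Binary.PropositionalEquality using (_≡_; refl; sym; trans; cong; subst)

private module W = CommutativeRing ℤ⟦w⟧

window : PS → (d : ℕ) → Vec ℤ d
window f zero    = []
window f (suc d) = f 0 ∷ window (tailʷ f) d

poly-window : ∀ f d → (∀ i → d ≤ i → f i ≡ + 0) → poly (window f d) ≋ʷ f
poly-window f zero    p i       = sym (p i z≤n)
poly-window f (suc d) p zero    = refl
poly-window f (suc d) p (suc i) = poly-window (tailʷ f) d (λ j d≤j → p (suc j) (s≤s d≤j)) i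

X-power-⊗ : ∀ n f → (∀ i → i < n → f i ≡ + 0) → X ^ˢ n ⊗ʷ (λ i → f (n + i)) ≋ʷ f
X-power-⊗ zero    f p i = trans (⊗ʷ-cong {g = f} one-const W.refl i) (W.*-identityˡ f i)
X-power-⊗ (suc n) f p i = trans (⊗ʷ-cong {g = λ i → f (suc n + i)} (⊛-⊗ X (X ^ˢ n)) W.refl i)
  (trans (⊗ʷ-assoc X (X ^ˢ n) (λ i → f (suc n + i)) i)
    (trans (⊗ʷ-cong {X} W.refl (X-power-⊗ n (tailʷ f) (λ j j<n → p (suc j) (s≤s j<n))) i)
      (trans (X-⊗ (tailʷ f) i) (restore i))))
  where
  restore : ∀ i → shiftʷ (tailʷ f) i ≡ f i
  restore zero    = sym (p 0 (s≤s z≤n))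
  restore (suc i) = refl

powers-^ˢ : ∀ e → powers e ≋ʷ oneMinusX ^ˢ e
powers-^ˢ zero    = W.sym one-const
powers-^ˢ (suc e) = W.trans (⊗ʷ-cong {oneMinusX} W.refl (powers-^ˢ e)) (W.sym (⊛-⊗ oneMinusX (oneMinusX ^ˢ e)))

powers-0 : ∀ e → (oneMinusX ^ˢ e) 0 ≡ + 1
powers-0 zero    = refl
powers-0 (suc e) = trans (cong (Data.Integer._*_ (+ 1)) (powers-0 e)) refl

theorem5p6 : (r : ℕ) → 1 ≤ r →
    ∃ λ (P : Vec ℤ (3 * r ∸ 2)) →
    (N : ℕ) → (F r ∘ˢ substT) N ≡ rhs r (poly P) N
theorem5p6 (suc a) 1≤r = P , λ N → sym (begin
  rhs r (poly P) N
    ≈⟨ W.trans (⊛-⊗ ((X ^ˢ suc r ⊛ onePlusX) ⊛ inv₁ D) (poly P)) (⊗ʷ-cong {g = poly P}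
         (W.trans (⊛-⊗ (X ^ˢ suc r ⊛ onePlusX) (inv₁ D)) (⊗ʷ-cong {g = inv₁ D} (⊛-⊗ (X ^ˢ suc r) onePlusX) W.refl)) W.refl) N ⟩
  (((X ^ˢ suc r ⊗ʷ onePlusX) ⊗ʷ inv₁ D) ⊗ʷ poly P) N
    ≈⟨ solve 4 (λ x b c p → ((x :* b) :* c) :* p := (b :* c) :* (x :* p)) W.refl (X ^ˢ suc r) onePlusX (inv₁ D) (poly P) N ⟩
  ((onePlusX ⊗ʷ inv₁ D) ⊗ʷ (X ^ˢ suc r ⊗ʷ poly P)) N
    ≈⟨ ⊗ʷ-cong {onePlusX ⊗ʷ inv₁ D} W.refl (W.trans (⊗ʷ-cong {X ^ˢ suc r} W.refl P-g)
         (W.trans (X-power-⊗ (suc r) g g-low) (⊗ʷ-cong {g = V r} D-powers W.refl))) N ⟩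
  ((onePlusX ⊗ʷ inv₁ D) ⊗ʷ (D ⊗ʷ V r)) N
    ≈⟨ solve 4 (λ b c d v → (b :* c) :* (d :* v) := (d :* c) :* (b :* v)) W.refl onePlusX (inv₁ D) D (V r) N ⟩
  ((D ⊗ʷ inv₁ D) ⊗ʷ (onePlusX ⊗ʷ V r)) N
    ≈⟨ W.trans (⊗ʷ-cong {g = onePlusX ⊗ʷ V r} (inv₁-inverse D (powers-0 (2 * r ∸ 1))) W.refl) (W.*-identityˡ _) N ⟩
  (onePlusX ⊗ʷ V r) N
    ≈⟨ W.trans (onePlusX-V r) (Ŷ-F r 1≤r) N ⟩
  (F r ∘ˢ substT) N ∎)
  where
  open import Relation.Binary.PropositionalEquality.Properties using (setoid)
  open import Relation.Binary.Reasoning.Setoid (setoid ℤ)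
  open import Algebra.Solver.Ring.NaturalCoefficients.Default W.commutativeSemiring using (solve; _:=_; _:*_)
  r = suc a
  D = oneMinusX ^ˢ (2 * r ∸ 1)
  -- The numerator (1-w)^(2r-1) Vᵣ; cutting off its factor w^(r+1) leaves the polynomial sought.
  g : PS
  g = powers (suc (2 * a)) ⊗ʷ V r
  P : Vec ℤ (3 * r ∸ 2)
  P = window (λ i → g (suc r + i)) (3 * r ∸ 2)
  D-powers : powers (suc (2 * a)) ≋ʷ D
  D-powers = W.trans (powers-^ˢ (suc (2 * a))) (λ i → cong (λ e → (oneMinusX ^ˢ e) i) (sym (ℕ.+-suc a (a + 0))))
  g-low : ∀ i → i < suc r → g i ≡ + 0
  g-low i i<r = proj₁ (V-shape r) i (subst (i <_) (ℕ.+-comm 2 a) i<r)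
  degree : ∀ a → 3 * suc a ≡ 2 + (3 * a + 1)
  degree = solve-∀
  -- The first exponent beyond the support of g is 4a+3. Less the r+1 = a+2 shifted away, this is
  -- 3a+1 = 3r-2, the length of P.
  high : ∀ a → suc (4 * a + 2) ≡ suc (suc a) + (3 * a + 1)
  high = solve-∀
  P-g : poly P ≋ʷ λ i → g (suc r + i)
  P-g = poly-window (λ i → g (suc r + i)) (3 * r ∸ 2) λ i d≤i → proj₂ (V-shape r) (suc r + i)
    (ℕ.≤-trans (ℕ.≤-reflexive (high a)) (ℕ.+-monoʳ-≤ (suc r)
      (ℕ.≤-trans (ℕ.≤-reflexive (sym (cong (_∸ 2) (degree a)))) d≤i)))
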